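{- Let $m\equiv 2\pmod 4$, $n=2m$, $\mathbb M=\mathbb F_{2^m}$. Let $q=2^k$ with $0<k<m$, $\gcd(k,m)=1$, $r=2^{k+m/2}$, let $a\in\mathbb F_{2^{m/2}}^\times$ and let $B\in\mathbb M^\times$ be a non-cube with $B^{q+r}\neq a^{q+1}$. Then the APN function $F$ on $\mathbb F_{2^n}\cong\mathbb M\times\mathbb M$ given by $$F(x,y)=\left(x^{q+1}+By^{q+1},\;x^ry+\tfrac{a}{B}xy^r\right)$$ (that is, every function in the family $\mathcal F_4$) is $3$-to-$1$ and has classical Walsh spectrum.
   Context: $\mathbb F_{2^n}$ is identified with $\mathbb M\times\mathbb M$ as an $\mathbb F_2$-vector space. A function $F$ on a finite $\mathbb F_2$-vector space is called $3$-to-$1$ here if $F(z)=0$ if and only if $z=0$, and every nonzero element of the image of $F$ has precisely $3$ preimages. For $F:\mathbb F_{2^n}\to\mathbb F_{2^n}$ and $a,b\in\mathbb F_{2^n}$ put $W_F(b,a)=\sum_{x\in\mathbb F_{2^n}}(-1)^{\mathrm{Tr}(bF(x)+ax)}\in\mathbb Z$, with $\mathrm{Tr}$ the absolute trace of $\mathbb F_{2^n}$. The extended Walsh spectrum of $F$ is the multiset $\{|W_F(b,a)|: b\in\mathbb F_{2^n}^\times,\,a\in\mathbb F_{2^n}\}$ (it does not depend on the chosen $\mathbb F_2$-linear identification). For even $n$, $F$ has classical Walsh spectrum if its extended Walsh spectrum contains the values $0$, $2^{n/2}$, $2^{(n+2)/2}$ precisely $(2^n-1)2^{n-2}$ times,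 $(2^n-1)2^{n+1}/3$ times, and $(2^n-1)2^{n-2}/3$ times, respectively. -}

module Defs where

open import Algebra.Bundles using (CommutativeRing)
open import Algebra.Core using (Op₁; Op₂)
import Algebra.Properties.Semiring.Exp as SemiringExp
import Algebra.Properties.CommutativeMonoid.Sum as CommutativeMonoidSum
open import Algebra.Structures using (IsCommutativeRing)
open import Data.Fin.Base using (Fin; toℕ)
import Data.Fin.Properties as Fin
open import Data.Integer.Base using (ℤ; ∣_∣; 1ℤ; -1ℤ)
import Data.Integer.Properties as ℤ
open import Data.List.Base using (List; cartesianProduct; filter; length; map; tabulate)
open import Data.Nat.Base as ℕ using (ℕ; _∸_; _≤_)
import Data.Nat.Properties as ℕ
open import Data.Nat.DivMod using (_/_)
open import Data.Product.Base using (∃; _×_; _,_)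
open import Data.Product.Properties using (≡-dec)
open import Function.Base using (_∘_)
open import Function.Bundles using (_↔_; _⇔_; Inverse)
open import Function.Construct.Symmetry using (↔-sym)
open import Function.Properties.Inverse using (↔⇒↣)
open import Level using (0ℓ)
open import Relation.Binary.Definitions using (DecidableEquality)
open import Relation.Binary.PropositionalEquality using (_≡_; _≢_)
open import Relation.Nullary.Decidable using (does; via-injection; ¬?)
open import Data.Bool.Base using (if_then_else_)

-- A field with 2ⁿ elements. Inversion is total; its value at 0# is unspecified.
record BinaryField (n : ℕ) : Set₁ where
  infixl 6 _+_
  infixl 7 _*_
  infix  8 -_
  infix  9 _⁻¹
  field
    Carrier           : Set
    _+_ _*_           : Op₂ Carrier
    -_                : Op₁ Carrier
    0# 1#             : Carrier
    isCommutativeRing : IsCommutativeRing _≡_ _+_ _*_ -_ 0# 1#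
    0#≢1#             : 0# ≢ 1#
    _⁻¹               : Op₁ Carrier
    *-inverseʳ        : ∀ {x} → x ≢ 0# → x * x ⁻¹ ≡ 1#
    enumeration       : Fin (2 ℕ.^ n) ↔ Carrier

  commutativeRing : CommutativeRing 0ℓ 0ℓ
  commutativeRing = record { isCommutativeRing = isCommutativeRing }

  open CommutativeRing commutativeRing public
    using (rawRing; semiring; +-commutativeMonoid)
  open SemiringExp semiring public using (_^_)

  infix 4 _≟_
  _≟_ : DecidableEquality Carrier
  _≟_ = via-injection (↔⇒↣ (↔-sym enumeration)) Fin._≟_

  elements : List Carrier
  elements = tabulate (Inverse.to enumeration)

module Plane {m : ℕ} (M : BinaryField m) where
  open BinaryField M

  M² : Set
  M² = Carrier × Carrier

  0² : M²
  0² = 0# , 0#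

  infixl 6 _+²_
  _+²_ : Op₂ M²
  (x , y) +² (x′ , y′) = (x + x′) , (y + y′)

  infix 4 _≟²_
  _≟²_ : DecidableEquality M²
  _≟²_ = ≡-dec _≟_ _≟_

  elements² : List M²
  elements² = cartesianProduct elements elements

  #preimages : (M² → M²) → M² → ℕ
  #preimages F w = length (filter (λ z → F z ≟² w) elements²)

  APN : (M² → M²) → Set
  APN F = ∀ c d → c ≢ 0² → #preimages (λ z → F (z +² c) +² F z) d ≤ 2

  ThreeToOne : (M² → M²) → Set
  ThreeToOne F =
    (∀ z → F z ≡ 0² ⇔ z ≡ 0²) ×
    (∀ w → w ≢ 0² → (∃ λ z → F z ≡ w) → #preimages F w ≡ 3)

  family₄ : (q r : ℕ) (a B : Carrier) → M² → M²
  family₄ q r a B (x , y) =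
    (x ^ (q ℕ.+ 1) + B * y ^ (q ℕ.+ 1)) ,
    (x ^ r * y + a * B ⁻¹ * (x * y ^ r))

  -- Additive maps are automatically linear over the prime field.
  record LinearIdentification {n : ℕ} (L : BinaryField n) : Set where
    private module L = BinaryField L
    field
      bijection : M² ↔ L.Carrier
    open Inverse bijection public using (to; from)
    field
      to-+ : ∀ u v → to (u +² v) ≡ to u L.+ to v

    transport : (M² → M²) → L.Carrier → L.Carrier
    transport F = to ∘ F ∘ from

module Walsh {n : ℕ} (L : BinaryField n) where
  open BinaryField L
  private
    module Σᴸ = CommutativeMonoidSum +-commutativeMonoid
    module Σᶻ = CommutativeMonoidSum ℤ.+-0-commutativeMonoid

  Tr : Carrier → Carrier
  Tr x = Σᴸ.sum {n} λ i → x ^ (2 ℕ.^ toℕ i)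

  -- (-1)ᵗ for t in the prime field {0#, 1#}, where Tr takes its values.
  sign : Carrier → ℤ
  sign t = if does (t ≟ 0#) then 1ℤ else -1ℤ

  W : (Carrier → Carrier) → Carrier → Carrier → ℤ
  W F b a = Σᶻ.sum λ i →
    let x = Inverse.to enumeration i in sign (Tr (b * F x + a * x))

  -- A multiset, represented as a list.
  extendedWalshSpectrum : (Carrier → Carrier) → List ℕ
  extendedWalshSpectrum F =
    map (λ (b , a) → ∣ W F b a ∣)
        (cartesianProduct (filter (λ b → ¬? (b ≟ 0#)) elements) elements)

  multiplicity : ℕ → List ℕ → ℕ
  multiplicity v s = length (filter (v ℕ.≟_) s)

  -- Meaningful for even n ≥ 2 only: then all the divisions below are exact.
  ClassicalWalshSpectrum : (Carrier → Carrier) → Set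
  ClassicalWalshSpectrum F =
    let s = extendedWalshSpectrum F in
    multiplicity 0                     s ≡ (2 ℕ.^ n ∸ 1) ℕ.* 2 ℕ.^ (n ∸ 2) ×
    multiplicity (2 ℕ.^ (n / 2))       s ≡ ((2 ℕ.^ n ∸ 1) ℕ.* 2 ℕ.^ (n ℕ.+ 1)) / 3 ×
    multiplicity (2 ℕ.^ ((n ℕ.+ 2) / 2)) s ≡ ((2 ℕ.^ n ∸ 1) ℕ.* 2 ℕ.^ (n ∸ 2)) / 3

{-# OPTIONS --safe #-}

-- APN: write σ for the q-th power map, τ for the involution of M over K (so x^r = σ τ x) and, for
-- uv ≠ 0, x = uX, y = vY, t = v/u. The kernel of the polar form of F at (u , v) is then given by
-- σ X + X = A (σ Y + Y) and A (σ τ X + Y) = e (X + σ τ Y) with A = B t^(q+1) and τ e = e. With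
-- Z = X + τ Y these imply (A τ A + e) σ Z = (e + 1) A τ Z. Elements fixed by τ are cubes, and so is
-- x^(r-1), but A is not; hence Z = 0, which leaves X = Y ∈ {0, 1}.
-- The hypothesis B^(q+r) ≠ a^(q+1) excludes the degenerate case A τ A = e = 1.
--
-- 3-to-1: F is invariant under T (x , y) = (ω x , ω² y) with ω of order 3, and T c solves
-- F (z + c) = F z, so by the APN property the fibres are the orbits of T.
--
-- Spectrum: let v = (-2)^m, so v² = N = 2ⁿ. For b ≠ 0, W(b,a)² is 0 or κ N for an integer κ depending
-- on b only, and W(b,0) ≡ 1 ≡ v modulo 3 by the 3-to-1 property. This forces
-- (W(b,0) - v) (W(b,0) + 2v) ≥ 0, while the first two moments of W(b,0) show that these terms sum
-- to 0. So W(b,0) is v or -2v, κ is 1 or 4, and Parseval's identity gives the multiplicities.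
module Submission where

open import Algebra.Bundles using (CommutativeMonoid; CommutativeRing)
import Algebra.Definitions.RawMonoid as RawMonoidDefinitions
open import Algebra.Morphism.Structures using (IsRingHomomorphism)
import Algebra.Properties.CommutativeMonoid.Sum as CommutativeMonoidSum
import Algebra.Properties.CommutativeSemiring.Exp as CommutativeSemiringExp
import Algebra.Properties.Ring as RingProperties
import Algebra.Properties.Semiring.Sum as SemiringSum
import Algebra.Solver.Ring as RingSolver
open import Algebra.Solver.Ring.AlmostCommutativeRing using (AlmostCommutativeRing; _-Raw-AlmostCommutative⟶_)
open import Data.Bool.Base using (Bool; false; if_then_else_; true)
import Data.Bool.Properties as Bool
open import Data.Empty using (⊥; ⊥-elim)
open import Data.Fin.Base using (Fin; fromℕ; inject₁; suc; toℕ; zero)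
open import Data.Fin.Permutation using (Permutation; permutation)
import Data.Fin.Properties as Fin
open import Data.Integer.Base as ℤ using (-1ℤ; -[1+_]; 0ℤ; 1ℤ; ℤ; ∣_∣)
import Data.Integer.Properties as ℤ
import Data.Integer.Solver as ℤ
open import Data.List.Base as List using (List; []; _++_; _∷_; cartesianProduct; filter; length; map; replicate; tabulate)
open import Data.List.Membership.DecPropositional using (_∈?_)
open import Data.List.Membership.Propositional using (_∈_)
open import Data.List.Membership.Propositional.Properties using (∈-++⁺ʳ; ∈-++⁺ˡ; ∈-++⁻; ∈-cartesianProduct⁺; ∈-filter⁺; ∈-filter⁻; ∈-map⁺; ∈-map⁻; ∈-tabulate⁺; ∈-∃++)
import Data.List.Properties as List
open import Data.List.Relation.Unary.All as All using (All; []; _∷_)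
open import Data.List.Relation.Unary.All.Properties using (¬Any⇒All¬)
open import Data.List.Relation.Unary.AllPairs using ([]; _∷_)
open import Data.List.Relation.Unary.Any as Any using (here; there)
open import Data.List.Relation.Unary.Unique.Propositional using (Unique)
import Data.List.Relation.Unary.Unique.Propositional.Properties as Unique
open import Data.Maybe.Base using (Maybe; just; nothing)
open import Data.Nat.Base as ℕ using (_<_; _≤_; suc; s≤s; zero; z≤n; ℕ)
open import Data.Nat.DivMod using (_%_; _/_; m%n<n; m*n/n≡m; m≡m%n+[m/n]*n)
open import Data.Nat.Divisibility as ℕ using (_∣?_; divides; ∣1⇒≡1)
open import Data.Nat.GCD using (GCD; gcd; gcd-GCD; gcd-greatest; module Bézout)
import Data.Nat.Properties as ℕ
open import Data.Nat.Solver as ℕ using (module +-*-Solver)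
open import Data.Product.Base using (_,_; _×_; proj₁; proj₂; ∃)
open import Data.Sum.Base as Sum using ([_,_]′; _⊎_; inj₁; inj₂)
open import Defs
open import Function.Base using (_∘_)
open import Function.Bundles using (Equivalence; Inverse; _↔_; _⇔_; mk⇔)
open import Level using (0ℓ)
open import Relation.Binary.Definitions using (tri<; tri>; tri≈)
open import Relation.Binary.PropositionalEquality
open import Relation.Nullary.Decidable using (Dec; _×-dec_; dec-false; dec-true; decidable-stable; does; from-no; no; yes; ¬?)
open import Relation.Nullary.Negation using (¬_)
open import Relation.Unary using (Decidable)

-- The cubes come from parity. As m = 2 modulo 4, h = m/2 is odd, and k, being prime to the even m,
-- is odd as well. Hence 3 divides q + 1, so t^(q+1) is a cube and A is B times a cube; r = 1 modulo
-- 3, so x^(r-1) is a cube; and 3 is prime to 2^h - 1, so cubing is onto among the elements fixed by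
-- τ. The same residues give ω^(q+1) = 1 and ω^r = ω, which makes T a symmetry of F. The spectrum is
-- computed for any quadratic 3-to-1 function. W(b,a)² is a sum over c of the sign of b F(c) + a c
-- times a complete character sum of the polar form, and the latter is N or 0 according to whether c
-- lies in the kernel. On the kernel the sign is a character, so it sums to 0 or to the kernel size
-- κ. The moments are counts: summed over all b, W(b,0) gives N times the number of zeros, and
-- W(b,0)² gives N times the number of pairs with F x = F y, which is 3 (N - 1) + 1. Removing b = 0
-- leaves 0 and 2N (N - 1), exactly what cancels the term -2v² summed N - 1 times. The sign of v is
-- chosen so that v, like W(b,0), is 1 modulo 3.

Unique-⊆⇒length≤ : ∀ {A : Set} {xs ys : List A} → Unique xs →
  (∀ {x} → x ∈ xs → x ∈ ys) → length xs ≤ length ys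
Unique-⊆⇒length≤ [] xs⊆ys = z≤n
Unique-⊆⇒length≤ {xs = x ∷ xs} (x∉xs ∷ xs!) xs⊆ys with ∈-∃++ (xs⊆ys (here refl))
... | ls , rs , refl = begin
  suc (length xs)              ≤⟨ s≤s (Unique-⊆⇒length≤ xs! xs⊆ls++rs) ⟩
  suc (length (ls ++ rs))      ≡⟨ cong suc (List.length-++ ls) ⟩
  suc (length ls ℕ.+ length rs) ≡⟨ ℕ.+-suc (length ls) (length rs) ⟨
  length ls ℕ.+ suc (length rs) ≡⟨ List.length-++ ls ⟨
  length (ls ++ x ∷ rs)        ∎
  where
  open ℕ.≤-Reasoning
  xs⊆ls++rs : ∀ {y} → y ∈ xs → y ∈ ls ++ rs
  xs⊆ls++rs y∈xs with ∈-++⁻ ls (xs⊆ys (there y∈xs))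
  ... | inj₁ y∈ls         = ∈-++⁺ˡ y∈ls
  ... | inj₂ (here refl)  = ⊥-elim (All.lookup x∉xs y∈xs refl)
  ... | inj₂ (there y∈rs) = ∈-++⁺ʳ ls y∈rs

-- Sums over an enumerated finite set with values in a commutative monoid.

module EnumeratedSum {N : ℕ} {A : Set} (enum : Fin N ↔ A) (C : CommutativeMonoid 0ℓ 0ℓ) where
  open CommutativeMonoid C using (_≈_; ε; _∙_; ∙-cong; identityʳ; identityˡ) renaming (Carrier to X)
  private
    module C = CommutativeMonoid C
    open CommutativeMonoidSum C
    open RawMonoidDefinitions C.rawMonoid using () renaming (_×_ to _·_)
  open Inverse enum using (to; from)

  ∑ : (A → X) → X
  ∑ f = sum (f ∘ to)

  private
    sum-single : ∀ {n} (i : Fin n) (f : Fin n → X) → (∀ j → j ≢ i → f j ≈ ε) → sum f ≈ f i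
    sum-single {suc n} zero f f≈ε = C.trans
      (∙-cong C.refl (C.trans (sum-cong-≋ (λ j → f≈ε (suc j) λ ())) (sum-replicate-zero n)))
      (identityʳ _)
    sum-single {suc n} (suc i) f f≈ε = C.trans
      (∙-cong (f≈ε zero λ ())
        (sum-single i (f ∘ suc) λ j j≢i → f≈ε (suc j) (j≢i ∘ Fin.suc-injective)))
      (identityˡ _)

  ∑-cong : ∀ {f g} → (∀ x → f x ≈ g x) → ∑ f ≈ ∑ g
  ∑-cong f≈g = sum-cong-≋ λ i → f≈g (to i)

  ∑-∙ : ∀ f g → ∑ (λ x → f x ∙ g x) ≈ ∑ f ∙ ∑ g
  ∑-∙ f g = ∑-distrib-+ (f ∘ to) (g ∘ to)

  ∑-single : ∀ a f → (∀ x → x ≢ a → f x ≈ ε) → ∑ f ≈ f a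
  ∑-single a f f≈ε = C.trans
    (sum-single (from a) (f ∘ to) λ j j≢ → f≈ε (to j) λ eq →
      j≢ (trans (sym (Inverse.strictlyInverseʳ enum j)) (cong from eq)))
    (C.reflexive (cong f (Inverse.strictlyInverseˡ enum a)))

  ∑-reindex : ∀ f (p p⁻¹ : A → A) → (∀ x → p (p⁻¹ x) ≡ x) → (∀ x → p⁻¹ (p x) ≡ x) →
    ∑ f ≈ ∑ (f ∘ p)
  ∑-reindex f p p⁻¹ pp⁻¹ p⁻¹p = C.trans (sum-permute (f ∘ to) π)
    (sum-cong-≋ {N} λ i → C.reflexive (cong f (Inverse.strictlyInverseˡ enum (p (to i)))))
    where
    conj : ∀ (g h : A → A) → (∀ x → g (h x) ≡ x) →
      ∀ i → from (g (to (from (h (to i))))) ≡ i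
    conj g h gh i = trans (cong (from ∘ g) (Inverse.strictlyInverseˡ enum _))
      (trans (cong from (gh _)) (Inverse.strictlyInverseʳ enum i))
    π : Permutation N N
    π = permutation (from ∘ p ∘ to) (from ∘ p⁻¹ ∘ to) (conj p p⁻¹ pp⁻¹) (conj p⁻¹ p p⁻¹p)

  ∑-const : ∀ x → ∑ (λ _ → x) ≈ N · x
  ∑-const x = sum-replicate N

-- Arithmetic of a field with 2^n elements, from its cardinality.

module FieldProperties {n : ℕ} (F : BinaryField n) where
  open BinaryField F public hiding (rawRing; semiring; +-commutativeMonoid)
  open CommutativeRing commutativeRing public
    using (ring; commutativeSemiring; *-commutativeMonoid; +-assoc; +-comm; +-identityˡ; +-identityʳ; -‿inverseʳ;
      *-assoc; *-comm; *-identityˡ; *-identityʳ; distribˡ; distribʳ; zeroˡ; zeroʳ)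
  open CommutativeSemiringExp commutativeSemiring public
    using (^-homo-*; ^-assocʳ; ^-distrib-*)
  open Inverse enumeration public using (to; from)
  open ≡-Reasoning

  *-inverseˡ : ∀ {x} → x ≢ 0# → x ⁻¹ * x ≡ 1#
  *-inverseˡ x≢0 = trans (*-comm _ _) (*-inverseʳ x≢0)

  *-cancelˡ : ∀ {x y z} → x ≢ 0# → x * y ≡ x * z → y ≡ z
  *-cancelˡ {x} {y} {z} x≢0 eq = begin
    y                ≡⟨ lemma y ⟨
    x ⁻¹ * (x * y)   ≡⟨ cong (x ⁻¹ *_) eq ⟩
    x ⁻¹ * (x * z)   ≡⟨ lemma z ⟩
    z                ∎
    where
    lemma : ∀ w → x ⁻¹ * (x * w) ≡ w
    lemma w = trans (sym (*-assoc _ _ _)) (trans (cong (_* w) (*-inverseˡ x≢0)) (*-identityˡ w))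

  *-zero-cancelˡ : ∀ {x y} → x ≢ 0# → x * y ≡ 0# → y ≡ 0#
  *-zero-cancelˡ x≢0 eq = *-cancelˡ x≢0 (trans eq (sym (zeroʳ _)))

  *-nonZero : ∀ {x y} → x ≢ 0# → y ≢ 0# → x * y ≢ 0#
  *-nonZero x≢0 y≢0 eq = y≢0 (*-zero-cancelˡ x≢0 eq)

  ^-nonZero : ∀ {x} k → x ≢ 0# → x ^ k ≢ 0#
  ^-nonZero zero    x≢0 eq = 0#≢1# (sym eq)
  ^-nonZero (suc k) x≢0 = *-nonZero x≢0 (^-nonZero k x≢0)

  1^ : ∀ k → 1# ^ k ≡ 1#
  1^ zero    = refl
  1^ (suc k) = trans (*-identityˡ _) (1^ k)

  elements-unique : Unique elements
  elements-unique = Unique.tabulate⁺ λ {i} {j} eq → trans (sym (Inverse.strictlyInverseʳ enumeration i))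
    (trans (cong from eq) (Inverse.strictlyInverseʳ enumeration j))

  ∈-elements : ∀ x → x ∈ elements
  ∈-elements x = subst (_∈ elements) (Inverse.strictlyInverseˡ enumeration x) (∈-tabulate⁺ (from x))

  private
    open module ∏ = EnumeratedSum enumeration *-commutativeMonoid using () renaming (∑ to ∏)

    if-zero : ∀ {A : Set} {x} {a b : A} → x ≡ 0# → (if does (x ≟ 0#) then a else b) ≡ a
    if-zero {x = x} {a} {b} eq = cong (if_then a else b) (dec-true (x ≟ 0#) eq)

    if-nonZero : ∀ {A : Set} {x} {a b : A} → x ≢ 0# → (if does (x ≟ 0#) then a else b) ≡ b
    if-nonZero {x = x} {a} {b} eq = cong (if_then a else b) (dec-false (x ≟ 0#) eq)

    ∏-nonZero : ∀ f → (∀ x → f x ≢ 0#) → ∏ f ≢ 0#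
    ∏-nonZero f f≢0 = go (f ∘ to) (f≢0 ∘ to)
      where
      go : ∀ {k} (g : Fin k → Carrier) → (∀ i → g i ≢ 0#) →
        CommutativeMonoidSum.sum *-commutativeMonoid g ≢ 0#
      go {zero}  g g≢0 eq = 0#≢1# (sym eq)
      go {suc k} g g≢0 = *-nonZero (g≢0 zero) (go (g ∘ suc) (g≢0 ∘ suc))

  -- Multiplication by x ≠ 0 permutes the nonzero elements, so it fixes their product.
  fermat : ∀ x → x ^ (2 ℕ.^ n) ≡ x
  fermat x with x ≟ 0#
  ... | yes refl = lemma (2 ℕ.^ n) (ℕ.m^n>0 2 n)
    where
    lemma : ∀ k → 0 < k → 0# ^ k ≡ 0#
    lemma (suc k) _ = zeroˡ _
  ... | no x≢0 = begin
    x ^ (2 ℕ.^ n)                  ≡⟨ ∏.∑-const x ⟨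
    ∏ (λ _ → x)                    ≡⟨ ∏.∑-cong split ⟩
    ∏ (λ y → scale y * marker y)   ≡⟨ ∏.∑-∙ scale marker ⟩
    ∏ scale * ∏ marker             ≡⟨ cong₂ _*_ ∏scale (∏.∑-single 0# marker λ y → if-nonZero) ⟩
    1# * marker 0#                 ≡⟨ trans (*-identityˡ _) (if-zero refl) ⟩
    x                              ∎
    where
    -- The product runs over 0 too, which must not spoil it: `unit` puts 1 there, and `marker`
    -- collects the one factor x that belongs to the index 0. This extra factor is why the exponent
    -- is 2^n and not 2^n - 1.
    scale marker unit : Carrier → Carrier
    scale  y = if does (y ≟ 0#) then 1# else x
    marker y = if does (y ≟ 0#) then x else 1#
    unit   y = if does (y ≟ 0#) then 1# else y

    by-cases : ∀ {P : Carrier → Set} → P 0# → (∀ y → y ≢ 0# → P y) → ∀ y → P y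
    by-cases P0 P≢0 y with y ≟ 0#
    ... | yes refl = P0
    ... | no  y≢0  = P≢0 y y≢0

    split : ∀ y → x ≡ scale y * marker y
    split = by-cases
      (sym (trans (cong₂ _*_ (if-zero refl) (if-zero refl)) (*-identityˡ x)))
      (λ y y≢0 → sym (trans (cong₂ _*_ (if-nonZero y≢0) (if-nonZero y≢0)) (*-identityʳ x)))

    unit≢0 : ∀ y → unit y ≢ 0#
    unit≢0 = by-cases
      (subst (_≢ 0#) (sym (if-zero refl)) (0#≢1# ∘ sym))
      (λ y y≢0 → subst (_≢ 0#) (sym (if-nonZero y≢0)) y≢0)

    unit-scale : ∀ y → unit (x * y) ≡ scale y * unit y
    unit-scale = by-cases
      (trans (if-zero (zeroʳ x)) (sym (trans (cong₂ _*_ (if-zero refl) (if-zero refl)) (*-identityˡ 1#))))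
      (λ y y≢0 → trans (if-nonZero (*-nonZero x≢0 y≢0))
        (sym (cong₂ _*_ (if-nonZero y≢0) (if-nonZero y≢0))))

    ∏scale : ∏ scale ≡ 1#
    ∏scale = *-cancelˡ (∏-nonZero unit unit≢0) (begin
      ∏ unit * ∏ scale             ≡⟨ *-comm _ _ ⟩
      ∏ scale * ∏ unit             ≡⟨ ∏.∑-∙ scale unit ⟨
      ∏ (λ y → scale y * unit y)   ≡⟨ ∏.∑-cong (sym ∘ unit-scale) ⟩
      ∏ (unit ∘ (x *_))            ≡⟨ ∏.∑-reindex unit (x *_) (x ⁻¹ *_) (inv x≢0 (*-inverseʳ x≢0)) (inv x≢0 (*-inverseˡ x≢0)) ⟨
      ∏ unit                       ≡⟨ *-identityʳ _ ⟨
      ∏ unit * 1#                  ∎)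
      where
      inv : ∀ {a b} → x ≢ 0# → a * b ≡ 1# → ∀ y → a * (b * y) ≡ y
      inv _ eq y = trans (sym (*-assoc _ _ _)) (trans (cong (_* y) eq) (*-identityˡ y))

  -- Characteristic 2 is extracted from the cardinality. By `fermat`, -1 equals (-1)^(2^n), which
  -- for n > 0 is a power of (-1)² = 1; for n = 0 a single element would have to be both 0 and 1.
  -- The exponent `k` stands for n, a module parameter that cannot be split.
  1+1≡0 : 1# + 1# ≡ 0#
  1+1≡0 = trans (cong (1# +_) (sym (-1≡1 n (fermat (- 1#)) enumeration))) (-‿inverseʳ 1#)
    where
    -1≡1 : ∀ k → (- 1#) ^ (2 ℕ.^ k) ≡ - 1# → Fin (2 ℕ.^ k) ↔ Carrier → - 1# ≡ 1#
    -1≡1 zero _ e = ⊥-elim (0#≢1# (trans (sym (Inverse.strictlyInverseˡ e 0#))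
      (trans (cong (Inverse.to e) (all-equal _ _)) (Inverse.strictlyInverseˡ e 1#))))
      where
      all-equal : ∀ (i j : Fin 1) → i ≡ j
      all-equal zero zero = refl
    -1≡1 (suc k) eq _ = begin
      - 1#                          ≡⟨ eq ⟨
      (- 1#) ^ (2 ℕ.* 2 ℕ.^ k)      ≡⟨ ^-assocʳ (- 1#) 2 (2 ℕ.^ k) ⟨
      ((- 1#) ^ 2) ^ (2 ℕ.^ k)      ≡⟨ cong (_^ (2 ℕ.^ k)) sq ⟩
      1# ^ (2 ℕ.^ k)                ≡⟨ 1^ (2 ℕ.^ k) ⟩
      1#                            ∎
      where
      open RingProperties ring
      sq : (- 1#) ^ 2 ≡ 1#
      sq = begin
        - 1# * (- 1# * 1#) ≡⟨ cong (- 1# *_) (*-identityʳ _) ⟩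
        - 1# * - 1#        ≡⟨ -1*x≈-x _ ⟩
        - (- 1#)           ≡⟨ -‿involutive 1# ⟩
        1#                 ∎

  x+x≡0 : ∀ x → x + x ≡ 0#
  x+x≡0 x = begin
    x + x             ≡⟨ cong₂ _+_ (*-identityˡ x) (*-identityˡ x) ⟨
    1# * x + 1# * x   ≡⟨ distribʳ x 1# 1# ⟨
    (1# + 1#) * x     ≡⟨ cong (_* x) 1+1≡0 ⟩
    0# * x            ≡⟨ zeroˡ x ⟩
    0#                ∎

  -- A ring solver over 𝔽₂: taking - to be the identity is legitimate in characteristic 2.
  private
    almostCommutativeRing : AlmostCommutativeRing 0ℓ 0ℓ
    almostCommutativeRing = record
      { Carrier = Carrier ; _≈_ = _≡_ ; _+_ = _+_ ; _*_ = _*_ ; -_ = λ x → x ; 0# = 0# ; 1# = 1#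
      ; isAlmostCommutativeRing = record
        { isCommutativeSemiring = CommutativeRing.isCommutativeSemiring commutativeRing
        ; -‿cong = λ eq → eq ; -‿*-distribˡ = λ _ _ → refl ; -‿+-comm = λ _ _ → refl } }

    𝔽₂ = CommutativeRing.rawRing Bool.xor-∧-commutativeRing

    embed : 𝔽₂ -Raw-AlmostCommutative⟶ almostCommutativeRing
    embed = record
      { ⟦_⟧ = λ b → if b then 1# else 0#
      ; +-homo = λ { false _ → sym (+-identityˡ _) ; true false → sym (+-identityʳ _) ; true true → sym 1+1≡0 }
      ; *-homo = λ { false _ → sym (zeroˡ _) ; true _ → sym (*-identityˡ _) }
      ; -‿homo = λ { false → refl ; true → refl }
      ; 0-homo = refl ; 1-homo = refl }

    coefficient≟ : ∀ b b′ → Maybe ((if b then 1# else 0#) ≡ (if b′ then 1# else 0#))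
    coefficient≟ false false = just refl
    coefficient≟ true  true  = just refl
    coefficient≟ false true  = nothing
    coefficient≟ true  false = nothing

  open RingSolver 𝔽₂ almostCommutativeRing embed coefficient≟ public using (solve; _:=_; _:+_; _:*_; con)

  +-self-cancel : ∀ x y → x + (x + y) ≡ y
  +-self-cancel = solve 2 (λ x y → x :+ (x :+ y) := y) refl

  x+y≡0⇒x≡y : ∀ {x y} → x + y ≡ 0# → x ≡ y
  x+y≡0⇒x≡y {x} {y} eq = begin
    x            ≡⟨ +-identityʳ x ⟨
    x + 0#       ≡⟨ cong (x +_) eq ⟨
    x + (x + y)  ≡⟨ +-self-cancel x y ⟩
    y            ∎

  frobenius-+ : ∀ k x y → (x + y) ^ (2 ℕ.^ k) ≡ x ^ (2 ℕ.^ k) + y ^ (2 ℕ.^ k)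
  frobenius-+ zero x y = trans (*-identityʳ _) (sym (cong₂ _+_ (*-identityʳ x) (*-identityʳ y)))
  frobenius-+ (suc k) x y = begin
    (x + y) ^ (2 ℕ.* 2 ℕ.^ k)                              ≡⟨ square-first (x + y) ⟩
    ((x + y) * (x + y)) ^ (2 ℕ.^ k)                        ≡⟨ cong (_^ (2 ℕ.^ k)) (solve 2 (λ x y → (x :+ y) :* (x :+ y) := x :* x :+ y :* y) refl x y) ⟩
    (x * x + y * y) ^ (2 ℕ.^ k)                            ≡⟨ frobenius-+ k _ _ ⟩
    (x * x) ^ (2 ℕ.^ k) + (y * y) ^ (2 ℕ.^ k)              ≡⟨ cong₂ _+_ (square-first x) (square-first y) ⟨
    x ^ (2 ℕ.* 2 ℕ.^ k) + y ^ (2 ℕ.* 2 ℕ.^ k)              ∎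
    where
    square-first : ∀ z → z ^ (2 ℕ.* 2 ℕ.^ k) ≡ (z * z) ^ (2 ℕ.^ k)
    square-first z = trans (sym (^-assocʳ z 2 (2 ℕ.^ k))) (cong (λ w → (z * w) ^ (2 ℕ.^ k)) (*-identityʳ z))

-- Integer identities and inequalities for Walsh values.

m*m≡n*n⇒m≡n : ∀ {m n : ℕ} → m ℕ.* m ≡ n ℕ.* n → m ≡ n
m*m≡n*n⇒m≡n {m} {n} eq with ℕ.<-cmp m n
... | tri< m<n _ _ = ⊥-elim (ℕ.<⇒≢ (ℕ.*-mono-< m<n m<n) eq)
... | tri≈ _ m≡n _ = m≡n
... | tri> _ _ m>n = ⊥-elim (ℕ.<⇒≢ (ℕ.*-mono-< m>n m>n) (sym eq))

*-interchangeℕ : ∀ h d → h ℕ.* h ℕ.* (d ℕ.* d) ≡ d ℕ.* h ℕ.* (d ℕ.* h)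
*-interchangeℕ = solve 2 (λ h d → h :* h :* (d :* d) := d :* h :* (d :* h)) refl
  where open ℕ.+-*-Solver

x*3y : ∀ x y → x ℕ.* (3 ℕ.* y) ≡ x ℕ.* y ℕ.* 3
x*3y = solve 2 (λ x y → x :* (con 3 :* y) := x :* y :* con 3) refl
  where open ℕ.+-*-Solver

module IntegerLemmas where
  open import Data.Integer.Base using (_+_; _*_; -_; _-_)
  open ℤ.+-*-Solver using (solve; con; _:+_; _:*_; :-_; _:-_; _:=_)
  open ≡-Reasoning

  i*i≡∣i∣*∣i∣ : ∀ i → i * i ≡ ℤ.+ (∣ i ∣ ℕ.* ∣ i ∣)
  i*i≡∣i∣*∣i∣ (ℤ.+ n)   = sym (ℤ.pos-* n n)
  i*i≡∣i∣*∣i∣ -[1+ n ] = refl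

  i*i≥0 : ∀ i → 0ℤ ℤ.≤ i * i
  i*i≥0 i = subst (0ℤ ℤ.≤_) (sym (i*i≡∣i∣*∣i∣ i)) (ℤ.+≤+ z≤n)

  i*i≡0⇒i≡0 : ∀ i → i * i ≡ 0ℤ → i ≡ 0ℤ
  i*i≡0⇒i≡0 i eq = [ (λ p → p) , (λ p → p) ]′ (ℤ.i*j≡0⇒i≡0∨j≡0 i eq)

  i≥0∧j≥0⇒i*j≥0 : ∀ {i} n → 0ℤ ℤ.≤ i → 0ℤ ℤ.≤ i * ℤ.+ n
  i≥0∧j≥0⇒i*j≥0 {i} n i≥0 = ℤ.*-monoʳ-≤-nonNeg (ℤ.+ n) i≥0

  i+j≡0⇒both≡0 : ∀ {i j} → 0ℤ ℤ.≤ i → 0ℤ ℤ.≤ j → i + j ≡ 0ℤ → i ≡ 0ℤ × j ≡ 0ℤ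
  i+j≡0⇒both≡0 {ℤ.+ zero} {ℤ.+ zero} _ _ _ = refl , refl
  i+j≡0⇒both≡0 {ℤ.+ zero} {ℤ.+ suc _} _ _ ()
  i+j≡0⇒both≡0 {ℤ.+ suc _} {ℤ.+ _} _ _ ()

  3*i≢-1 : ∀ i → ℤ.+ 3 * i ≢ -1ℤ
  3*i≢-1 i eq = from-no (3 ∣? 1) (divides ∣ i ∣ (trans (sym (cong ∣_∣ eq)) (trans (ℤ.abs-* (ℤ.+ 3) i) (ℕ.*-comm 3 ∣ i ∣))))

  3*i≢-2 : ∀ i → ℤ.+ 3 * i ≢ -[1+ 1 ]
  3*i≢-2 i eq = from-no (3 ∣? 2) (divides ∣ i ∣ (trans (sym (cong ∣_∣ eq)) (trans (ℤ.abs-* (ℤ.+ 3) i) (ℕ.*-comm 3 ∣ i ∣))))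

  -- (W - v)(W + 2v) ≥ 0: modulo 3 we get κ ≡ 1; κ = 1 leaves only W = v, and for κ = 1 + 3u with u ≥ 1
  -- use 4 (W² + vW - 2v²) = 9v² (u - 1) + (W + 2v)².
  gap : ∀ v W κ t Q → v ≡ 1ℤ + ℤ.+ 3 * t → W ≡ 1ℤ + ℤ.+ 3 * Q → W * W ≡ v * v * κ →
    0ℤ ℤ.≤ ℤ.+ 4 * (W * W + v * W - ℤ.+ 2 * (v * v))
  gap v W κ t Q v≡ W≡ W²≡ = cases u κ≡
    where
    -- Squaring gives W² = 1 + 3 (2Q + 3Q²) and v² = 1 + 3 (2t + 3t²). Solving W² = v² κ for the
    -- single κ that is not multiplied by 3 yields κ = 1 + 3u with this `u`.
    u : ℤ
    u = (ℤ.+ 2 * Q + ℤ.+ 3 * (Q * Q)) - κ * (ℤ.+ 2 * t + ℤ.+ 3 * (t * t))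

    κ≡ : κ ≡ 1ℤ + ℤ.+ 3 * u
    κ≡ = begin
      κ
        ≡⟨ solve 2 (λ κ t → κ := (con 1ℤ :+ con (ℤ.+ 3) :* t) :* (con 1ℤ :+ con (ℤ.+ 3) :* t) :* κ
                       :- con (ℤ.+ 3) :* (κ :* (con (ℤ.+ 2) :* t :+ con (ℤ.+ 3) :* (t :* t)))) refl κ t ⟩
      (1ℤ + ℤ.+ 3 * t) * (1ℤ + ℤ.+ 3 * t) * κ - ℤ.+ 3 * (κ * (ℤ.+ 2 * t + ℤ.+ 3 * (t * t)))
        ≡⟨ cong (_- ℤ.+ 3 * (κ * (ℤ.+ 2 * t + ℤ.+ 3 * (t * t)))) (trans (cong (λ v → v * v * κ) (sym v≡)) (trans (sym W²≡) (cong (λ W → W * W) W≡))) ⟩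
      (1ℤ + ℤ.+ 3 * Q) * (1ℤ + ℤ.+ 3 * Q) - ℤ.+ 3 * (κ * (ℤ.+ 2 * t + ℤ.+ 3 * (t * t)))
        ≡⟨ solve 2 (λ Q k → (con 1ℤ :+ con (ℤ.+ 3) :* Q) :* (con 1ℤ :+ con (ℤ.+ 3) :* Q) :- con (ℤ.+ 3) :* k
                      := con 1ℤ :+ con (ℤ.+ 3) :* ((con (ℤ.+ 2) :* Q :+ con (ℤ.+ 3) :* (Q :* Q)) :- k))
             refl Q (κ * (ℤ.+ 2 * t + ℤ.+ 3 * (t * t))) ⟩
      1ℤ + ℤ.+ 3 * u ∎

    W²≡u : ∀ u → κ ≡ 1ℤ + ℤ.+ 3 * u → W * W ≡ v * v * (1ℤ + ℤ.+ 3 * u)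
    W²≡u u eq = trans W²≡ (cong (v * v *_) eq)

    W≢0 : W ≢ 0ℤ
    W≢0 W≡0 = 3*i≢-1 Q (trans
      (solve 1 (λ Q → con (ℤ.+ 3) :* Q := (con 1ℤ :+ con (ℤ.+ 3) :* Q) :- con 1ℤ) refl Q)
      (cong (_- 1ℤ) (trans (sym W≡) W≡0)))

    W≢-v : W ≢ - v
    W≢-v W≡-v = 3*i≢-2 (Q + t) (begin
      ℤ.+ 3 * (Q + t)
        ≡⟨ solve 2 (λ Q t → con (ℤ.+ 3) :* (Q :+ t) := (con 1ℤ :+ con (ℤ.+ 3) :* Q) :+ ((con 1ℤ :+ con (ℤ.+ 3) :* t) :- con (ℤ.+ 2))) refl Q t ⟩
      (1ℤ + ℤ.+ 3 * Q) + ((1ℤ + ℤ.+ 3 * t) - ℤ.+ 2)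
        ≡⟨ cong₂ (λ x y → x + (y - ℤ.+ 2)) (trans (sym W≡) W≡-v) (sym v≡) ⟩
      - v + (v - ℤ.+ 2)
        ≡⟨ solve 1 (λ v → :- v :+ (v :- con (ℤ.+ 2)) := con -[1+ 1 ]) refl v ⟩
      -[1+ 1 ] ∎)

    cases : ∀ u → κ ≡ 1ℤ + ℤ.+ 3 * u → 0ℤ ℤ.≤ ℤ.+ 4 * (W * W + v * W - ℤ.+ 2 * (v * v))
    cases (ℤ.+ zero) κ≡1 = ℤ.≤-reflexive (sym (trans
      (cong (λ W → ℤ.+ 4 * (W * W + v * W - ℤ.+ 2 * (v * v))) W≡v)
      (solve 1 (λ v → con (ℤ.+ 4) :* (v :* v :+ v :* v :- con (ℤ.+ 2) :* (v :* v)) := con 0ℤ) refl v)))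
      where
      W≡v : W ≡ v
      W≡v = [ ℤ.i-j≡0⇒i≡j W v
            , (λ eq → ⊥-elim (W≢-v (trans (solve 2 (λ W v → W := (W :+ v) :- v) refl W v) (trans (cong (_- v) eq) (ℤ.+-identityˡ (- v)))))) ]′
        (ℤ.i*j≡0⇒i≡0∨j≡0 (W - v) (begin
          (W - v) * (W + v)   ≡⟨ solve 2 (λ W v → (W :- v) :* (W :+ v) := W :* W :- v :* v) refl W v ⟩
          W * W - v * v       ≡⟨ cong (_- v * v) (trans (W²≡u 0ℤ κ≡1) (ℤ.*-identityʳ (v * v))) ⟩
          v * v - v * v       ≡⟨ ℤ.+-inverseʳ (v * v) ⟩
          0ℤ                  ∎))
    cases (ℤ.+ suc u′) κ≡u = subst (0ℤ ℤ.≤_) (sym (begin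
      ℤ.+ 4 * (W * W + v * W - ℤ.+ 2 * (v * v))
        ≡⟨ solve 2 (λ W v → con (ℤ.+ 4) :* (W :* W :+ v :* W :- con (ℤ.+ 2) :* (v :* v)) :=
             con (ℤ.+ 3) :* (W :* W) :- con (ℤ.+ 12) :* (v :* v) :+ (W :+ con (ℤ.+ 2) :* v) :* (W :+ con (ℤ.+ 2) :* v)) refl W v ⟩
      ℤ.+ 3 * (W * W) - ℤ.+ 12 * (v * v) + (W + ℤ.+ 2 * v) * (W + ℤ.+ 2 * v)
        ≡⟨ cong (λ w → ℤ.+ 3 * w - ℤ.+ 12 * (v * v) + (W + ℤ.+ 2 * v) * (W + ℤ.+ 2 * v)) (W²≡u (1ℤ + ℤ.+ u′) κ≡u) ⟩
      ℤ.+ 3 * (v * v * (1ℤ + ℤ.+ 3 * (1ℤ + ℤ.+ u′))) - ℤ.+ 12 * (v * v) + (W + ℤ.+ 2 * v) * (W + ℤ.+ 2 * v)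
        ≡⟨ cong (_+ (W + ℤ.+ 2 * v) * (W + ℤ.+ 2 * v))
             (solve 2 (λ v u → con (ℤ.+ 3) :* (v :* v :* (con 1ℤ :+ con (ℤ.+ 3) :* (con 1ℤ :+ u))) :- con (ℤ.+ 12) :* (v :* v)
                          := (con (ℤ.+ 3) :* v) :* (con (ℤ.+ 3) :* v) :* u) refl v (ℤ.+ u′)) ⟩
      (ℤ.+ 3 * v) * (ℤ.+ 3 * v) * ℤ.+ u′ + (W + ℤ.+ 2 * v) * (W + ℤ.+ 2 * v) ∎))
      (ℤ.+-mono-≤ (i≥0∧j≥0⇒i*j≥0 u′ (i*i≥0 (ℤ.+ 3 * v))) (i*i≥0 (W + ℤ.+ 2 * v)))
    -- Here κ = -(2 + 3u′) is negative, so W² + (2 + 3u′) v² = 0 forces W = 0, impossible for W = 1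
    -- modulo 3.
    cases -[1+ u′ ] κ≡u = ⊥-elim (W≢0 (i*i≡0⇒i≡0 W (proj₁ (i+j≡0⇒both≡0 (i*i≥0 W)
      (i≥0∧j≥0⇒i*j≥0 (2 ℕ.+ 3 ℕ.* u′) (i*i≥0 v)) (begin
        W * W + v * v * ℤ.+ (2 ℕ.+ 3 ℕ.* u′)
          ≡⟨ cong₂ (λ x y → x + v * v * y) (W²≡u -[1+ u′ ] κ≡u) (trans (ℤ.pos-+ 2 (3 ℕ.* u′)) (cong (λ w → ℤ.+ 2 + w) (ℤ.pos-* 3 u′))) ⟩
        v * v * (1ℤ + ℤ.+ 3 * (- (1ℤ + ℤ.+ u′))) + v * v * (ℤ.+ 2 + ℤ.+ 3 * ℤ.+ u′)
          ≡⟨ solve 2 (λ v u → v :* v :* (con 1ℤ :+ con (ℤ.+ 3) :* (:- (con 1ℤ :+ u))) :+ v :* v :* (con (ℤ.+ 2) :+ con (ℤ.+ 3) :* u) := con 0ℤ) refl v (ℤ.+ u′) ⟩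
        0ℤ ∎)))))

  -- The expression factors as 4 (W - v) (W + 2v).
  4*[W²+vW-2v²]≡0⇒ : ∀ v W → ℤ.+ 4 * (W * W + v * W - ℤ.+ 2 * (v * v)) ≡ 0ℤ → W ≡ v ⊎ W ≡ -[1+ 1 ] * v
  4*[W²+vW-2v²]≡0⇒ v W eq = Sum.map (ℤ.i-j≡0⇒i≡j W v)
    (λ p → trans (solve 2 (λ W v → W := (W :+ con (ℤ.+ 2) :* v) :+ con -[1+ 1 ] :* v) refl W v)
      (trans (cong (_+ -[1+ 1 ] * v) p) (ℤ.+-identityˡ _)))
    (ℤ.i*j≡0⇒i≡0∨j≡0 (W - v) (trans
      (solve 2 (λ W v → (W :- v) :* (W :+ con (ℤ.+ 2) :* v) := W :* W :+ v :* W :- con (ℤ.+ 2) :* (v :* v)) refl W v)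
      ([ (λ ()) , (λ p → p) ]′ (ℤ.i*j≡0⇒i≡0∨j≡0 (ℤ.+ 4) eq))))

  -- v = (-2)ᵐ
  signed-root : ∀ m → ∃ λ v → v * v ≡ ℤ.+ (2 ℕ.^ (2 ℕ.* m)) × ∣ v ∣ ≡ 2 ℕ.^ m × ∃ λ t → v ≡ 1ℤ + ℤ.+ 3 * t
  signed-root zero = 1ℤ , refl , refl , 0ℤ , refl
  signed-root (suc m) with signed-root m
  ... | v , v²≡ , ∣v∣≡ , t , v≡ = -[1+ 1 ] * v , square , trans (ℤ.abs-* -[1+ 1 ] v) (cong (2 ℕ.*_) ∣v∣≡) ,
      -1ℤ + -[1+ 1 ] * t , trans (cong (-[1+ 1 ] *_) v≡)
        (solve 1 (λ t → con -[1+ 1 ] :* (con 1ℤ :+ con (ℤ.+ 3) :* t) := con 1ℤ :+ con (ℤ.+ 3) :* (con -1ℤ :+ con -[1+ 1 ] :* t)) refl t)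
    where
    square : -[1+ 1 ] * v * (-[1+ 1 ] * v) ≡ ℤ.+ (2 ℕ.^ (2 ℕ.* suc m))
    square = begin
      -[1+ 1 ] * v * (-[1+ 1 ] * v)        ≡⟨ solve 1 (λ v → con -[1+ 1 ] :* v :* (con -[1+ 1 ] :* v) := con (ℤ.+ 4) :* (v :* v)) refl v ⟩
      ℤ.+ 4 * (v * v)                      ≡⟨ cong (ℤ.+ 4 *_) v²≡ ⟩
      ℤ.+ 4 * ℤ.+ (2 ℕ.^ (2 ℕ.* m))        ≡⟨ ℤ.pos-* 4 (2 ℕ.^ (2 ℕ.* m)) ⟨
      ℤ.+ (4 ℕ.* 2 ℕ.^ (2 ℕ.* m))          ≡⟨ cong ℤ.+_ (ℕ.*-assoc 2 2 (2 ℕ.^ (2 ℕ.* m))) ⟩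
      ℤ.+ (2 ℕ.^ (2 ℕ.+ 2 ℕ.* m))          ≡⟨ cong (λ e → ℤ.+ (2 ℕ.^ e)) (ℕ.*-suc 2 m) ⟨
      ℤ.+ (2 ℕ.^ (2 ℕ.* suc m))            ∎

  *-expand : ∀ x i c → x * (i + ℤ.+ 3 * c) ≡ x * i + ℤ.+ 3 * (x * c)
  *-expand = solve 3 (λ x i c → x :* (i :+ con (ℤ.+ 3) :* c) := x :* i :+ con (ℤ.+ 3) :* (x :* c)) refl

  *-zeros : ∀ x y z → x * (0ℤ * y) ≡ 0ℤ * z
  *-zeros = solve 3 (λ x y z → x :* (con 0ℤ :* y) := con 0ℤ :* z) refl

  *-swap : ∀ x y z → x * (y * z) ≡ y * (x * z)
  *-swap = solve 3 (λ x y z → x :* (y :* z) := y :* (x :* z)) refl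

  *-interchange : ∀ d v → d * v * (d * v) ≡ v * v * (d * d)
  *-interchange = solve 2 (λ d v → d :* v :* (d :* v) := v :* v :* (d :* d)) refl

  subtract-self : ∀ x → x + -1ℤ * (1ℤ * x) ≡ 0ℤ * x
  subtract-self = solve 1 (λ x → x :+ con -1ℤ :* (con 1ℤ :* x) := con 0ℤ :* x) refl

  subtract-none : ∀ x → x + -1ℤ * (0ℤ * x) ≡ 1ℤ * x
  subtract-none = solve 1 (λ x → x :+ con -1ℤ :* (con 0ℤ :* x) := con 1ℤ :* x) refl

  3*Q≡ : ∀ Q → ℤ.+ 3 * Q ≡ 1ℤ + ℤ.+ 3 * Q + -1ℤ
  3*Q≡ = solve 1 (λ Q → con (ℤ.+ 3) :* Q := con 1ℤ :+ con (ℤ.+ 3) :* Q :+ con -1ℤ) refl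

  -2* : ∀ x → - (ℤ.+ 2 * x) ≡ -[1+ 1 ] * x * 1ℤ
  -2* = solve 1 (λ x → :- (con (ℤ.+ 2) :* x) := con -[1+ 1 ] :* x :* con 1ℤ) refl

  4*i-i : ∀ i → ℤ.+ 4 * i - i ≡ ℤ.+ 3 * i
  4*i-i = solve 1 (λ i → con (ℤ.+ 4) :* i :- i := con (ℤ.+ 3) :* i) refl

  i≡j+k⇒j≡i-k : ∀ {i j k} → i ≡ j + k → j ≡ i - k
  i≡j+k⇒j≡i-k {i} {j} {k} i≡j+k = trans (solve 2 (λ j k → j := j :+ k :- k) refl j k) (cong (_- k) (sym i≡j+k))

  -- With v² = N and the moments N and N (3N - 2), this is the sum of 4 (W² + vW - 2v²) over all b,
  -- minus the term at b = 0, where W = N.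
  deviation-total : ∀ v N →
    ℤ.+ 4 * (N * (ℤ.+ 3 * N + -[1+ 1 ]) + v * N + -[1+ 1 ] * N * N) + -1ℤ * (ℤ.+ 4 * (N * N + v * N - ℤ.+ 2 * N)) ≡ 0ℤ
  deviation-total = solve 2 (λ v N →
    con (ℤ.+ 4) :* (N :* (con (ℤ.+ 3) :* N :+ con -[1+ 1 ]) :+ v :* N :+ con -[1+ 1 ] :* N :* N)
      :+ con -1ℤ :* (con (ℤ.+ 4) :* (N :* N :+ v :* N :- con (ℤ.+ 2) :* N)) := con 0ℤ) refl

  -- The affine function (α - β) W + (2α + β) v interpolates: it is 3vα at W = v and 3vβ at W = -2v.
  -- A count that depends only on which value W takes thus becomes linear in W, and the first moment
  -- sums it.
  weight-v : ∀ α β v → v * ℤ.+ 3 * α ≡ (α + -1ℤ * β) * v + (ℤ.+ 2 * α + β) * v * 1ℤ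
  weight-v = solve 3 (λ α β v →
    v :* con (ℤ.+ 3) :* α := (α :+ con -1ℤ :* β) :* v :+ (con (ℤ.+ 2) :* α :+ β) :* v :* con 1ℤ) refl

  weight-−2v : ∀ α β v → v * ℤ.+ 3 * β ≡ (α + -1ℤ * β) * (-[1+ 1 ] * v) + (ℤ.+ 2 * α + β) * v * 1ℤ
  weight-−2v = solve 3 (λ α β v →
    v :* con (ℤ.+ 3) :* β := (α :+ con -1ℤ :* β) :* (con -[1+ 1 ] :* v) :+ (con (ℤ.+ 2) :* α :+ β) :* v :* con 1ℤ) refl

  weight-total : ∀ p s v N → (p * N + s * v * N) + -1ℤ * (p * N + s * v * 1ℤ) ≡ v * ((N + -1ℤ) * s)
  weight-total = solve 4 (λ p s v N →
    (p :* N :+ s :* v :* N) :+ con -1ℤ :* (p :* N :+ s :* v :* con 1ℤ) := v :* ((N :+ con -1ℤ) :* s)) refl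

length-filter-map : ∀ {A B : Set} {P : B → Set} (P? : Decidable P) (f : A → B) xs →
  length (filter P? (map f xs)) ≡ length (filter (P? ∘ f) xs)
length-filter-map P? f []       = refl
length-filter-map P? f (x ∷ xs) with P? (f x)
... | yes _ = cong suc (length-filter-map P? f xs)
... | no  _ = length-filter-map P? f xs

-- Monic polynomials and the bound on their number of roots.

module MonicPolynomials {n : ℕ} (L : BinaryField n) where
  open FieldProperties L
  open ≡-Reasoning

  -- A list of length d holds the coefficients of degree < d of a monic polynomial of degree d.
  eval : List Carrier → Carrier → Carrier
  eval []      x = 1#
  eval (c ∷ p) x = c + x * eval p x

  -- Synthetic division of `c ∷ p` by x + w. The constant coefficient `c` enters only the remainder,
  -- hence is not an argument.
  quotient : List Carrier → Carrier → List Carrier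
  quotient []          w = []
  quotient p@(_ ∷ p′) w = eval p w ∷ quotient p′ w

  length-quotient : ∀ p w → length (quotient p w) ≡ length p
  length-quotient []      w = refl
  length-quotient (_ ∷ p) w = cong suc (length-quotient p w)

  eval-quotient : ∀ c p w x → eval (c ∷ p) x + eval (c ∷ p) w ≡ (x + w) * eval (quotient p w) x
  eval-quotient c [] w x =
    solve 3 (λ c w x → (c :+ x :* con true) :+ (c :+ w :* con true) := (x :+ w) :* con true) refl c w x
  eval-quotient c p@(c′ ∷ p′) w x = begin
    (c + x * g x) + (c + w * g w)
      ≡⟨ solve 5 (λ c w x gx gw → (c :+ x :* gx) :+ (c :+ w :* gw) := (x :+ w) :* gw :+ x :* (gx :+ gw)) refl c w x (g x) (g w) ⟩
    (x + w) * g w + x * (g x + g w)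
      ≡⟨ cong (λ v → (x + w) * g w + x * v) (eval-quotient c′ p′ w x) ⟩
    (x + w) * g w + x * ((x + w) * eval (quotient p′ w) x)
      ≡⟨ solve 4 (λ w x gw e → (x :+ w) :* gw :+ x :* ((x :+ w) :* e) := (x :+ w) :* (gw :+ x :* e)) refl w x (g w) (eval (quotient p′ w) x) ⟩
    (x + w) * (g w + x * eval (quotient p′ w) x) ∎
    where g = eval p

  roots-bound : ∀ p {xs} → Unique xs → All (λ x → eval p x ≡ 0#) xs → length xs ≤ length p
  roots-bound p       []           []             = z≤n
  roots-bound []      (_ ∷ _)      (root ∷ _)     = ⊥-elim (0#≢1# (sym root))
  roots-bound (c ∷ p) {w ∷ _} (w∉xs ∷ xs!) (root ∷ roots) =
    s≤s (ℕ.≤-trans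
      (roots-bound (quotient p w) xs! (All.zipWith (λ (w≢x , eq) → root′ w≢x eq) (w∉xs , roots)))
      (ℕ.≤-reflexive (length-quotient p w)))
    where
    root′ : ∀ {x} → w ≢ x → eval (c ∷ p) x ≡ 0# → eval (quotient p w) x ≡ 0#
    root′ {x} w≢x eq = *-zero-cancelˡ (w≢x ∘ sym ∘ x+y≡0⇒x≡y)
      (trans (sym (eval-quotient c p w x)) (trans (cong₂ _+_ eq root) (+-identityˡ 0#)))

  -- The strict inequality of degrees keeps the sum monic. The empty list is the constant 1, not 0,
  -- so it changes the constant coefficient.
  add : ∀ p p′ → length p′ < length p →
    ∃ λ s → length s ≡ length p × ∀ x → eval s x ≡ eval p′ x + eval p x
  add (c ∷ p) [] _ = c + 1# ∷ p , refl , λ x →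
    solve 2 (λ c e → c :+ con true :+ e := con true :+ (c :+ e)) refl c (x * eval p x)
  add (c ∷ p) (c′ ∷ p′) (s≤s p′<p) with add p p′ p′<p
  ... | s , len , eq = c′ + c ∷ s , cong suc len , λ x →
    trans (cong (λ w → c′ + c + x * w) (eq x))
      (solve 5 (λ c c′ x e e′ → c′ :+ c :+ x :* (e′ :+ e) := (c′ :+ x :* e′) :+ (c :+ x :* e))
        refl c c′ x (eval p x) (eval p′ x))

  monomial : ∀ d x → eval (replicate d 0#) x ≡ x ^ d
  monomial zero    x = refl
  monomial (suc d) x = trans (+-identityˡ _) (cong (x *_) (monomial d x))

  private module Σᴸ = CommutativeMonoidSum (CommutativeRing.+-commutativeMonoid commutativeRing)

  -- Meant for the exponents 2^i, where it exhibits the trace as a monic polynomial; strictly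
  -- growing exponents are what `add` requires.
  sum-of-powers : ∀ j (e : ℕ → ℕ) → (∀ {i i′} → i < i′ → e i < e i′) →
    ∃ λ p → length p ≡ e j × ∀ x → eval p x ≡ Σᴸ.sum {suc j} λ i → x ^ e (toℕ i)
  sum-of-powers zero e _ = replicate (e 0) 0# , List.length-replicate (e 0) , λ x →
    trans (monomial (e 0) x) (sym (+-identityʳ _))
  sum-of-powers (suc j) e e-mono with sum-of-powers j (e ∘ suc) (e-mono ∘ s≤s)
  ... | p , len , eq with add p (replicate (e 0) 0#)
          (subst₂ _<_ (sym (List.length-replicate (e 0))) (sym len) (e-mono (s≤s z≤n)))
  ...   | s , len′ , eq′ = s , trans len′ len , λ x →
          trans (eq′ x) (cong₂ _+_ (monomial (e 0) x) (eq x))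

-- The trace, its additive character, and character sums.

module Character {n : ℕ} (L : BinaryField n) where
  open FieldProperties L
  open MonicPolynomials L
  open Walsh L using (Tr; sign)
  open ≡-Reasoning
  private module Σᴸ = CommutativeMonoidSum (CommutativeRing.+-commutativeMonoid commutativeRing)

  Tr-+ : ∀ x y → Tr (x + y) ≡ Tr x + Tr y
  Tr-+ x y = trans (Σᴸ.sum-cong-≗ {n} λ i → frobenius-+ (toℕ i) x y)
    (Σᴸ.∑-distrib-+ {n} (λ i → x ^ (2 ℕ.^ toℕ i)) (λ i → y ^ (2 ℕ.^ toℕ i)))

  private
    sum-squared : ∀ {k} (f : Fin k → Carrier) → Σᴸ.sum f * Σᴸ.sum f ≡ Σᴸ.sum (λ i → f i * f i)
    sum-squared {zero}  f = zeroˡ 0#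
    sum-squared {suc k} f = trans
      (solve 2 (λ x y → (x :+ y) :* (x :+ y) := x :* x :+ y :* y) refl (f zero) (Σᴸ.sum (f ∘ suc)))
      (cong ((f zero * f zero) +_) (sum-squared (f ∘ suc)))

    power-shift : ∀ x k → x ^ (2 ℕ.^ k) * x ^ (2 ℕ.^ k) ≡ x ^ (2 ℕ.^ suc k)
    power-shift x k = trans (sym (^-homo-* x (2 ℕ.^ k) (2 ℕ.^ k)))
      (cong (λ w → x ^ (2 ℕ.^ k ℕ.+ w)) (sym (ℕ.+-identityʳ _)))

  -- Squaring moves each term x^(2^i) to the next one, and the last wraps round to x^(2^n) = x. To
  -- make this precise, x is added twice, and the resulting sum of n + 1 terms is split at its other
  -- end.
  Tr-idempotent : ∀ x → Tr x * Tr x ≡ Tr x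
  Tr-idempotent x = begin
    Tr x * Tr x
      ≡⟨ sum-squared {n} f ⟩
    Σᴸ.sum {n} (λ i → f i * f i)
      ≡⟨ Σᴸ.sum-cong-≗ {n} (λ i → power-shift x (toℕ i)) ⟩
    Σᴸ.sum {n} (λ i → x ^ (2 ℕ.^ suc (toℕ i)))
      ≡⟨ +-self-cancel x _ ⟨
    x + (x + Σᴸ.sum {n} (λ i → x ^ (2 ℕ.^ suc (toℕ i))))
      ≡⟨ cong (λ w → x + (w + Σᴸ.sum {n} (λ i → x ^ (2 ℕ.^ suc (toℕ i))))) (*-identityʳ x) ⟨
    x + Σᴸ.sum {suc n} (λ i → x ^ (2 ℕ.^ toℕ i))
      ≡⟨ cong (x +_) (Σᴸ.sum-init-last {n} (λ i → x ^ (2 ℕ.^ toℕ i))) ⟩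
    x + (Σᴸ.sum {n} (λ i → x ^ (2 ℕ.^ toℕ (inject₁ i))) + x ^ (2 ℕ.^ toℕ (fromℕ n)))
      ≡⟨ cong₂ (λ v w → x + (v + w)) (Σᴸ.sum-cong-≗ {n} λ i → cong (λ j → x ^ (2 ℕ.^ j)) (Fin.toℕ-inject₁ i))
           (trans (cong (λ j → x ^ (2 ℕ.^ j)) (Fin.toℕ-fromℕ n)) (fermat x)) ⟩
    x + (Tr x + x)
      ≡⟨ solve 2 (λ x t → x :+ (t :+ x) := t) refl x (Tr x) ⟩
    Tr x ∎
    where
    f : Fin n → Carrier
    f i = x ^ (2 ℕ.^ toℕ i)

  Tr∈𝔽₂ : ∀ x → Tr x ≡ 0# ⊎ Tr x ≡ 1#
  Tr∈𝔽₂ x with Tr x ≟ 0#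
  ... | yes Tr≡0 = inj₁ Tr≡0
  ... | no Tr≢0 = inj₂ (*-cancelˡ Tr≢0 (trans (Tr-idempotent x) (sym (*-identityʳ _))))

  -- Otherwise the trace, a polynomial of degree 2ⁿ⁻¹, would have 2ⁿ roots.
  Tr-nontrivial : n ≢ 0 → ∃ λ x → Tr x ≢ 0#
  Tr-nontrivial n≢0 with Any.any? (λ x → ¬? (Tr x ≟ 0#)) elements
  ... | yes p = Any.satisfied p
  ... | no none = ⊥-elim (contra n refl)
    where
    Tr≡0 : ∀ x → Tr x ≡ 0#
    Tr≡0 x = decidable-stable (Tr x ≟ 0#) λ Tr≢0 → none (Any.map (λ { refl → Tr≢0 }) (∈-elements x))
    contra : ∀ k → k ≡ n → ⊥
    contra zero    refl = n≢0 refl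
    contra (suc j) refl with sum-of-powers j (2 ℕ.^_) (ℕ.^-monoʳ-< 2 (s≤s (s≤s z≤n)))
    ... | p , len , eq = ℕ.<⇒≱ (ℕ.^-monoʳ-< 2 (s≤s (s≤s z≤n)) (ℕ.n<1+n j))
      (subst₂ _≤_ (List.length-tabulate to) len
        (roots-bound p elements-unique (All.tabulate λ {x} _ → trans (eq x) (Tr≡0 x))))

  χ : Carrier → ℤ
  χ x = sign (Tr x)

  private
    sign-0 : ∀ {t} → t ≡ 0# → sign t ≡ 1ℤ
    sign-0 {t} eq = cong (if_then 1ℤ else -1ℤ) (dec-true (t ≟ 0#) eq)

    sign-≢0 : ∀ {t} → t ≢ 0# → sign t ≡ -1ℤ
    sign-≢0 {t} neq = cong (if_then 1ℤ else -1ℤ) (dec-false (t ≟ 0#) neq)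

    sign-1 : ∀ {t} → t ≡ 1# → sign t ≡ -1ℤ
    sign-1 eq = sign-≢0 λ t≡0 → 0#≢1# (trans (sym t≡0) eq)

  χ-± : ∀ x → χ x ≡ 1ℤ ⊎ χ x ≡ -1ℤ
  χ-± x = Sum.map sign-0 sign-1 (Tr∈𝔽₂ x)

  χ-+ : ∀ x y → χ (x + y) ≡ χ x ℤ.* χ y
  χ-+ x y = trans (cong sign (Tr-+ x y)) (sign-+ (Tr∈𝔽₂ x) (Tr∈𝔽₂ y))
    where
    sign-+ : ∀ {s t} → s ≡ 0# ⊎ s ≡ 1# → t ≡ 0# ⊎ t ≡ 1# → sign (s + t) ≡ sign s ℤ.* sign t
    sign-+ (inj₁ p) (inj₁ q) = trans (sign-0 (trans (cong₂ _+_ p q) (+-identityˡ 0#))) (sym (cong₂ ℤ._*_ (sign-0 p) (sign-0 q)))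
    sign-+ (inj₁ p) (inj₂ q) = trans (sign-1 (trans (cong₂ _+_ p q) (+-identityˡ 1#))) (sym (cong₂ ℤ._*_ (sign-0 p) (sign-1 q)))
    sign-+ (inj₂ p) (inj₁ q) = trans (sign-1 (trans (cong₂ _+_ p q) (+-identityʳ 1#))) (sym (cong₂ ℤ._*_ (sign-1 p) (sign-0 q)))
    sign-+ (inj₂ p) (inj₂ q) = trans (sign-0 (trans (cong₂ _+_ p q) 1+1≡0)) (sym (cong₂ ℤ._*_ (sign-1 p) (sign-1 q)))

  χ-square : ∀ x → χ x ℤ.* χ x ≡ 1ℤ
  χ-square x = [ (λ p → cong₂ ℤ._*_ p p) , (λ p → cong₂ ℤ._*_ p p) ]′ (χ-± x)

  χ-0 : χ 0# ≡ 1ℤ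
  χ-0 = trans (cong χ (sym (+-identityˡ 0#))) (trans (χ-+ 0# 0#) (χ-square 0#))

  χ-nontrivial : n ≢ 0 → ∃ λ x → χ x ≡ -1ℤ
  χ-nontrivial n≢0 = (λ (x , Tr≢0) → x , sign-≢0 Tr≢0) (Tr-nontrivial n≢0)

  open EnumeratedSum enumeration ℤ.+-0-commutativeMonoid public
    using (∑; ∑-cong; ∑-single; ∑-reindex) renaming (∑-∙ to ∑-+)

  private
    module Σᶻ = CommutativeMonoidSum ℤ.+-0-commutativeMonoid
    module Sᶻ = SemiringSum ℤ.+-*-semiring

  N : ℤ
  N = ℤ.+ (2 ℕ.^ n)

  ∑-comm : ∀ (f : Carrier → Carrier → ℤ) → ∑ (λ x → ∑ (f x)) ≡ ∑ (λ y → ∑ (λ x → f x y))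
  ∑-comm f = Σᶻ.∑-comm (λ i j → f (to i) (to j))

  ∑-*ˡ : ∀ c f → ∑ (λ x → c ℤ.* f x) ≡ c ℤ.* ∑ f
  ∑-*ˡ c f = sym (Sᶻ.*-distribˡ-sum c (f ∘ to))

  ∑-*ʳ : ∀ f c → ∑ (λ x → f x ℤ.* c) ≡ ∑ f ℤ.* c
  ∑-*ʳ f c = sym (Sᶻ.*-distribʳ-sum c (f ∘ to))

  ∑-1 : ∑ (λ _ → 1ℤ) ≡ N
  ∑-1 = go (2 ℕ.^ n)
    where
    go : ∀ k → Σᶻ.sum {k} (λ _ → 1ℤ) ≡ ℤ.+ k
    go zero    = refl
    go (suc k) = cong (ℤ._+_ 1ℤ) (go k)

  ∑-translate : ∀ c f → ∑ f ≡ ∑ (λ x → f (x + c))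
  ∑-translate c f = ∑-reindex f (_+ c) (_+ c) twice twice
    where
    twice : ∀ x → x + c + c ≡ x
    twice x = solve 2 (λ x c → x :+ c :+ c := x) refl x c

  -- Translation by `c` both preserves and negates the sum. Every vanishing character sum below is
  -- obtained in this way.
  ∑-antisymmetric : ∀ c f → (∀ x → f (x + c) ≡ -1ℤ ℤ.* f x) → ∑ f ≡ 0ℤ
  ∑-antisymmetric c f anti = self-negative (begin
    ∑ f                         ≡⟨ ∑-translate c f ⟩
    ∑ (λ x → f (x + c))         ≡⟨ ∑-cong anti ⟩
    ∑ (λ x → -1ℤ ℤ.* f x)       ≡⟨ ∑-*ˡ -1ℤ f ⟩
    -1ℤ ℤ.* ∑ f                 ≡⟨ ℤ.-1*i≡-i _ ⟩
    ℤ.- ∑ f                     ∎)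
    where
    self-negative : ∀ {i} → i ≡ ℤ.- i → i ≡ 0ℤ
    self-negative {ℤ.+ zero} _ = refl
    self-negative {ℤ.+ suc _} ()
    self-negative { -[1+ _ ]} ()

  indicator : ∀ {P : Set} → Dec P → ℤ
  indicator P? = if does P? then 1ℤ else 0ℤ

  indicator-yes : ∀ {P : Set} (P? : Dec P) → P → indicator P? ≡ 1ℤ
  indicator-yes P? p = cong (if_then 1ℤ else 0ℤ) (dec-true P? p)

  indicator-no : ∀ {P : Set} (P? : Dec P) → ¬ P → indicator P? ≡ 0ℤ
  indicator-no P? ¬p = cong (if_then 1ℤ else 0ℤ) (dec-false P? ¬p)

  length-filter-elements : ∀ {P : Carrier → Set} (P? : Decidable P) →
    ℤ.+ length (filter P? elements) ≡ ∑ (λ x → indicator (P? x))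
  length-filter-elements P? = go to
    where
    go : ∀ {k} (f : Fin k → Carrier) → ℤ.+ length (filter P? (tabulate f)) ≡ Σᶻ.sum (λ i → indicator (P? (f i)))
    go {zero}  f = refl
    go {suc k} f with P? (f zero)
    ... | yes _ = cong (ℤ._+_ 1ℤ) (go (f ∘ suc))
    ... | no  _ = trans (go (f ∘ suc)) (sym (ℤ.+-identityˡ _))

  -- Turns a multiplicity in the spectrum, defined by filtering a list of pairs, into a double sum
  -- of indicators, on which moments and Parseval's identity can act.
  length-filter-pairs : ∀ {P : Carrier → Set} {Q : ℕ → Set} (P? : Decidable P) (Q? : Decidable Q)
    (g : Carrier × Carrier → ℕ) →
    ℤ.+ length (filter Q? (map g (cartesianProduct (filter P? elements) elements))) ≡
    ∑ (λ b → indicator (P? b) ℤ.* ∑ (λ a → indicator (Q? (g (b , a)))))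
  length-filter-pairs P? Q? g = go to
    where
    row : ∀ b → ℤ.+ length (filter Q? (map g (map (b ,_) elements))) ≡ ∑ (λ a → indicator (Q? (g (b , a))))
    row b = trans
      (cong ℤ.+_ (trans (length-filter-map Q? g (map (b ,_) elements)) (length-filter-map (Q? ∘ g) (b ,_) elements)))
      (length-filter-elements (λ a → Q? (g (b , a))))
    go : ∀ {k} (f : Fin k → Carrier) →
      ℤ.+ length (filter Q? (map g (cartesianProduct (filter P? (tabulate f)) elements))) ≡
      Σᶻ.sum (λ i → indicator (P? (f i)) ℤ.* ∑ (λ a → indicator (Q? (g (f i , a)))))
    go {zero}  f = refl
    go {suc k} f with P? (f zero)
    ... | no  _ = trans (go (f ∘ suc)) (sym (trans (cong (ℤ._+ rest) (ℤ.*-zeroˡ (∑ (λ a → indicator (Q? (g (f zero , a))))))) (ℤ.+-identityˡ rest)))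
      where rest = Σᶻ.sum (λ i → indicator (P? (f (suc i))) ℤ.* ∑ (λ a → indicator (Q? (g (f (suc i) , a)))))
    ... | yes _ = begin
      ℤ.+ length (filter Q? (map g (head List.++ tail)))
        ≡⟨ cong (λ l → ℤ.+ length (filter Q? l)) (List.map-++ g head tail) ⟩
      ℤ.+ length (filter Q? (map g head List.++ map g tail))
        ≡⟨ cong (λ l → ℤ.+ length l) (List.filter-++ Q? (map g head) (map g tail)) ⟩
      ℤ.+ length (filter Q? (map g head) List.++ filter Q? (map g tail))
        ≡⟨ cong ℤ.+_ (List.length-++ (filter Q? (map g head))) ⟩
      ℤ.+ length (filter Q? (map g head)) ℤ.+ ℤ.+ length (filter Q? (map g tail))
        ≡⟨ cong₂ ℤ._+_ (trans (row (f zero)) (sym (ℤ.*-identityˡ (∑ (λ a → indicator (Q? (g (f zero , a)))))))) (go (f ∘ suc)) ⟩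
      _ ∎
      where
      head = map (f zero ,_) elements
      tail = cartesianProduct (filter P? (tabulate (f ∘ suc))) elements

  ∑-nonNegative : ∀ f → (∀ x → 0ℤ ℤ.≤ f x) → ∑ f ≡ 0ℤ → ∀ x → f x ≡ 0ℤ
  ∑-nonNegative f f≥0 ∑≡0 x =
    trans (cong f (sym (Inverse.strictlyInverseˡ enumeration x))) (go (f ∘ to) (f≥0 ∘ to) ∑≡0 (from x))
    where
    sum≥0 : ∀ {k} (g : Fin k → ℤ) → (∀ i → 0ℤ ℤ.≤ g i) → 0ℤ ℤ.≤ Σᶻ.sum g
    sum≥0 {zero}  g g≥0 = ℤ.≤-refl
    sum≥0 {suc k} g g≥0 = ℤ.+-mono-≤ (g≥0 zero) (sum≥0 (g ∘ suc) (g≥0 ∘ suc))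
    go : ∀ {k} (g : Fin k → ℤ) → (∀ i → 0ℤ ℤ.≤ g i) → Σᶻ.sum g ≡ 0ℤ → ∀ i → g i ≡ 0ℤ
    go g g≥0 eq zero    = proj₁ (IntegerLemmas.i+j≡0⇒both≡0 (g≥0 zero) (sum≥0 (g ∘ suc) (g≥0 ∘ suc)) eq)
    go g g≥0 eq (suc i) = go (g ∘ suc) (g≥0 ∘ suc) (proj₂ (IntegerLemmas.i+j≡0⇒both≡0 (g≥0 zero) (sum≥0 (g ∘ suc) (g≥0 ∘ suc)) eq)) i

  -- If u ≠ v, translating a by y / (u + v), with y of sign -1, negates every term; if u = v, every
  -- term is 1.
  χ-orthogonal : n ≢ 0 → ∀ u v → ∑ (λ a → χ (a * (u + v))) ≡ N ℤ.* indicator (u ≟ v)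
  χ-orthogonal n≢0 u v = cases (u ≟ v)
    where
    cases : Dec (u ≡ v) → ∑ (λ a → χ (a * (u + v))) ≡ N ℤ.* indicator (u ≟ v)
    cases (yes u≡v) = begin
      ∑ (λ a → χ (a * (u + v)))   ≡⟨ ∑-cong (λ a → trans (cong χ (trans (cong (λ w → a * (u + w)) (sym u≡v)) (trans (cong (a *_) (x+x≡0 u)) (zeroʳ a)))) χ-0) ⟩
      ∑ (λ _ → 1ℤ)                ≡⟨ ∑-1 ⟩
      N                           ≡⟨ ℤ.*-identityʳ N ⟨
      N ℤ.* 1ℤ                    ≡⟨ cong (N ℤ.*_) (indicator-yes (u ≟ v) u≡v) ⟨
      N ℤ.* indicator (u ≟ v)     ∎
    cases (no u≢v) = begin
      ∑ (λ a → χ (a * (u + v)))   ≡⟨ ∑-antisymmetric (proj₁ y * (u + v) ⁻¹) _ anti ⟩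
      0ℤ                          ≡⟨ ℤ.*-zeroʳ N ⟨
      N ℤ.* 0ℤ                    ≡⟨ cong (N ℤ.*_) (indicator-no (u ≟ v) u≢v) ⟨
      N ℤ.* indicator (u ≟ v)     ∎
      where
      y : ∃ λ y → χ y ≡ -1ℤ
      y = χ-nontrivial n≢0
      anti : ∀ a → χ ((a + proj₁ y * (u + v) ⁻¹) * (u + v)) ≡ -1ℤ ℤ.* χ (a * (u + v))
      anti a = begin
        χ ((a + proj₁ y * (u + v) ⁻¹) * (u + v))       ≡⟨ cong χ (solve 4 (λ a y w i → (a :+ y :* i) :* w := y :* (w :* i) :+ a :* w) refl a (proj₁ y) (u + v) ((u + v) ⁻¹)) ⟩
        χ (proj₁ y * ((u + v) * (u + v) ⁻¹) + a * (u + v)) ≡⟨ cong (λ w → χ (proj₁ y * w + a * (u + v))) (*-inverseʳ (u≢v ∘ x+y≡0⇒x≡y)) ⟩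
        χ (proj₁ y * 1# + a * (u + v))                 ≡⟨ cong (λ w → χ (w + a * (u + v))) (*-identityʳ _) ⟩
        χ (proj₁ y + a * (u + v))                      ≡⟨ χ-+ _ _ ⟩
        χ (proj₁ y) ℤ.* χ (a * (u + v))                ≡⟨ cong (ℤ._* χ (a * (u + v))) (proj₂ y) ⟩
        -1ℤ ℤ.* χ (a * (u + v))                        ∎

-- Walsh transform of a quadratic function `G` with polar form `D`.

module _ {n : ℕ} (L : BinaryField n) where
  open FieldProperties L

  module QuadraticWalsh (n≢0 : n ≢ 0)
    (G : Carrier → Carrier) (D : Carrier → Carrier → Carrier)
    (G-+ : ∀ x y → G (x + y) ≡ G x + G y + D x y)
    (D-+ˡ : ∀ x x′ y → D (x + x′) y ≡ D x y + D x′ y) (D-sym : ∀ x y → D x y ≡ D y x) where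
    open Walsh L using (W)
    open Character L
    open IntegerLemmas
    open ≡-Reasoning

    private
      D-+ʳ : ∀ x y y′ → D x (y + y′) ≡ D x y + D x y′
      D-+ʳ x y y′ = trans (D-sym x _) (trans (D-+ˡ y y′ x) (cong₂ _+_ (D-sym y x) (D-sym y′ x)))

      ∑-product : ∀ f g → ∑ f ℤ.* ∑ g ≡ ∑ (λ x → ∑ (λ y → f x ℤ.* g y))
      ∑-product f g = trans (sym (∑-*ʳ f (∑ g))) (∑-cong λ x → sym (∑-*ˡ (f x) g))

    -- After expanding the square, summing over a first leaves, by orthogonality, the pairs x = y,
    -- each contributing N.
    parseval : ∀ b → ∑ (λ a → W G b a ℤ.* W G b a) ≡ N ℤ.* N
    parseval b = begin
      ∑ (λ a → W G b a ℤ.* W G b a)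
        ≡⟨ ∑-cong (λ a → ∑-product (λ x → χ (b * G x + a * x)) (λ y → χ (b * G y + a * y))) ⟩
      ∑ (λ a → ∑ λ x → ∑ λ y → χ (b * G x + a * x) ℤ.* χ (b * G y + a * y))
        ≡⟨ ∑-comm (λ a x → ∑ λ y → χ (b * G x + a * x) ℤ.* χ (b * G y + a * y)) ⟩
      ∑ (λ x → ∑ λ a → ∑ λ y → χ (b * G x + a * x) ℤ.* χ (b * G y + a * y))
        ≡⟨ ∑-cong (λ x → ∑-comm (λ a y → χ (b * G x + a * x) ℤ.* χ (b * G y + a * y))) ⟩
      ∑ (λ x → ∑ λ y → ∑ λ a → χ (b * G x + a * x) ℤ.* χ (b * G y + a * y))
        ≡⟨ ∑-cong (λ x → trans (∑-cong (inner x)) (∑-single x _ (λ y y≢x → off-diagonal x y (y≢x ∘ sym)))) ⟩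
      ∑ (λ x → χ (b * G x + b * G x) ℤ.* (N ℤ.* indicator (x ≟ x)))
        ≡⟨ ∑-cong diagonal ⟩
      ∑ (λ _ → N ℤ.* 1ℤ)
        ≡⟨ ∑-*ˡ N (λ _ → 1ℤ) ⟩
      N ℤ.* ∑ (λ _ → 1ℤ)
        ≡⟨ cong (N ℤ.*_) ∑-1 ⟩
      N ℤ.* N ∎
      where
      inner : ∀ x y → ∑ (λ a → χ (b * G x + a * x) ℤ.* χ (b * G y + a * y)) ≡
                      χ (b * G x + b * G y) ℤ.* (N ℤ.* indicator (x ≟ y))
      inner x y = begin
        ∑ (λ a → χ (b * G x + a * x) ℤ.* χ (b * G y + a * y))
          ≡⟨ ∑-cong (λ a → trans (sym (χ-+ _ _)) (trans (cong χ
               (solve 5 (λ u v a x y → (u :+ a :* x) :+ (v :+ a :* y) := (u :+ v) :+ a :* (x :+ y)) refl (b * G x) (b * G y) a x y))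
               (χ-+ _ _))) ⟩
        ∑ (λ a → χ (b * G x + b * G y) ℤ.* χ (a * (x + y)))
          ≡⟨ ∑-*ˡ (χ (b * G x + b * G y)) (λ a → χ (a * (x + y))) ⟩
        χ (b * G x + b * G y) ℤ.* ∑ (λ a → χ (a * (x + y)))
          ≡⟨ cong (χ (b * G x + b * G y) ℤ.*_) (χ-orthogonal n≢0 x y) ⟩
        χ (b * G x + b * G y) ℤ.* (N ℤ.* indicator (x ≟ y)) ∎
      off-diagonal : ∀ x y → x ≢ y → χ (b * G x + b * G y) ℤ.* (N ℤ.* indicator (x ≟ y)) ≡ 0ℤ
      off-diagonal x y x≢y = trans
        (cong (χ (b * G x + b * G y) ℤ.*_) (trans (cong (N ℤ.*_) (indicator-no (x ≟ y) x≢y)) (ℤ.*-zeroʳ N)))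
        (ℤ.*-zeroʳ (χ (b * G x + b * G y)))
      diagonal : ∀ x → χ (b * G x + b * G x) ℤ.* (N ℤ.* indicator (x ≟ x)) ≡ N ℤ.* 1ℤ
      diagonal x = trans (cong₂ (λ w i → w ℤ.* (N ℤ.* i)) (trans (cong χ (x+x≡0 (b * G x))) χ-0) (indicator-yes (x ≟ x) refl))
        (ℤ.*-identityˡ (N ℤ.* 1ℤ))

    private
      kernelSum : Carrier → Carrier → ℤ
      kernelSum b c = ∑ λ x → χ (b * D x c)

      all-1-or-some-−1 : ∀ (f : Carrier → Carrier) → (∀ x → χ (f x) ≡ 1ℤ) ⊎ ∃ λ x → χ (f x) ≡ -1ℤ
      all-1-or-some-−1 f with Any.any? (λ x → χ (f x) ℤ.≟ -1ℤ) elements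
      ... | yes p   = inj₂ (Any.satisfied p)
      ... | no none = inj₁ λ x → [ (λ p → p) , (λ p → ⊥-elim (none (Any.map (λ { refl → p }) (∈-elements x)))) ]′ (χ-± (f x))

      negate : ∀ j {i} → i ≡ -1ℤ → j ℤ.* i ≡ -1ℤ ℤ.* j
      negate j i≡-1 = trans (cong (j ℤ.*_) i≡-1) (ℤ.*-comm j -1ℤ)

      -- Additivity of `D` makes x ↦ χ (b * D x c) a character: it is trivial, with sum N, or it
      -- takes the value -1 and sums to 0. The trivial case keeps the pointwise statement, which
      -- translation by kernel elements relies on.
      kernelSum-dichotomy : ∀ b c → (∀ x → χ (b * D x c) ≡ 1ℤ) × kernelSum b c ≡ N ⊎ kernelSum b c ≡ 0ℤ
      kernelSum-dichotomy b c = Sum.map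
        (λ all-1 → all-1 , trans (∑-cong all-1) ∑-1)
        (λ (x₀ , −1) → ∑-antisymmetric x₀ (λ x → χ (b * D x c)) λ x →
          trans (cong χ (trans (cong (b *_) (D-+ˡ x x₀ c)) (distribˡ b _ _)))
            (trans (χ-+ _ _) (negate (χ (b * D x c)) −1)))
        (all-1-or-some-−1 (λ x → b * D x c))

      -- The witness is 1 if x ↦ χ (b * D x c) is identically 1, and 0 otherwise: an indicator of
      -- the kernel.
      kernelSum-multiple : ∀ b c → ∃ λ e → kernelSum b c ≡ N ℤ.* e
      kernelSum-multiple b c = [ (λ (_ , eq) → 1ℤ , trans eq (sym (ℤ.*-identityʳ N)))
                               , (λ eq → 0ℤ , trans eq (sym (ℤ.*-zeroʳ N))) ]′ (kernelSum-dichotomy b c)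

      N≢0 : N ≢ 0ℤ
      N≢0 eq = ℕ.<⇒≢ (ℕ.m^n>0 2 n) (sym (ℤ.+-injective eq))

    -- κ b is the number of c such that x ↦ Tr (b (G (x + c) + G x + G c)) vanishes.
    κ : Carrier → ℤ
    κ b = ∑ λ c → proj₁ (kernelSum-multiple b c)

    private
      ∑-kernelSum : ∀ b → ∑ (kernelSum b) ≡ N ℤ.* κ b
      ∑-kernelSum b = trans (∑-cong (λ c → proj₂ (kernelSum-multiple b c))) (∑-*ˡ N (λ c → proj₁ (kernelSum-multiple b c)))

      -- Substituting y = c + x turns the exponent into (b G c + a c) + b D x c, so that x occurs
      -- only in `kernelSum b c`.
      W² : ∀ b a → W G b a ℤ.* W G b a ≡ ∑ (λ c → χ (b * G c + a * c) ℤ.* kernelSum b c)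
      W² b a = begin
        W G b a ℤ.* W G b a
          ≡⟨ ∑-product (λ x → χ (b * G x + a * x)) (λ y → χ (b * G y + a * y)) ⟩
        ∑ (λ x → ∑ λ y → χ (b * G x + a * x) ℤ.* χ (b * G y + a * y))
          ≡⟨ ∑-cong (λ x → ∑-translate x (λ y → χ (b * G x + a * x) ℤ.* χ (b * G y + a * y))) ⟩
        ∑ (λ x → ∑ λ c → χ (b * G x + a * x) ℤ.* χ (b * G (c + x) + a * (c + x)))
          ≡⟨ ∑-cong (λ x → ∑-cong (term x)) ⟩
        ∑ (λ x → ∑ λ c → χ (b * G c + a * c) ℤ.* χ (b * D x c))
          ≡⟨ ∑-comm (λ x c → χ (b * G c + a * c) ℤ.* χ (b * D x c)) ⟩
        ∑ (λ c → ∑ λ x → χ (b * G c + a * c) ℤ.* χ (b * D x c))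
          ≡⟨ ∑-cong (λ c → ∑-*ˡ (χ (b * G c + a * c)) (λ x → χ (b * D x c))) ⟩
        ∑ (λ c → χ (b * G c + a * c) ℤ.* kernelSum b c) ∎
        where
        term : ∀ x c → χ (b * G x + a * x) ℤ.* χ (b * G (c + x) + a * (c + x)) ≡ χ (b * G c + a * c) ℤ.* χ (b * D x c)
        term x c = trans (sym (χ-+ _ _)) (trans (cong χ (begin
          (b * G x + a * x) + (b * G (c + x) + a * (c + x))
            ≡⟨ cong (λ w → (b * G x + a * x) + (b * w + a * (c + x))) (trans (G-+ c x) (cong (λ w → G c + G x + w) (D-sym c x))) ⟩
          (b * G x + a * x) + (b * (G c + G x + D x c) + a * (c + x))
            ≡⟨ solve 7 (λ b a x c gx gc d → (b :* gx :+ a :* x) :+ (b :* (gc :+ gx :+ d) :+ a :* (c :+ x)) :=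
                 (b :* gc :+ a :* c) :+ b :* d) refl b a x c (G x) (G c) (D x c) ⟩
          (b * G c + a * c) + b * D x c ∎)) (χ-+ _ _))

    -- On the kernel, c ↦ χ (b * G c + a * c) is a character. If it is -1 at some kernel element c₀,
    -- translation by c₀ negates all terms of the sum in `W²`; if not, it is 1 wherever `kernelSum`
    -- is nonzero, and only the kernel size remains.
    W²-dichotomy : ∀ b a → W G b a ℤ.* W G b a ≡ 0ℤ ⊎ W G b a ℤ.* W G b a ≡ N ℤ.* κ b
    W²-dichotomy b a = cases (Any.any? (λ c → (kernelSum b c ℤ.≟ N) ×-dec (χ (b * G c + a * c) ℤ.≟ -1ℤ)) elements)
      where
      Kernel∋−1 : Set
      Kernel∋−1 = Any.Any (λ c → kernelSum b c ≡ N × χ (b * G c + a * c) ≡ -1ℤ) elements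

      vanishes : (∃ λ c → kernelSum b c ≡ N × χ (b * G c + a * c) ≡ -1ℤ) →
        ∑ (λ c → χ (b * G c + a * c) ℤ.* kernelSum b c) ≡ 0ℤ
      vanishes (c₀ , ≡N , −1) = ∑-antisymmetric c₀ (λ c → χ (b * G c + a * c) ℤ.* kernelSum b c) λ c → begin
        χ (b * G (c + c₀) + a * (c + c₀)) ℤ.* kernelSum b (c + c₀)
          ≡⟨ cong₂ ℤ._*_ (ψ-negates c) (∑-cong (kernel-invariant c)) ⟩
        -1ℤ ℤ.* χ (b * G c + a * c) ℤ.* kernelSum b c
          ≡⟨ ℤ.*-assoc -1ℤ (χ (b * G c + a * c)) (kernelSum b c) ⟩
        -1ℤ ℤ.* (χ (b * G c + a * c) ℤ.* kernelSum b c) ∎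
        where
        c₀∈ker : ∀ x → χ (b * D x c₀) ≡ 1ℤ
        c₀∈ker = [ proj₁ , (λ ≡0 → ⊥-elim (N≢0 (trans (sym ≡N) ≡0))) ]′ (kernelSum-dichotomy b c₀)
        drop : ∀ x u → χ (u + b * D x c₀) ≡ χ u
        drop x u = trans (χ-+ _ _) (trans (cong (χ u ℤ.*_) (c₀∈ker x)) (ℤ.*-identityʳ (χ u)))
        kernel-invariant : ∀ c x → χ (b * D x (c + c₀)) ≡ χ (b * D x c)
        kernel-invariant c x = trans (cong χ (trans (cong (b *_) (D-+ʳ x c c₀)) (distribˡ b _ _))) (drop x (b * D x c))
        ψ-negates : ∀ c → χ (b * G (c + c₀) + a * (c + c₀)) ≡ -1ℤ ℤ.* χ (b * G c + a * c)
        ψ-negates c = begin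
          χ (b * G (c + c₀) + a * (c + c₀))
            ≡⟨ cong χ (trans (cong (λ w → b * w + a * (c + c₀)) (G-+ c c₀))
                 (solve 7 (λ b a c c₀ g g₀ d → b :* (g :+ g₀ :+ d) :+ a :* (c :+ c₀) :=
                   ((b :* g :+ a :* c) :+ (b :* g₀ :+ a :* c₀)) :+ b :* d) refl b a c c₀ (G c) (G c₀) (D c c₀))) ⟩
          χ ((b * G c + a * c) + (b * G c₀ + a * c₀) + b * D c c₀)
            ≡⟨ drop c _ ⟩
          χ ((b * G c + a * c) + (b * G c₀ + a * c₀))
            ≡⟨ trans (χ-+ _ _) (negate (χ (b * G c + a * c)) −1) ⟩
          -1ℤ ℤ.* χ (b * G c + a * c) ∎

      pointwise : ¬ Kernel∋−1 → ∀ c → χ (b * G c + a * c) ℤ.* kernelSum b c ≡ kernelSum b c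
      pointwise none c = [ (λ (_ , ≡N) → [ (λ ≡1 → trans (cong (ℤ._* kernelSum b c) ≡1) (ℤ.*-identityˡ (kernelSum b c)))
                                    , (λ ≡-1 → ⊥-elim (none (Any.map (λ { refl → ≡N , ≡-1 }) (∈-elements c)))) ]′ (χ-± (b * G c + a * c)))
                    , (λ ≡0 → trans (cong (χ (b * G c + a * c) ℤ.*_) ≡0) (trans (ℤ.*-zeroʳ (χ (b * G c + a * c))) (sym ≡0))) ]′
        (kernelSum-dichotomy b c)

      cases : Dec Kernel∋−1 → W G b a ℤ.* W G b a ≡ 0ℤ ⊎ W G b a ℤ.* W G b a ≡ N ℤ.* κ b
      cases (yes some) = inj₁ (trans (W² b a) (vanishes (Any.satisfied some)))
      cases (no none)  = inj₂ (trans (W² b a) (trans (∑-cong (pointwise none)) (∑-kernelSum b)))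

    G0≡0 : G 0# ≡ 0#
    G0≡0 = begin
      G 0#                     ≡⟨ cong G (+-identityˡ 0#) ⟨
      G (0# + 0#)              ≡⟨ G-+ 0# 0# ⟩
      G 0# + G 0# + D 0# 0#    ≡⟨ cong₂ _+_ (x+x≡0 (G 0#)) D00 ⟩
      0# + 0#                  ≡⟨ +-identityˡ 0# ⟩
      0#                       ∎
      where
      D00 : D 0# 0# ≡ 0#
      D00 = trans (cong (λ w → D w 0#) (sym (+-identityˡ 0#))) (trans (D-+ˡ 0# 0# 0#) (x+x≡0 _))

    module _ (G≡0⇒≡0 : ∀ x → G x ≡ 0# → x ≡ 0#)
      (G-fibre : ∀ x → x ≢ 0# → ∑ (λ y → indicator (G x ≟ G y)) ≡ ℤ.+ 3) where

      private
        W₀ : Carrier → ℤ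
        W₀ b = W G b 0#

        W₀≡ : ∀ b → W₀ b ≡ ∑ (λ x → χ (b * G x))
        W₀≡ b = ∑-cong λ x → cong χ (trans (cong (b * G x +_) (zeroˡ x)) (+-identityʳ _))

        W₀0≡N : W₀ 0# ≡ N
        W₀0≡N = trans (W₀≡ 0#) (trans (∑-cong (λ x → trans (cong χ (zeroˡ (G x))) χ-0)) ∑-1)

        fibre : Carrier → ℤ
        fibre w = ∑ λ x → indicator (w ≟ G x)

        fibre-0 : ∀ {w} → w ≡ 0# → fibre w ≡ 1ℤ
        fibre-0 refl = trans
          (∑-single 0# (λ x → indicator (0# ≟ G x)) λ x x≢0 → indicator-no (0# ≟ G x) λ eq → x≢0 (G≡0⇒≡0 x (sym eq)))
          (indicator-yes (0# ≟ G 0#) (sym G0≡0))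

        -- A fibre has 1 element over 0 and 0 or 3 elements elsewhere; `c` is the indicator of the
        -- nonzero part of the image.
        fibre-decomposition : ∀ w → ∃ λ c → fibre w ≡ indicator (w ≟ 0#) ℤ.+ ℤ.+ 3 ℤ.* c
        fibre-decomposition w = cases (w ≟ 0#) (Any.any? (λ x → w ≟ G x) elements)
          where
          cases : Dec (w ≡ 0#) → Dec (Any.Any (λ x → w ≡ G x) elements) → _
          cases (yes w≡0) _ = 0ℤ , trans (fibre-0 w≡0) (cong (ℤ._+ 0ℤ) (sym (indicator-yes (w ≟ 0#) w≡0)))
          cases (no w≢0) (yes some) = 1ℤ , trans (image (Any.satisfied some)) (cong (ℤ._+ ℤ.+ 3) (sym (indicator-no (w ≟ 0#) w≢0)))
            where
            image : (∃ λ x → w ≡ G x) → fibre w ≡ ℤ.+ 3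
            image (x , w≡Gx) = trans (cong fibre w≡Gx) (G-fibre x λ x≡0 → w≢0 (trans w≡Gx (trans (cong G x≡0) G0≡0)))
          cases (no w≢0) (no none) = 0ℤ , (begin
            fibre w                          ≡⟨ ∑-cong (λ x → indicator-no (w ≟ G x) λ eq → none (Any.map (λ { refl → eq }) (∈-elements x))) ⟩
            ∑ (λ _ → 0ℤ ℤ.* 0ℤ)              ≡⟨ ∑-*ˡ 0ℤ (λ _ → 0ℤ) ⟩
            0ℤ ℤ.* ∑ (λ _ → 0ℤ)              ≡⟨ ℤ.*-zeroˡ (∑ (λ _ → 0ℤ)) ⟩
            0ℤ                               ≡⟨ cong (ℤ._+ 0ℤ) (indicator-no (w ≟ 0#) w≢0) ⟨
            indicator (w ≟ 0#) ℤ.+ 0ℤ        ∎)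

        -- Grouping x by its image w weights χ (b * w) with the size of the fibre over w, and modulo
        -- 3 only w = 0 survives, with weight 1.
        W₀-mod-3 : ∀ b → ∃ λ Q → W₀ b ≡ 1ℤ ℤ.+ ℤ.+ 3 ℤ.* Q
        W₀-mod-3 b = ∑ (λ w → χ (b * w) ℤ.* c w) , (begin
          W₀ b
            ≡⟨ W₀≡ b ⟩
          ∑ (λ x → χ (b * G x))
            ≡⟨ ∑-cong (λ x → sym (trans (∑-single (G x) (λ w → χ (b * w) ℤ.* indicator (w ≟ G x)) (off x)) (on (G x)))) ⟩
          ∑ (λ x → ∑ λ w → χ (b * w) ℤ.* indicator (w ≟ G x))
            ≡⟨ ∑-comm (λ x w → χ (b * w) ℤ.* indicator (w ≟ G x)) ⟩
          ∑ (λ w → ∑ λ x → χ (b * w) ℤ.* indicator (w ≟ G x))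
            ≡⟨ ∑-cong (λ w → trans (∑-*ˡ (χ (b * w)) (λ x → indicator (w ≟ G x))) (cong (χ (b * w) ℤ.*_) (proj₂ (fibre-decomposition w)))) ⟩
          ∑ (λ w → χ (b * w) ℤ.* (indicator (w ≟ 0#) ℤ.+ ℤ.+ 3 ℤ.* c w))
            ≡⟨ ∑-cong (λ w → *-expand (χ (b * w)) (indicator (w ≟ 0#)) (c w)) ⟩
          ∑ (λ w → χ (b * w) ℤ.* indicator (w ≟ 0#) ℤ.+ ℤ.+ 3 ℤ.* (χ (b * w) ℤ.* c w))
            ≡⟨ ∑-+ (λ w → χ (b * w) ℤ.* indicator (w ≟ 0#)) (λ w → ℤ.+ 3 ℤ.* (χ (b * w) ℤ.* c w)) ⟩
          ∑ (λ w → χ (b * w) ℤ.* indicator (w ≟ 0#)) ℤ.+ ∑ (λ w → ℤ.+ 3 ℤ.* (χ (b * w) ℤ.* c w))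
            ≡⟨ cong₂ ℤ._+_
                 (trans (∑-single 0# (λ w → χ (b * w) ℤ.* indicator (w ≟ 0#)) off-0) (trans (on 0#) (trans (cong χ (zeroʳ b)) χ-0)))
                 (∑-*ˡ (ℤ.+ 3) (λ w → χ (b * w) ℤ.* c w)) ⟩
          1ℤ ℤ.+ ℤ.+ 3 ℤ.* ∑ (λ w → χ (b * w) ℤ.* c w) ∎)
          where
          c : Carrier → ℤ
          c w = proj₁ (fibre-decomposition w)
          on : ∀ w → χ (b * w) ℤ.* indicator (w ≟ w) ≡ χ (b * w)
          on w = trans (cong (χ (b * w) ℤ.*_) (indicator-yes (w ≟ w) refl)) (ℤ.*-identityʳ (χ (b * w)))
          off : ∀ x w → w ≢ G x → χ (b * w) ℤ.* indicator (w ≟ G x) ≡ 0ℤ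
          off x w neq = trans (cong (χ (b * w) ℤ.*_) (indicator-no (w ≟ G x) neq)) (ℤ.*-zeroʳ (χ (b * w)))
          off-0 : ∀ w → w ≢ 0# → χ (b * w) ℤ.* indicator (w ≟ 0#) ≡ 0ℤ
          off-0 w neq = trans (cong (χ (b * w) ℤ.*_) (indicator-no (w ≟ 0#) neq)) (ℤ.*-zeroʳ (χ (b * w)))

        ∑W₀ : ∑ W₀ ≡ N
        ∑W₀ = begin
          ∑ W₀
            ≡⟨ ∑-cong W₀≡ ⟩
          ∑ (λ b → ∑ λ x → χ (b * G x))
            ≡⟨ ∑-comm (λ b x → χ (b * G x)) ⟩
          ∑ (λ x → ∑ λ b → χ (b * G x))
            ≡⟨ ∑-cong (λ x → trans (∑-cong λ b → cong (λ w → χ (b * w)) (sym (+-identityʳ (G x)))) (χ-orthogonal n≢0 (G x) 0#)) ⟩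
          ∑ (λ x → N ℤ.* indicator (G x ≟ 0#))
            ≡⟨ ∑-single 0# (λ x → N ℤ.* indicator (G x ≟ 0#)) (λ x x≢0 →
                 trans (cong (N ℤ.*_) (indicator-no (G x ≟ 0#) λ eq → x≢0 (G≡0⇒≡0 x eq))) (ℤ.*-zeroʳ N)) ⟩
          N ℤ.* indicator (G 0# ≟ 0#)
            ≡⟨ trans (cong (N ℤ.*_) (indicator-yes (G 0# ≟ 0#) G0≡0)) (ℤ.*-identityʳ N) ⟩
          N ∎

        -- The correction -2 lowers the generic size 3 to 1 for the fibre through 0.
        fibre-G : ∀ x → fibre (G x) ≡ ℤ.+ 3 ℤ.+ -[1+ 1 ] ℤ.* indicator (x ≟ 0#)
        fibre-G x = cases (x ≟ 0#)
          where
          cases : Dec (x ≡ 0#) → fibre (G x) ≡ ℤ.+ 3 ℤ.+ -[1+ 1 ] ℤ.* indicator (x ≟ 0#)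
          cases (yes x≡0) = trans (fibre-0 (trans (cong G x≡0) G0≡0)) (cong (λ i → ℤ.+ 3 ℤ.+ -[1+ 1 ] ℤ.* i) (sym (indicator-yes (x ≟ 0#) x≡0)))
          cases (no x≢0)  = trans (G-fibre x x≢0) (cong (λ i → ℤ.+ 3 ℤ.+ -[1+ 1 ] ℤ.* i) (sym (indicator-no (x ≟ 0#) x≢0)))

        ∑-indicator-0 : ∑ (λ x → indicator (x ≟ 0#)) ≡ 1ℤ
        ∑-indicator-0 = trans (∑-single 0# (λ x → indicator (x ≟ 0#)) (λ x → indicator-no (x ≟ 0#))) (indicator-yes (0# ≟ 0#) refl)

        ∑W₀² : ∑ (λ b → W₀ b ℤ.* W₀ b) ≡ N ℤ.* (ℤ.+ 3 ℤ.* N ℤ.+ -[1+ 1 ])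
        ∑W₀² = begin
          ∑ (λ b → W₀ b ℤ.* W₀ b)
            ≡⟨ ∑-cong (λ b → trans (cong₂ ℤ._*_ (W₀≡ b) (W₀≡ b)) (∑-product (λ x → χ (b * G x)) (λ y → χ (b * G y)))) ⟩
          ∑ (λ b → ∑ λ x → ∑ λ y → χ (b * G x) ℤ.* χ (b * G y))
            ≡⟨ ∑-comm (λ b x → ∑ λ y → χ (b * G x) ℤ.* χ (b * G y)) ⟩
          ∑ (λ x → ∑ λ b → ∑ λ y → χ (b * G x) ℤ.* χ (b * G y))
            ≡⟨ ∑-cong (λ x → ∑-comm (λ b y → χ (b * G x) ℤ.* χ (b * G y))) ⟩
          ∑ (λ x → ∑ λ y → ∑ λ b → χ (b * G x) ℤ.* χ (b * G y))
            ≡⟨ ∑-cong (λ x → ∑-cong λ y → trans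
                 (∑-cong λ b → trans (sym (χ-+ (b * G x) (b * G y))) (cong χ (sym (distribˡ b (G x) (G y)))))
                 (χ-orthogonal n≢0 (G x) (G y))) ⟩
          ∑ (λ x → ∑ λ y → N ℤ.* indicator (G x ≟ G y))
            ≡⟨ ∑-cong (λ x → trans (∑-*ˡ N (λ y → indicator (G x ≟ G y))) (cong (N ℤ.*_) (fibre-G x))) ⟩
          ∑ (λ x → N ℤ.* (ℤ.+ 3 ℤ.+ -[1+ 1 ] ℤ.* indicator (x ≟ 0#)))
            ≡⟨ ∑-*ˡ N (λ x → ℤ.+ 3 ℤ.+ -[1+ 1 ] ℤ.* indicator (x ≟ 0#)) ⟩
          N ℤ.* ∑ (λ x → ℤ.+ 3 ℤ.* 1ℤ ℤ.+ -[1+ 1 ] ℤ.* indicator (x ≟ 0#))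
            ≡⟨ cong (N ℤ.*_) (trans (∑-+ (λ _ → ℤ.+ 3 ℤ.* 1ℤ) (λ x → -[1+ 1 ] ℤ.* indicator (x ≟ 0#)))
                 (cong₂ ℤ._+_ (trans (∑-*ˡ (ℤ.+ 3) (λ _ → 1ℤ)) (cong (ℤ.+ 3 ℤ.*_) ∑-1))
                   (trans (∑-*ˡ -[1+ 1 ] (λ x → indicator (x ≟ 0#))) (cong (-[1+ 1 ] ℤ.*_) ∑-indicator-0)))) ⟩
          N ℤ.* (ℤ.+ 3 ℤ.* N ℤ.+ -[1+ 1 ]) ∎

        nonZero : Carrier → ℤ
        nonZero b = indicator (¬? (b ≟ 0#))

        nonZero-0 : nonZero 0# ≡ 0ℤ
        nonZero-0 = indicator-no (¬? (0# ≟ 0#)) λ ≢ → ≢ refl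

        nonZero-≢0 : ∀ {b} → b ≢ 0# → nonZero b ≡ 1ℤ
        nonZero-≢0 {b} = indicator-yes (¬? (b ≟ 0#))

        by-zero : ∀ {P : Carrier → Set} → P 0# → (∀ b → b ≢ 0# → P b) → ∀ b → P b
        by-zero P0 P≢0 b with b ≟ 0#
        ... | yes refl = P0
        ... | no b≢0 = P≢0 b b≢0

        -- The spectrum ranges over b ≠ 0, while moments are computed over all b; this removes the
        -- term at 0.
        ∑-nonZero : ∀ g → ∑ (λ b → nonZero b ℤ.* g b) ≡ ∑ g ℤ.+ -1ℤ ℤ.* g 0#
        ∑-nonZero g = begin
          ∑ (λ b → nonZero b ℤ.* g b)
            ≡⟨ ∑-cong (by-zero
                 (trans (cong (ℤ._* g 0#) nonZero-0) (sym (trans (cong (λ i → g 0# ℤ.+ -1ℤ ℤ.* (i ℤ.* g 0#)) (indicator-yes (0# ≟ 0#) refl)) (subtract-self (g 0#)))))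
                 (λ b b≢0 → trans (cong (ℤ._* g b) (nonZero-≢0 b≢0))
                   (sym (trans (cong (λ i → g b ℤ.+ -1ℤ ℤ.* (i ℤ.* g b)) (indicator-no (b ≟ 0#) b≢0)) (subtract-none (g b)))))) ⟩
          ∑ (λ b → g b ℤ.+ -1ℤ ℤ.* (indicator (b ≟ 0#) ℤ.* g b))
            ≡⟨ trans (∑-+ g (λ b → -1ℤ ℤ.* (indicator (b ≟ 0#) ℤ.* g b)))
                 (cong (λ w → ∑ g ℤ.+ w) (∑-*ˡ -1ℤ (λ b → indicator (b ≟ 0#) ℤ.* g b))) ⟩
          ∑ g ℤ.+ -1ℤ ℤ.* ∑ (λ b → indicator (b ≟ 0#) ℤ.* g b)
            ≡⟨ cong (λ w → ∑ g ℤ.+ -1ℤ ℤ.* w) (trans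
                 (∑-single 0# (λ b → indicator (b ≟ 0#) ℤ.* g b) λ b b≢0 →
                   trans (cong (ℤ._* g b) (indicator-no (b ≟ 0#) b≢0)) (ℤ.*-zeroˡ (g b)))
                 (trans (cong (ℤ._* g 0#) (indicator-yes (0# ≟ 0#) refl)) (ℤ.*-identityˡ (g 0#)))) ⟩
          ∑ g ℤ.+ -1ℤ ℤ.* g 0# ∎

      module _ (v t : ℤ) (v²≡N : v ℤ.* v ≡ N) (v≡ : v ≡ 1ℤ ℤ.+ ℤ.+ 3 ℤ.* t) where
        private
          instance
            N-nonZero : ℤ.NonZero N
            N-nonZero = ℤ.≢-nonZero N≢0

          v≢0 : v ≢ 0ℤ
          v≢0 v≡0 = N≢0 (trans (sym v²≡N) (trans (cong (ℤ._* v) v≡0) (ℤ.*-zeroˡ v)))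

          W₀≢0 : ∀ b → W₀ b ≢ 0ℤ
          W₀≢0 b W₀≡0 = 3*i≢-1 (proj₁ (W₀-mod-3 b)) (trans
            (3*Q≡ (proj₁ (W₀-mod-3 b)))
            (cong (ℤ._+ -1ℤ) (trans (sym (proj₂ (W₀-mod-3 b))) W₀≡0)))

          -- Being 1 modulo 3, `W₀ b` is not 0, which rules out the vanishing branch of the
          -- dichotomy at a = 0.
          W₀²≡Nκ : ∀ b → W₀ b ℤ.* W₀ b ≡ N ℤ.* κ b
          W₀²≡Nκ b = [ (λ ≡0 → ⊥-elim (W₀≢0 b (i*i≡0⇒i≡0 (W₀ b) ≡0))) , (λ p → p) ]′ (W²-dichotomy b 0#)

          -- This is 4 (W₀ b - v) (W₀ b + 2v). The factor 4 allows completing the square (W₀ b +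
          -- 2v)² over the integers.
          deviation : Carrier → ℤ
          deviation b = ℤ.+ 4 ℤ.* (W₀ b ℤ.* W₀ b ℤ.+ v ℤ.* W₀ b ℤ.- ℤ.+ 2 ℤ.* (v ℤ.* v))

          deviation≥0 : ∀ b → 0ℤ ℤ.≤ deviation b
          deviation≥0 b = gap v (W₀ b) (κ b) t (proj₁ (W₀-mod-3 b)) v≡ (proj₂ (W₀-mod-3 b))
            (trans (W₀²≡Nκ b) (cong (ℤ._* κ b) (sym v²≡N)))

          ∑-deviation : ∑ (λ b → nonZero b ℤ.* deviation b) ≡ 0ℤ
          ∑-deviation = begin
            ∑ (λ b → nonZero b ℤ.* deviation b)
              ≡⟨ ∑-nonZero deviation ⟩
            ∑ deviation ℤ.+ -1ℤ ℤ.* deviation 0#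
              ≡⟨ cong₂ (λ x y → x ℤ.+ -1ℤ ℤ.* y) sum at-0 ⟩
            ℤ.+ 4 ℤ.* (N ℤ.* (ℤ.+ 3 ℤ.* N ℤ.+ -[1+ 1 ]) ℤ.+ v ℤ.* N ℤ.+ -[1+ 1 ] ℤ.* N ℤ.* N)
              ℤ.+ -1ℤ ℤ.* (ℤ.+ 4 ℤ.* (N ℤ.* N ℤ.+ v ℤ.* N ℤ.- ℤ.+ 2 ℤ.* N))
              ≡⟨ deviation-total v N ⟩
            0ℤ ∎
            where
            at-0 : deviation 0# ≡ ℤ.+ 4 ℤ.* (N ℤ.* N ℤ.+ v ℤ.* N ℤ.- ℤ.+ 2 ℤ.* N)
            at-0 = cong₂ (λ w z → ℤ.+ 4 ℤ.* (w ℤ.* w ℤ.+ v ℤ.* w ℤ.- ℤ.+ 2 ℤ.* z)) W₀0≡N v²≡N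
            sum : ∑ deviation ≡ ℤ.+ 4 ℤ.* (N ℤ.* (ℤ.+ 3 ℤ.* N ℤ.+ -[1+ 1 ]) ℤ.+ v ℤ.* N ℤ.+ -[1+ 1 ] ℤ.* N ℤ.* N)
            sum = begin
              ∑ deviation
                ≡⟨ ∑-*ˡ (ℤ.+ 4) (λ b → W₀ b ℤ.* W₀ b ℤ.+ v ℤ.* W₀ b ℤ.- ℤ.+ 2 ℤ.* (v ℤ.* v)) ⟩
              ℤ.+ 4 ℤ.* ∑ (λ b → W₀ b ℤ.* W₀ b ℤ.+ v ℤ.* W₀ b ℤ.- ℤ.+ 2 ℤ.* (v ℤ.* v))
                ≡⟨ cong (ℤ.+ 4 ℤ.*_) (trans (∑-+ (λ b → W₀ b ℤ.* W₀ b ℤ.+ v ℤ.* W₀ b) (λ _ → ℤ.- (ℤ.+ 2 ℤ.* (v ℤ.* v))))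
                     (cong₂ ℤ._+_
                       (trans (∑-+ (λ b → W₀ b ℤ.* W₀ b) (λ b → v ℤ.* W₀ b)) (cong₂ ℤ._+_ ∑W₀² (trans (∑-*ˡ v W₀) (cong (v ℤ.*_) ∑W₀))))
                       (begin
                         ∑ (λ _ → ℤ.- (ℤ.+ 2 ℤ.* (v ℤ.* v)))
                           ≡⟨ ∑-cong (λ _ → trans (cong (λ w → ℤ.- (ℤ.+ 2 ℤ.* w)) v²≡N) (-2* N)) ⟩
                         ∑ (λ _ → -[1+ 1 ] ℤ.* N ℤ.* 1ℤ)
                           ≡⟨ trans (∑-*ˡ (-[1+ 1 ] ℤ.* N) (λ _ → 1ℤ)) (cong (-[1+ 1 ] ℤ.* N ℤ.*_) ∑-1) ⟩
                         -[1+ 1 ] ℤ.* N ℤ.* N ∎))) ⟩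
              ℤ.+ 4 ℤ.* (N ℤ.* (ℤ.+ 3 ℤ.* N ℤ.+ -[1+ 1 ]) ℤ.+ v ℤ.* N ℤ.+ -[1+ 1 ] ℤ.* N ℤ.* N) ∎

          W₀-values : ∀ b → b ≢ 0# → W₀ b ≡ v ⊎ W₀ b ≡ -[1+ 1 ] ℤ.* v
          W₀-values b b≢0 = 4*[W²+vW-2v²]≡0⇒ v (W₀ b) (begin
            deviation b                  ≡⟨ ℤ.*-identityˡ (deviation b) ⟨
            1ℤ ℤ.* deviation b           ≡⟨ cong (ℤ._* deviation b) (nonZero-≢0 b≢0) ⟨
            nonZero b ℤ.* deviation b    ≡⟨ ∑-nonNegative (λ b → nonZero b ℤ.* deviation b) (by-zero
                                              (ℤ.≤-reflexive (sym (trans (cong (ℤ._* deviation 0#) nonZero-0) (ℤ.*-zeroˡ (deviation 0#)))))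
                                              (λ b b≢0 → subst (0ℤ ℤ.≤_) (sym (trans (cong (ℤ._* deviation b) (nonZero-≢0 b≢0)) (ℤ.*-identityˡ (deviation b)))) (deviation≥0 b)))
                                            ∑-deviation b ⟩
            0ℤ                           ∎)

          κ-values : ∀ b {d} → W₀ b ≡ d ℤ.* v → κ b ≡ d ℤ.* d
          κ-values b {d} W₀≡dv = ℤ.*-cancelˡ-≡ N (κ b) (d ℤ.* d) (begin
            N ℤ.* κ b                    ≡⟨ W₀²≡Nκ b ⟨
            W₀ b ℤ.* W₀ b                ≡⟨ cong (λ w → w ℤ.* w) W₀≡dv ⟩
            d ℤ.* v ℤ.* (d ℤ.* v)        ≡⟨ *-interchange d v ⟩
            v ℤ.* v ℤ.* (d ℤ.* d)        ≡⟨ cong (ℤ._* (d ℤ.* d)) v²≡N ⟩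
            N ℤ.* (d ℤ.* d)              ∎)

        count : Carrier → ℕ → ℤ
        count b l = ∑ λ a → indicator (l ℕ.≟ ∣ W G b a ∣)

        -- In a row with κ b = d², every Walsh value is 0 or H in absolute value, because H² = N κ
        -- b; Parseval's identity then counts both levels. `H` is separate from d ∣v∣ so that d = 1
        -- can be used with `h` itself.
        module _ (b : Carrier) (d H : ℕ) (d≢0 : d ≢ 0) (H≡ : H ≡ d ℕ.* ∣ v ∣) (κ≡ : κ b ≡ ℤ.+ d ℤ.* ℤ.+ d) where
          private
            Nκ≡H² : N ℤ.* κ b ≡ ℤ.+ (H ℕ.* H)
            Nκ≡H² = begin
              N ℤ.* κ b
                ≡⟨ cong₂ ℤ._*_ (trans (sym v²≡N) (i*i≡∣i∣*∣i∣ v)) κ≡ ⟩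
              ℤ.+ (∣ v ∣ ℕ.* ∣ v ∣) ℤ.* (ℤ.+ d ℤ.* ℤ.+ d)
                ≡⟨ cong (ℤ.+ (∣ v ∣ ℕ.* ∣ v ∣) ℤ.*_) (ℤ.pos-* d d) ⟨
              ℤ.+ (∣ v ∣ ℕ.* ∣ v ∣) ℤ.* ℤ.+ (d ℕ.* d)
                ≡⟨ ℤ.pos-* (∣ v ∣ ℕ.* ∣ v ∣) (d ℕ.* d) ⟨
              ℤ.+ (∣ v ∣ ℕ.* ∣ v ∣ ℕ.* (d ℕ.* d))
                ≡⟨ cong ℤ.+_ (*-interchangeℕ ∣ v ∣ d) ⟩
              ℤ.+ (d ℕ.* ∣ v ∣ ℕ.* (d ℕ.* ∣ v ∣))
                ≡⟨ cong (λ H → ℤ.+ (H ℕ.* H)) H≡ ⟨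
              ℤ.+ (H ℕ.* H) ∎

            H≢0 : H ≢ 0
            H≢0 H≡0 = [ d≢0 , v≢0 ∘ ℤ.∣i∣≡0⇒i≡0 ]′ (ℕ.m*n≡0⇒m≡0∨n≡0 d (trans (sym H≡) H≡0))

            levels : ∀ a → ∣ W G b a ∣ ≡ 0 ⊎ ∣ W G b a ∣ ≡ H
            levels a = Sum.map
              (λ ≡0 → cong ∣_∣ (i*i≡0⇒i≡0 (W G b a) ≡0))
              (λ ≡Nκ → m*m≡n*n⇒m≡n (ℤ.+-injective (trans (sym (i*i≡∣i∣*∣i∣ (W G b a))) (trans ≡Nκ Nκ≡H²))))
              (W²-dichotomy b a)

            W²≡H² : ∀ a → W G b a ℤ.* W G b a ≡ ℤ.+ (H ℕ.* H) ℤ.* indicator (H ℕ.≟ ∣ W G b a ∣)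
            W²≡H² a = trans (i*i≡∣i∣*∣i∣ (W G b a)) ([
              (λ ≡0 → trans (cong (λ w → ℤ.+ (w ℕ.* w)) ≡0)
                (sym (trans (cong (ℤ.+ (H ℕ.* H) ℤ.*_) (indicator-no (H ℕ.≟ ∣ W G b a ∣) λ H≡∣W∣ → H≢0 (trans H≡∣W∣ ≡0))) (ℤ.*-zeroʳ (ℤ.+ (H ℕ.* H)))))) ,
              (λ ≡H → trans (cong (λ w → ℤ.+ (w ℕ.* w)) ≡H)
                (sym (trans (cong (ℤ.+ (H ℕ.* H) ℤ.*_) (indicator-yes (H ℕ.≟ ∣ W G b a ∣) (sym ≡H))) (ℤ.*-identityʳ (ℤ.+ (H ℕ.* H)))))) ]′
              (levels a))

          count-H : N ≡ ℤ.+ d ℤ.* ℤ.+ d ℤ.* count b H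
          count-H = ℤ.*-cancelˡ-≡ N N (ℤ.+ d ℤ.* ℤ.+ d ℤ.* count b H) (begin
            N ℤ.* N                                     ≡⟨ parseval b ⟨
            ∑ (λ a → W G b a ℤ.* W G b a)               ≡⟨ ∑-cong W²≡H² ⟩
            ∑ (λ a → ℤ.+ (H ℕ.* H) ℤ.* indicator (H ℕ.≟ ∣ W G b a ∣)) ≡⟨ ∑-*ˡ (ℤ.+ (H ℕ.* H)) (λ a → indicator (H ℕ.≟ ∣ W G b a ∣)) ⟩
            ℤ.+ (H ℕ.* H) ℤ.* count b H                 ≡⟨ cong (ℤ._* count b H) (trans (sym Nκ≡H²) (cong (N ℤ.*_) κ≡)) ⟩
            N ℤ.* (ℤ.+ d ℤ.* ℤ.+ d) ℤ.* count b H       ≡⟨ ℤ.*-assoc N (ℤ.+ d ℤ.* ℤ.+ d) (count b H) ⟩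
            N ℤ.* (ℤ.+ d ℤ.* ℤ.+ d ℤ.* count b H)       ∎)

          count-0 : N ≡ count b 0 ℤ.+ count b H
          count-0 = sym (trans (sym (∑-+ (λ a → indicator (0 ℕ.≟ ∣ W G b a ∣)) (λ a → indicator (H ℕ.≟ ∣ W G b a ∣))))
            (trans (∑-cong λ a → [
              (λ ≡0 → cong₂ ℤ._+_ (indicator-yes (0 ℕ.≟ ∣ W G b a ∣) (sym ≡0)) (indicator-no (H ℕ.≟ ∣ W G b a ∣) λ eq → H≢0 (trans eq ≡0))) ,
              (λ ≡H → cong₂ ℤ._+_ (indicator-no (0 ℕ.≟ ∣ W G b a ∣) λ eq → H≢0 (trans (sym ≡H) (sym eq))) (indicator-yes (H ℕ.≟ ∣ W G b a ∣) (sym ≡H))) ]′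
              (levels a)) ∑-1))

          count-other : ∀ {l} → l ≢ 0 → l ≢ H → count b l ≡ 0ℤ
          count-other {l} l≢0 l≢H = trans
            (∑-cong λ a → trans (indicator-no (l ℕ.≟ ∣ W G b a ∣) λ eq → [ l≢0 ∘ trans eq , l≢H ∘ trans eq ]′ (levels a)) (sym (ℤ.*-zeroˡ 0ℤ)))
            (trans (∑-*ˡ 0ℤ (λ _ → 0ℤ)) (ℤ.*-zeroˡ (∑ (λ _ → 0ℤ))))

        -- Weight b ≠ 0 by [W₀ b = v] = (W₀ b + 2v) / 3v and [W₀ b = -2v] = (v - W₀ b) / 3v.
        ∑-count : ∀ l α β → (∀ b → κ b ≡ 1ℤ → count b l ≡ α) → (∀ b → κ b ≡ ℤ.+ 4 → count b l ≡ β) →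
          ℤ.+ 3 ℤ.* ∑ (λ b → nonZero b ℤ.* count b l) ≡ (N ℤ.+ -1ℤ) ℤ.* (ℤ.+ 2 ℤ.* α ℤ.+ β)
        ∑-count l α β κ≡1⇒ κ≡4⇒ = ℤ.*-cancelˡ-≡ v _ _ {{ℤ.≢-nonZero v≢0}} (begin
          v ℤ.* (ℤ.+ 3 ℤ.* ∑ (λ b → nonZero b ℤ.* count b l))
            ≡⟨ trans (sym (ℤ.*-assoc v (ℤ.+ 3) (∑ (λ b → nonZero b ℤ.* count b l)))) (sym (∑-*ˡ (v ℤ.* ℤ.+ 3) (λ b → nonZero b ℤ.* count b l))) ⟩
          ∑ (λ b → v ℤ.* ℤ.+ 3 ℤ.* (nonZero b ℤ.* count b l))
            ≡⟨ ∑-cong (by-zero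
                 (trans (cong (λ i → v ℤ.* ℤ.+ 3 ℤ.* (i ℤ.* count 0# l)) nonZero-0)
                   (trans (*-zeros (v ℤ.* ℤ.+ 3) (count 0# l) (weight 0#)) (cong (ℤ._* weight 0#) (sym nonZero-0))))
                 (λ b b≢0 → trans (*-swap (v ℤ.* ℤ.+ 3) (nonZero b) (count b l))
                   (cong (nonZero b ℤ.*_) ([ W₀≡v⇒ b , W₀≡-2v⇒ b ]′ (W₀-values b b≢0))))) ⟩
          ∑ (λ b → nonZero b ℤ.* weight b)
            ≡⟨ ∑-nonZero weight ⟩
          ∑ weight ℤ.+ -1ℤ ℤ.* weight 0#
            ≡⟨ cong₂ (λ x y → x ℤ.+ -1ℤ ℤ.* ((α ℤ.+ -1ℤ ℤ.* β) ℤ.* y ℤ.+ (ℤ.+ 2 ℤ.* α ℤ.+ β) ℤ.* v ℤ.* 1ℤ))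
                 (trans (∑-+ (λ b → (α ℤ.+ -1ℤ ℤ.* β) ℤ.* W₀ b) (λ _ → (ℤ.+ 2 ℤ.* α ℤ.+ β) ℤ.* v ℤ.* 1ℤ))
                   (cong₂ ℤ._+_ (trans (∑-*ˡ (α ℤ.+ -1ℤ ℤ.* β) W₀) (cong ((α ℤ.+ -1ℤ ℤ.* β) ℤ.*_) ∑W₀))
                     (trans (∑-*ˡ ((ℤ.+ 2 ℤ.* α ℤ.+ β) ℤ.* v) (λ _ → 1ℤ)) (cong ((ℤ.+ 2 ℤ.* α ℤ.+ β) ℤ.* v ℤ.*_) ∑-1))))
                 W₀0≡N ⟩
          ((α ℤ.+ -1ℤ ℤ.* β) ℤ.* N ℤ.+ (ℤ.+ 2 ℤ.* α ℤ.+ β) ℤ.* v ℤ.* N)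
            ℤ.+ -1ℤ ℤ.* ((α ℤ.+ -1ℤ ℤ.* β) ℤ.* N ℤ.+ (ℤ.+ 2 ℤ.* α ℤ.+ β) ℤ.* v ℤ.* 1ℤ)
            ≡⟨ weight-total (α ℤ.+ -1ℤ ℤ.* β) (ℤ.+ 2 ℤ.* α ℤ.+ β) v N ⟩
          v ℤ.* ((N ℤ.+ -1ℤ) ℤ.* (ℤ.+ 2 ℤ.* α ℤ.+ β)) ∎)
          where
          weight : Carrier → ℤ
          weight b = (α ℤ.+ -1ℤ ℤ.* β) ℤ.* W₀ b ℤ.+ (ℤ.+ 2 ℤ.* α ℤ.+ β) ℤ.* v ℤ.* 1ℤ
          W₀≡v⇒ : ∀ b → W₀ b ≡ v → v ℤ.* ℤ.+ 3 ℤ.* count b l ≡ weight b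
          W₀≡v⇒ b W₀≡v = begin
            v ℤ.* ℤ.+ 3 ℤ.* count b l    ≡⟨ cong (v ℤ.* ℤ.+ 3 ℤ.*_) (κ≡1⇒ b (κ-values b {1ℤ} (trans W₀≡v (sym (ℤ.*-identityˡ v))))) ⟩
            v ℤ.* ℤ.+ 3 ℤ.* α            ≡⟨ weight-v α β v ⟩
            (α ℤ.+ -1ℤ ℤ.* β) ℤ.* v ℤ.+ (ℤ.+ 2 ℤ.* α ℤ.+ β) ℤ.* v ℤ.* 1ℤ ≡⟨ cong (λ w → (α ℤ.+ -1ℤ ℤ.* β) ℤ.* w ℤ.+ (ℤ.+ 2 ℤ.* α ℤ.+ β) ℤ.* v ℤ.* 1ℤ) W₀≡v ⟨
            weight b                     ∎
          W₀≡-2v⇒ : ∀ b → W₀ b ≡ -[1+ 1 ] ℤ.* v → v ℤ.* ℤ.+ 3 ℤ.* count b l ≡ weight b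
          W₀≡-2v⇒ b W₀≡-2v = begin
            v ℤ.* ℤ.+ 3 ℤ.* count b l    ≡⟨ cong (v ℤ.* ℤ.+ 3 ℤ.*_) (κ≡4⇒ b (κ-values b { -[1+ 1 ]} W₀≡-2v)) ⟩
            v ℤ.* ℤ.+ 3 ℤ.* β            ≡⟨ weight-−2v α β v ⟩
            (α ℤ.+ -1ℤ ℤ.* β) ℤ.* (-[1+ 1 ] ℤ.* v) ℤ.+ (ℤ.+ 2 ℤ.* α ℤ.+ β) ℤ.* v ℤ.* 1ℤ ≡⟨ cong (λ w → (α ℤ.+ -1ℤ ℤ.* β) ℤ.* w ℤ.+ (ℤ.+ 2 ℤ.* α ℤ.+ β) ℤ.* v ℤ.* 1ℤ) W₀≡-2v ⟨
            weight b                     ∎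

        multiplicity-count : ∀ l → ℤ.+ Walsh.multiplicity L l (Walsh.extendedWalshSpectrum L G) ≡ ∑ (λ b → nonZero b ℤ.* count b l)
        multiplicity-count l = length-filter-pairs (λ b → ¬? (b ≟ 0#)) (l ℕ.≟_) (λ (b , a) → ∣ W G b a ∣)

        -- Two thirds of the nonzero b have κ b = 1 and one third have κ b = 4. The factor 3 keeps
        -- the identity free of division.
        3*multiplicity : ∀ l α β → (∀ b → κ b ≡ 1ℤ → count b l ≡ ℤ.+ α) → (∀ b → κ b ≡ ℤ.+ 4 → count b l ≡ ℤ.+ β) →
          Walsh.multiplicity L l (Walsh.extendedWalshSpectrum L G) ℕ.* 3 ≡ (2 ℕ.^ n ℕ.∸ 1) ℕ.* (2 ℕ.* α ℕ.+ β)
        3*multiplicity l α β κ≡1⇒ κ≡4⇒ = ℤ.+-injective (begin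
          ℤ.+ (mult ℕ.* 3)                                            ≡⟨ cong ℤ.+_ (ℕ.*-comm mult 3) ⟩
          ℤ.+ (3 ℕ.* mult)                                            ≡⟨ ℤ.pos-* 3 mult ⟩
          ℤ.+ 3 ℤ.* ℤ.+ mult                                          ≡⟨ cong (ℤ.+ 3 ℤ.*_) (multiplicity-count l) ⟩
          ℤ.+ 3 ℤ.* ∑ (λ b → nonZero b ℤ.* count b l)                 ≡⟨ ∑-count l (ℤ.+ α) (ℤ.+ β) κ≡1⇒ κ≡4⇒ ⟩
          (N ℤ.+ -1ℤ) ℤ.* (ℤ.+ 2 ℤ.* ℤ.+ α ℤ.+ ℤ.+ β)                 ≡⟨ cong₂ ℤ._*_ (predecessor (2 ℕ.^ n) (ℕ.m^n>0 2 n)) (cong (λ w → w ℤ.+ ℤ.+ β) (sym (ℤ.pos-* 2 α))) ⟩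
          ℤ.+ (2 ℕ.^ n ℕ.∸ 1) ℤ.* ℤ.+ (2 ℕ.* α ℕ.+ β)                 ≡⟨ ℤ.pos-* (2 ℕ.^ n ℕ.∸ 1) (2 ℕ.* α ℕ.+ β) ⟨
          ℤ.+ ((2 ℕ.^ n ℕ.∸ 1) ℕ.* (2 ℕ.* α ℕ.+ β))                   ∎)
          where
          mult = Walsh.multiplicity L l (Walsh.extendedWalshSpectrum L G)
          predecessor : ∀ k → 0 < k → ℤ.+ k ℤ.+ -1ℤ ≡ ℤ.+ (k ℕ.∸ 1)
          predecessor (suc k) _ = refl

        -- The row counts: if κ b = 1, all N values have size h; if κ b = 4, then N / 4 = Q values
        -- have size 2h and the other 3Q vanish.
        module _ (Q : ℕ) (N≡4Q : 2 ℕ.^ n ≡ 4 ℕ.* Q) where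
          private
            h = ∣ v ∣

            h≢0 : h ≢ 0
            h≢0 h≡0 = v≢0 (ℤ.∣i∣≡0⇒i≡0 h≡0)

            2h≢0 : 2 ℕ.* h ≢ 0
            2h≢0 eq = h≢0 (ℕ.m+n≡0⇒m≡0 h eq)

            h≢2h : h ≢ 2 ℕ.* h
            h≢2h eq = h≢0 (sym (ℕ.+-cancelˡ-≡ h 0 h (trans (ℕ.+-identityʳ h) (trans eq (cong (h ℕ.+_) (ℕ.+-identityʳ h))))))

            1≢0 : 1 ≢ 0
            1≢0 ()
            2≢0 : 2 ≢ 0
            2≢0 ()

            h≡ : h ≡ 1 ℕ.* h
            h≡ = sym (ℕ.*-identityˡ h)

            κ≡1⇒count-h : ∀ b → κ b ≡ 1ℤ → count b h ≡ N
            κ≡1⇒count-h b κ≡1 = sym (trans (count-H b 1 h 1≢0 h≡ κ≡1) (ℤ.*-identityˡ (count b h)))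

            κ≡4⇒count-2h : ∀ b → κ b ≡ ℤ.+ 4 → count b (2 ℕ.* h) ≡ ℤ.+ Q
            κ≡4⇒count-2h b κ≡4 = ℤ.*-cancelˡ-≡ (ℤ.+ 4) (count b (2 ℕ.* h)) (ℤ.+ Q)
              (trans (sym (count-H b 2 (2 ℕ.* h) 2≢0 refl κ≡4)) (trans (cong ℤ.+_ N≡4Q) (ℤ.pos-* 4 Q)))

            κ≡1⇒count-0 : ∀ b → κ b ≡ 1ℤ → count b 0 ≡ ℤ.+ 0
            κ≡1⇒count-0 b κ≡1 = trans (i≡j+k⇒j≡i-k (count-0 b 1 h 1≢0 h≡ κ≡1))
              (trans (cong (ℤ._-_ N) (κ≡1⇒count-h b κ≡1)) (ℤ.+-inverseʳ N))

            κ≡4⇒count-0 : ∀ b → κ b ≡ ℤ.+ 4 → count b 0 ≡ ℤ.+ (3 ℕ.* Q)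
            κ≡4⇒count-0 b κ≡4 = begin
              count b 0                    ≡⟨ i≡j+k⇒j≡i-k (count-0 b 2 (2 ℕ.* h) 2≢0 refl κ≡4) ⟩
              N ℤ.- count b (2 ℕ.* h)      ≡⟨ cong₂ ℤ._-_ (trans (cong ℤ.+_ N≡4Q) (ℤ.pos-* 4 Q)) (κ≡4⇒count-2h b κ≡4) ⟩
              ℤ.+ 4 ℤ.* ℤ.+ Q ℤ.- ℤ.+ Q    ≡⟨ 4*i-i (ℤ.+ Q) ⟩
              ℤ.+ 3 ℤ.* ℤ.+ Q              ≡⟨ ℤ.pos-* 3 Q ⟨
              ℤ.+ (3 ℕ.* Q)                ∎

          multiplicity-0 : Walsh.multiplicity L 0 (Walsh.extendedWalshSpectrum L G) ≡ (2 ℕ.^ n ℕ.∸ 1) ℕ.* Q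
          multiplicity-0 = ℕ.*-cancelʳ-≡ _ _ 3 (trans (3*multiplicity 0 0 (3 ℕ.* Q) κ≡1⇒count-0 κ≡4⇒count-0)
            (x*3y (2 ℕ.^ n ℕ.∸ 1) Q))

          3*multiplicity-h : Walsh.multiplicity L h (Walsh.extendedWalshSpectrum L G) ℕ.* 3 ≡ (2 ℕ.^ n ℕ.∸ 1) ℕ.* (2 ℕ.* 2 ℕ.^ n)
          3*multiplicity-h = trans (3*multiplicity h (2 ℕ.^ n) 0 κ≡1⇒count-h
              (λ b κ≡4 → count-other b 2 (2 ℕ.* h) 2≢0 refl κ≡4 h≢0 h≢2h))
            (cong ((2 ℕ.^ n ℕ.∸ 1) ℕ.*_) (ℕ.+-identityʳ (2 ℕ.* 2 ℕ.^ n)))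

          3*multiplicity-2h : Walsh.multiplicity L (2 ℕ.* h) (Walsh.extendedWalshSpectrum L G) ℕ.* 3 ≡ (2 ℕ.^ n ℕ.∸ 1) ℕ.* Q
          3*multiplicity-2h = 3*multiplicity (2 ℕ.* h) 0 Q
            (λ b κ≡1 → count-other b 1 h 1≢0 h≡ κ≡1 2h≢0 (h≢2h ∘ sym)) κ≡4⇒count-2h

-- The classical spectrum of quadratic 3-to-1 functions in even dimension.

module _ (m : ℕ) (L : BinaryField (2 ℕ.* m)) where
  open FieldProperties L

  module _ (m≢0 : m ≢ 0)
    (G : Carrier → Carrier) (D : Carrier → Carrier → Carrier)
    (G-+ : ∀ x y → G (x + y) ≡ G x + G y + D x y)
    (D-+ˡ : ∀ x x′ y → D (x + x′) y ≡ D x y + D x′ y) (D-sym : ∀ x y → D x y ≡ D y x)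
    (G≡0⇒≡0 : ∀ x → G x ≡ 0# → x ≡ 0#)
    (G-fibre : ∀ x → x ≢ 0# → length (filter (λ y → G x ≟ G y) elements) ≡ 3) where

    private
      n = 2 ℕ.* m

      n≢0 : n ≢ 0
      n≢0 n≡0 = m≢0 (ℕ.m+n≡0⇒m≡0 m n≡0)

      Q = 2 ℕ.^ (n ℕ.∸ 2)

      2≤n : 2 ≤ n
      2≤n = ℕ.*-monoʳ-≤ 2 (ℕ.n≢0⇒n>0 m≢0)

      N≡4Q : 2 ℕ.^ n ≡ 4 ℕ.* Q
      N≡4Q = trans (cong (2 ℕ.^_) (sym (ℕ.m+[n∸m]≡n 2≤n))) (sym (ℕ.*-assoc 2 2 Q))

      n/2≡m : n / 2 ≡ m
      n/2≡m = trans (cong (_/ 2) (ℕ.*-comm 2 m)) (m*n/n≡m m 2)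

      [n+2]/2≡1+m : (n ℕ.+ 2) / 2 ≡ 1 ℕ.+ m
      [n+2]/2≡1+m = trans (cong (_/ 2) (trans (ℕ.+-comm n 2) (trans (sym (ℕ.*-suc 2 m)) (ℕ.*-comm 2 (suc m))))) (m*n/n≡m (suc m) 2)

      /3 : ∀ {k l} → k ℕ.* 3 ≡ l → k ≡ l / 3
      /3 {k} refl = sym (m*n/n≡m k 3)

    quadratic∧threeToOne⇒classical : Walsh.ClassicalWalshSpectrum L G
    quadratic∧threeToOne⇒classical = from-root (IntegerLemmas.signed-root m)
      where
      from-root : (∃ λ v → v ℤ.* v ≡ ℤ.+ (2 ℕ.^ n) × ∣ v ∣ ≡ 2 ℕ.^ m × ∃ λ t → v ≡ 1ℤ ℤ.+ ℤ.+ 3 ℤ.* t) → Walsh.ClassicalWalshSpectrum L G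
      from-root (v , v²≡N , ∣v∣≡2^m , t , v≡) =
        Spectrum.multiplicity-0 G≡0⇒≡0 ∑-fibre v t v²≡N v≡ Q N≡4Q ,
        /3 (trans (cong (λ l → mult l ℕ.* 3) (trans (cong (2 ℕ.^_) n/2≡m) (sym ∣v∣≡2^m)))
          (trans (Spectrum.3*multiplicity-h G≡0⇒≡0 ∑-fibre v t v²≡N v≡ Q N≡4Q) (cong (λ e → (2 ℕ.^ n ℕ.∸ 1) ℕ.* 2 ℕ.^ e) (ℕ.+-comm 1 n)))) ,
        /3 (trans (cong (λ l → mult l ℕ.* 3) (trans (cong (2 ℕ.^_) [n+2]/2≡1+m) (cong (2 ℕ.*_) (sym ∣v∣≡2^m))))
          (Spectrum.3*multiplicity-2h G≡0⇒≡0 ∑-fibre v t v²≡N v≡ Q N≡4Q))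
        where
        mult : ℕ → ℕ
        mult l = Walsh.multiplicity L l (Walsh.extendedWalshSpectrum L G)
        module Spectrum = QuadraticWalsh L n≢0 G D G-+ D-+ˡ D-sym
        ∑-fibre : ∀ x → x ≢ 0# → Character.∑ L (λ y → Character.indicator L (G x ≟ G y)) ≡ ℤ.+ 3
        ∑-fibre x x≢0 = trans (sym (Character.length-filter-elements L (λ y → G x ≟ G y))) (cong ℤ.+_ (G-fibre x x≢0))

-- The trinomial system behind the APN property.

module Trinomials {n : ℕ} (M : BinaryField n) where
  open FieldProperties M
  open ≡-Reasoning

  private
    difference : ∀ {x y} → x ≡ y → ∀ z → z * (x + y) ≡ 0#
    difference {x} refl z = trans (cong (z *_) (x+x≡0 x)) (zeroʳ z)

  -- σ x = x^q and τ is the involution of M over K. In terms of Z = X + τ Y, D = σ Y + Y and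
  -- α = A τ A + e the two equations yield α D = e τ Z + τ A Z and σ Z + Z = A D + τ D, and
  -- eliminating D gives α σ Z = (e + 1) A τ Z.
  module _ (σ τ : Carrier → Carrier)
    (σ-+ : ∀ x y → σ (x + y) ≡ σ x + σ y) (σ-nonZero : ∀ {x} → x ≢ 0# → σ x ≢ 0#)
    (τ-+ : ∀ x y → τ (x + y) ≡ τ x + τ y) (τ-* : ∀ x y → τ (x * y) ≡ τ x * τ y)
    (τ-σ : ∀ x → τ (σ x) ≡ σ (τ x)) (τ-τ : ∀ x → τ (τ x) ≡ x) where

    private
      -- Adding `A′` times the first equation to the second removes σ X. All images under σ and τ
      -- are free variables here, so that exchanging primed and unprimed letters gives the
      -- τ-conjugate relation as well.
      elimination : ∀ A A′ e X X′ Y Y′ sX sY →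
        sX + X ≡ A * (sY + Y) → A′ * (sX + Y′) ≡ e * (X′ + sY) →
        (A * A′ + e) * (sY + Y) ≡ e * (X′ + Y) + A′ * (X + Y′)
      elimination A A′ e X X′ Y Y′ sX sY eq₁ eq₂ = x+y≡0⇒x≡y (begin
        (A * A′ + e) * (sY + Y) + (e * (X′ + Y) + A′ * (X + Y′))
          ≡⟨ solve 9 (λ A A′ e X X′ Y Y′ sX sY →
               (A :* A′ :+ e) :* (sY :+ Y) :+ (e :* (X′ :+ Y) :+ A′ :* (X :+ Y′)) :=
               A′ :* ((sX :+ X) :+ A :* (sY :+ Y)) :+ (A′ :* (sX :+ Y′) :+ e :* (X′ :+ sY)))
               refl A A′ e X X′ Y Y′ sX sY ⟩
        A′ * ((sX + X) + A * (sY + Y)) + (A′ * (sX + Y′) + e * (X′ + sY))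
          ≡⟨ cong₂ _+_ (difference eq₁ A′) (trans (cong (_+ e * (X′ + sY)) eq₂) (x+x≡0 _)) ⟩
        0# + 0#
          ≡⟨ +-identityˡ 0# ⟩
        0# ∎)

    -- `nonCube` is the cubic residue argument in abstract form: in the application σ (τ z) is z
    -- times a cube, and α and δ are cubes, so equality would make A a ratio of cubes. What remains
    -- here is pure elimination.
    module _ (A e X Y : Carrier) (τe : τ e ≡ e) (A≢0 : A ≢ 0#)
      (nonCube : ∀ α δ z → τ α ≡ α → α ≢ 0# → τ δ ≡ δ → δ ≢ 0# → z ≢ 0# → α * σ (τ z) ≢ δ * (A * z))
      (nonDegenerate : A * τ A ≡ 1# → e ≢ 1#)
      (eq₁ : σ X + X ≡ A * (σ Y + Y))
      (eq₂ : A * (σ (τ X) + Y) ≡ e * (X + σ (τ Y))) where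

      private
        α D D′ Z Z′ : Carrier
        α  = A * τ A + e
        D  = σ Y + Y
        D′ = σ (τ Y) + τ Y
        Z  = X + τ Y
        Z′ = τ X + Y

        τστ : ∀ x → τ (σ (τ x)) ≡ σ x
        τστ x = trans (τ-σ (τ x)) (cong σ (τ-τ x))

        τD : τ D ≡ D′
        τD = trans (τ-+ _ _) (cong (_+ τ Y) (τ-σ Y))

        τZ : τ Z ≡ Z′
        τZ = trans (τ-+ _ _) (cong (τ X +_) (τ-τ Y))

        τ-α : τ α ≡ α
        τ-α = trans (τ-+ _ _) (cong₂ _+_ (trans (τ-* _ _) (trans (cong (τ A *_) (τ-τ A)) (*-comm _ _))) τe)

        τ1 : τ 1# ≡ 1#
        τ1 = begin
          τ 1#            ≡⟨ *-identityʳ _ ⟨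
          τ 1# * 1#       ≡⟨ cong (τ 1# *_) (τ-τ 1#) ⟨
          τ 1# * τ (τ 1#) ≡⟨ τ-* 1# (τ 1#) ⟨
          τ (1# * τ 1#)   ≡⟨ cong τ (*-identityˡ _) ⟩
          τ (τ 1#)        ≡⟨ τ-τ 1# ⟩
          1#              ∎

        τ0 : τ 0# ≡ 0#
        τ0 = begin
          τ 0#        ≡⟨ cong τ (x+x≡0 1#) ⟨
          τ (1# + 1#) ≡⟨ τ-+ 1# 1# ⟩
          τ 1# + τ 1# ≡⟨ x+x≡0 _ ⟩
          0#          ∎

        eq₁′ : σ (τ X) + τ X ≡ τ A * D′
        eq₁′ = begin
          σ (τ X) + τ X  ≡⟨ cong (_+ τ X) (τ-σ X) ⟨
          τ (σ X) + τ X  ≡⟨ τ-+ _ _ ⟨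
          τ (σ X + X)    ≡⟨ cong τ eq₁ ⟩
          τ (A * D)      ≡⟨ τ-* _ _ ⟩
          τ A * τ D      ≡⟨ cong (τ A *_) τD ⟩
          τ A * D′       ∎

        eq₂′ : τ A * (σ X + τ Y) ≡ e * (τ X + σ Y)
        eq₂′ = begin
          τ A * (σ X + τ Y)          ≡⟨ cong (τ A *_) (trans (τ-+ _ _) (cong (_+ τ Y) (τστ X))) ⟨
          τ A * τ (σ (τ X) + Y)      ≡⟨ τ-* _ _ ⟨
          τ (A * (σ (τ X) + Y))      ≡⟨ cong τ eq₂ ⟩
          τ (e * (X + σ (τ Y)))      ≡⟨ τ-* _ _ ⟩
          τ e * τ (X + σ (τ Y))      ≡⟨ cong₂ _*_ τe (trans (τ-+ _ _) (cong (τ X +_) (τστ Y))) ⟩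
          e * (τ X + σ Y)            ∎

        αD : α * D ≡ e * Z′ + τ A * Z
        αD = elimination A (τ A) e X (τ X) Y (τ Y) (σ X) (σ Y) eq₁ eq₂′

        αD′ : α * D′ ≡ e * Z + A * Z′
        αD′ = trans (cong (λ w → (w + e) * D′) (*-comm A (τ A)))
          (elimination (τ A) A e (τ X) X (τ Y) Y (σ (τ X)) (σ (τ Y)) eq₁′ eq₂)

        ασZ : α * σ Z ≡ (e + 1#) * (A * Z′)
        ασZ = x+y≡0⇒x≡y (begin
          α * σ Z + (e + 1#) * (A * Z′)
            ≡⟨ cong (λ w → α * w + (e + 1#) * (A * Z′)) (σ-+ _ _) ⟩
          α * (σ X + σ (τ Y)) + (e + 1#) * (A * Z′)
            ≡⟨ solve 10 (λ α e A A′ X X′ Y Y′ sX sY →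
                 α :* (sX :+ sY) :+ (e :+ con true) :* (A :* X′) :=
                 α :* (sX :+ X) :+ α :* (X :+ Y′) :+ A :* (e :* X′) :+ α :* (sY :+ Y′) :+ A :* X′)
                 refl α e A (τ A) X Z′ Y (τ Y) (σ X) (σ (τ Y)) ⟩
          α * (σ X + X) + α * Z + A * (e * Z′) + α * D′ + A * Z′
            ≡⟨ cong₂ (λ w w′ → α * w + α * Z + A * (e * Z′) + w′ + A * Z′) eq₁ αD′ ⟩
          α * (A * D) + α * Z + A * (e * Z′) + (e * Z + A * Z′) + A * Z′
            ≡⟨ solve 6 (λ A A′ e Z Z′ D → let α = A :* A′ :+ e in
                 α :* (A :* D) :+ α :* Z :+ A :* (e :* Z′) :+ (e :* Z :+ A :* Z′) :+ A :* Z′ :=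
                 A :* (α :* D :+ (e :* Z′ :+ A′ :* Z)))
                 refl A (τ A) e Z Z′ D ⟩
          A * (α * D + (e * Z′ + τ A * Z))
            ≡⟨ difference αD A ⟩
          0# ∎)

        αe-nonDegenerate : α ≡ 0# → e ≢ 1#
        αe-nonDegenerate α≡0 e≡1 = nonDegenerate (trans (x+y≡0⇒x≡y α≡0) e≡1) e≡1

        Z≡0 : Z ≡ 0#
        Z≡0 with Z ≟ 0#
        ... | yes Z≡0 = Z≡0
        ... | no Z≢0 = ⊥-elim impossible
          where
          Z′≢0 : Z′ ≢ 0#
          Z′≢0 Z′≡0 = Z≢0 (trans (sym (τ-τ Z)) (trans (cong τ (trans τZ Z′≡0)) τ0))
          impossible : ⊥
          -- In α σ Z = (e + 1) A τ Z, two zero coefficients are the degenerate case, exactly one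
          -- contradicts Z ≠ 0, and none contradicts `nonCube` at z = τ Z.
          impossible with α ≟ 0# | e ≟ 1#
          ... | yes α≡0 | yes e≡1 = αe-nonDegenerate α≡0 e≡1
          ... | yes α≡0 | no e≢1 = *-nonZero (e≢1 ∘ x+y≡0⇒x≡y) (*-nonZero A≢0 Z′≢0)
            (trans (sym ασZ) (trans (cong (_* σ Z) α≡0) (zeroˡ _)))
          ... | no α≢0 | yes e≡1 = *-nonZero α≢0 (σ-nonZero Z≢0)
            (trans ασZ (trans (cong (λ w → (w + 1#) * (A * Z′)) e≡1) (trans (cong (_* (A * Z′)) 1+1≡0) (zeroˡ _))))
          ... | no α≢0 | no e≢1 = nonCube α (e + 1#) Z′ τ-α α≢0 (trans (τ-+ _ _) (cong₂ _+_ τe τ1))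
            (e≢1 ∘ x+y≡0⇒x≡y) Z′≢0
            (trans (cong (λ w → α * σ w) (trans (cong τ (sym τZ)) (τ-τ Z))) ασZ)

        X≡τY : X ≡ τ Y
        X≡τY = x+y≡0⇒x≡y Z≡0

        D′≡AD : D′ ≡ A * D
        D′≡AD = trans (cong (λ w → σ w + w) (sym X≡τY)) eq₁

        -- With Z = 0 the first equation says τ D = A D. If D ≠ 0, applying τ once more gives A τ A
        -- = 1, and α D = 0 gives A τ A = e: the degenerate case again.
        D≡0 : D ≡ 0#
        D≡0 with D ≟ 0#
        ... | yes D≡0 = D≡0
        ... | no D≢0 = ⊥-elim (nonDegenerate N≡1 (trans (sym (x+y≡0⇒x≡y α≡0)) N≡1))
          where
          α≡0 : α ≡ 0#
          α≡0 = *-zero-cancelˡ D≢0 (begin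
            D * α                ≡⟨ *-comm D α ⟩
            α * D                ≡⟨ αD ⟩
            e * Z′ + τ A * Z     ≡⟨ cong₂ (λ w w′ → e * w + τ A * w′) (trans (sym τZ) (trans (cong τ Z≡0) τ0)) Z≡0 ⟩
            e * 0# + τ A * 0#    ≡⟨ cong₂ _+_ (zeroʳ e) (zeroʳ (τ A)) ⟩
            0# + 0#              ≡⟨ +-identityˡ 0# ⟩
            0#                   ∎)
          N≡1 : A * τ A ≡ 1#
          N≡1 = *-cancelˡ D≢0 (begin
            D * (A * τ A)   ≡⟨ solve 3 (λ D A A′ → D :* (A :* A′) := A′ :* (A :* D)) refl D A (τ A) ⟩
            τ A * (A * D)   ≡⟨ cong (τ A *_) (trans (sym D′≡AD) (sym τD)) ⟩
            τ A * τ D       ≡⟨ τ-* A D ⟨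
            τ (A * D)       ≡⟨ cong τ (trans (sym D′≡AD) (sym τD)) ⟩
            τ (τ D)         ≡⟨ τ-τ D ⟩
            D               ≡⟨ *-identityʳ D ⟨
            D * 1#          ∎)

      trinomials-solution : σ Y ≡ Y × X ≡ τ Y
      trinomials-solution = x+y≡0⇒x≡y D≡0 , X≡τY

-- Cubes and cube roots of unity.

module Cubes {n : ℕ} (M : BinaryField n) where
  open FieldProperties M
  open ≡-Reasoning

  ^-zero : ∀ k → 0# ^ suc k ≡ 0#
  ^-zero k = zeroˡ _

  nonCube-ratio : ∀ {B} → (∀ z → z ^ 3 ≢ B) → ∀ p s → s ≢ 0# → p ^ 3 ≢ B * s ^ 3
  nonCube-ratio {B} nonCube p s s≢0 eq = nonCube (p * s ⁻¹) (begin
    (p * s ⁻¹) ^ 3            ≡⟨ ^-distrib-* p (s ⁻¹) 3 ⟩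
    p ^ 3 * s ⁻¹ ^ 3          ≡⟨ cong (_* s ⁻¹ ^ 3) eq ⟩
    B * s ^ 3 * s ⁻¹ ^ 3      ≡⟨ *-assoc _ _ _ ⟩
    B * (s ^ 3 * s ⁻¹ ^ 3)    ≡⟨ cong (B *_) (^-distrib-* s (s ⁻¹) 3) ⟨
    B * (s * s ⁻¹) ^ 3        ≡⟨ cong (λ w → B * w ^ 3) (*-inverseʳ s≢0) ⟩
    B * 1# ^ 3                ≡⟨ cong (B *_) (1^ 3) ⟩
    B * 1#                    ≡⟨ *-identityʳ B ⟩
    B                         ∎)

  -- (x^(2i+1))³ = x^(3i+1) x^(3i+2), where x^(3i+1) = 1.
  fixed-isCube : ∀ i {x} → x ^ (2 ℕ.+ i ℕ.* 3) ≡ x → x ≢ 0# → ∃ λ y → y ≢ 0# × y ^ 3 ≡ x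
  fixed-isCube i {x} fixed x≢0 = x ^ (1 ℕ.+ i ℕ.* 2) , ^-nonZero (1 ℕ.+ i ℕ.* 2) x≢0 , (begin
    (x ^ (1 ℕ.+ i ℕ.* 2)) ^ 3                     ≡⟨ ^-assocʳ x (1 ℕ.+ i ℕ.* 2) 3 ⟩
    x ^ ((1 ℕ.+ i ℕ.* 2) ℕ.* 3)                   ≡⟨ cong (x ^_) (arith i) ⟩
    x ^ ((1 ℕ.+ i ℕ.* 3) ℕ.+ (2 ℕ.+ i ℕ.* 3))     ≡⟨ ^-homo-* x (1 ℕ.+ i ℕ.* 3) (2 ℕ.+ i ℕ.* 3) ⟩
    x ^ (1 ℕ.+ i ℕ.* 3) * x ^ (2 ℕ.+ i ℕ.* 3)     ≡⟨ cong₂ _*_ one fixed ⟩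
    1# * x                                        ≡⟨ *-identityˡ x ⟩
    x                                             ∎)
    where
    arith : ∀ i → (1 ℕ.+ i ℕ.* 2) ℕ.* 3 ≡ (1 ℕ.+ i ℕ.* 3) ℕ.+ (2 ℕ.+ i ℕ.* 3)
    arith = +-*-Solver.solve 1 (λ i → (κ 1 ⊕ i ⊗ κ 2) ⊗ κ 3 ⊜ (κ 1 ⊕ i ⊗ κ 3) ⊕ (κ 2 ⊕ i ⊗ κ 3)) refl
      where open +-*-Solver using () renaming (con to κ; _:+_ to _⊕_; _:*_ to _⊗_; _:=_ to _⊜_)
    one : x ^ (1 ℕ.+ i ℕ.* 3) ≡ 1#
    one = *-cancelˡ x≢0 (trans fixed (sym (*-identityʳ x)))

  -- A missed value, put in front of the image, would give more distinct elements than the field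
  -- has.
  injective⇒surjective : (f : Carrier → Carrier) → (∀ {x y} → f x ≡ f y → x ≡ y) → ∀ y → ∃ λ x → f x ≡ y
  injective⇒surjective f f-injective y with _∈?_ _≟_ y (map f elements)
  ... | yes y∈ with ∈-map⁻ f y∈
  ...   | x , _ , eq = x , sym eq
  injective⇒surjective f f-injective y | no y∉ =
    ⊥-elim (ℕ.1+n≰n (subst (λ k → suc k ≤ length elements) (List.length-map f elements)
      (Unique-⊆⇒length≤ (¬Any⇒All¬ _ y∉ ∷ Unique.map⁺ f-injective elements-unique) λ {x} _ → ∈-elements x)))

  -- Without a root of ω² + ω + 1 cubing would be injective, hence surjective.
  primitive-cube-root : ∀ {B} → (∀ z → z ^ 3 ≢ B) → ∃ λ ω → ω * ω + ω + 1# ≡ 0#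
  primitive-cube-root {B} nonCube with Any.any? (λ ω → ω * ω + ω + 1# ≟ 0#) elements
  ... | yes p = Any.satisfied p
  ... | no none = ⊥-elim (nonCube _ (proj₂ (injective⇒surjective (_^ 3) cube-injective B)))
    where
    cube-injective : ∀ {x y} → x ^ 3 ≡ y ^ 3 → x ≡ y
    cube-injective {x} {y} eq with x ≟ y | y ≟ 0#
    ... | yes x≡y | _ = x≡y
    ... | no x≢y | yes refl = ⊥-elim (^-nonZero 3 x≢y (trans eq (^-zero 2)))
    ... | no x≢y | no y≢0 = ⊥-elim (none (Any.map (λ { refl → root }) (∈-elements ω)))
      where
      -- Since x³ + y³ = (x + y) (x² + x y + y²), distinct x and y with equal cubes have such a
      -- quotient as a root.
      ω = x * y ⁻¹
      root : ω * ω + ω + 1# ≡ 0#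
      root = *-zero-cancelˡ (x≢y ∘ x+y≡0⇒x≡y) (*-zero-cancelˡ (*-nonZero y≢0 y≢0) (begin
        y * y * ((x + y) * (ω * ω + ω + 1#))
          ≡⟨ solve 3 (λ x y i → let ω = x :* i in
               y :* y :* ((x :+ y) :* (ω :* ω :+ ω :+ con true)) :=
               (x :+ y) :* ((x :* x) :* ((y :* i) :* (y :* i)) :+ x :* y :* (y :* i) :+ y :* y))
               refl x y (y ⁻¹) ⟩
        (x + y) * ((x * x) * ((y * y ⁻¹) * (y * y ⁻¹)) + x * y * (y * y ⁻¹) + y * y)
          ≡⟨ cong (λ w → (x + y) * ((x * x) * (w * w) + x * y * w + y * y)) (*-inverseʳ y≢0) ⟩
        (x + y) * ((x * x) * (1# * 1#) + x * y * 1# + y * y)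
          ≡⟨ solve 2 (λ x y →
               (x :+ y) :* ((x :* x) :* (con true :* con true) :+ x :* y :* con true :+ y :* y) :=
               x :* (x :* (x :* con true)) :+ y :* (y :* (y :* con true))) refl x y ⟩
        x ^ 3 + y ^ 3
          ≡⟨ cong (_+ y ^ 3) eq ⟩
        y ^ 3 + y ^ 3
          ≡⟨ x+x≡0 _ ⟩
        0# ∎))

length-filter : ∀ {A : Set} {P : A → Set} (P? : Decidable P) {xs ys} → Unique xs → (∀ x → x ∈ xs) →
  Unique ys → (∀ x → P x ⇔ x ∈ ys) → length (filter P? xs) ≡ length ys
length-filter P? {xs} xs! all∈ ys! P⇔∈ = ℕ.≤-antisym
  (Unique-⊆⇒length≤ (Unique.filter⁺ P? xs!) λ x∈ →
    Equivalence.to (P⇔∈ _) (proj₂ (∈-filter⁻ P? {xs = xs} x∈)))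
  (Unique-⊆⇒length≤ ys! λ x∈ → ∈-filter⁺ P? (all∈ _) (Equivalence.from (P⇔∈ _) x∈))

-- Powers of 2 modulo 3 and the parity of the exponents.

2^2*c : ∀ c → ∃ λ i → 2 ℕ.^ (2 ℕ.* c) ≡ 1 ℕ.+ i ℕ.* 3
2^2*c zero = 0 , refl
2^2*c (suc c) with 2^2*c c
... | i , eq = 1 ℕ.+ 4 ℕ.* i , (begin
  2 ℕ.^ (2 ℕ.* suc c)              ≡⟨ cong (2 ℕ.^_) (ℕ.*-suc 2 c) ⟩
  2 ℕ.* (2 ℕ.* 2 ℕ.^ (2 ℕ.* c))    ≡⟨ cong (λ w → 2 ℕ.* (2 ℕ.* w)) eq ⟩
  2 ℕ.* (2 ℕ.* (1 ℕ.+ i ℕ.* 3))    ≡⟨ solve 1 (λ i → con 2 :* (con 2 :* (con 1 :+ i :* con 3)) := con 1 :+ (con 1 :+ con 4 :* i) :* con 3) refl i ⟩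
  1 ℕ.+ (1 ℕ.+ 4 ℕ.* i) ℕ.* 3      ∎)
  where
  open ≡-Reasoning
  open +-*-Solver

2^odd : ∀ {k c} → k ≡ 1 ℕ.+ 2 ℕ.* c → ∃ λ i → 2 ℕ.^ k ≡ 2 ℕ.+ i ℕ.* 3
2^odd {c = c} refl with 2^2*c c
... | i , eq = 2 ℕ.* i , trans (cong (2 ℕ.*_) eq)
  (solve 1 (λ i → con 2 :* (con 1 :+ i :* con 3) := con 2 :+ (con 2 :* i) :* con 3) refl i)
  where open +-*-Solver

2^odd+1 : ∀ {k c} → k ≡ 1 ℕ.+ 2 ℕ.* c → ∃ λ i → 2 ℕ.^ k ℕ.+ 1 ≡ i ℕ.* 3
2^odd+1 {k} {c} k≡ with 2^odd {c = c} k≡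
... | i , eq = suc i , trans (ℕ.+-comm (2 ℕ.^ k) 1) (cong suc eq)

2^odd+odd : ∀ {k h c d} → k ≡ 1 ℕ.+ 2 ℕ.* c → h ≡ 1 ℕ.+ 2 ℕ.* d → ∃ λ i → 2 ℕ.^ (k ℕ.+ h) ≡ 1 ℕ.+ i ℕ.* 3
2^odd+odd {c = c} {d} refl refl = subst (λ e → ∃ λ i → 2 ℕ.^ e ≡ 1 ℕ.+ i ℕ.* 3)
  (solve 2 (λ c d → con 2 :* (con 1 :+ c :+ d) := (con 1 :+ con 2 :* c) :+ (con 1 :+ con 2 :* d)) refl c d)
  (2^2*c (1 ℕ.+ c ℕ.+ d))
  where open +-*-Solver

m%4≡2⇒m/2 : ∀ m → m % 4 ≡ 2 → m ≡ (1 ℕ.+ 2 ℕ.* (m / 4)) ℕ.* 2 × m / 2 ≡ 1 ℕ.+ 2 ℕ.* (m / 4)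
m%4≡2⇒m/2 m m%4≡2 = m≡ , trans (cong (_/ 2) m≡) (m*n/n≡m _ 2)
  where
  m≡ : m ≡ (1 ℕ.+ 2 ℕ.* (m / 4)) ℕ.* 2
  m≡ = trans (trans (m≡m%n+[m/n]*n m 4) (cong (ℕ._+ m / 4 ℕ.* 4) m%4≡2))
    (solve 1 (λ s → con 2 :+ s :* con 4 := (con 1 :+ con 2 :* s) :* con 2) refl (m / 4))
    where open +-*-Solver

coprime-even⇒odd : ∀ k {m} → 2 ℕ.∣ m → gcd k m ≡ 1 → ∃ λ c → k ≡ 1 ℕ.+ 2 ℕ.* c
coprime-even⇒odd k 2∣m gcd≡1 with k % 2 in k%2≡ | m≡m%n+[m/n]*n k 2 | m%n<n k 2
... | 0 | k≡ | _ with () ← ∣1⇒≡1 (subst (2 ℕ.∣_) gcd≡1 (gcd-greatest (divides (k / 2) k≡) 2∣m))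
... | 1 | k≡ | _ = k / 2 , trans k≡ (cong suc (ℕ.*-comm (k / 2) 2))
... | suc (suc _) | _ | s≤s (s≤s ())

-- Fixed points of powers of the Frobenius map.

module FrobeniusFixedPoints {m : ℕ} (M : BinaryField m) where
  open FieldProperties M
  open ≡-Reasoning

  frobenius-∘ : ∀ x i j → (x ^ (2 ℕ.^ i)) ^ (2 ℕ.^ j) ≡ x ^ (2 ℕ.^ (i ℕ.+ j))
  frobenius-∘ x i j = trans (^-assocʳ x (2 ℕ.^ i) (2 ℕ.^ j)) (cong (x ^_) (sym (ℕ.^-distribˡ-+-* 2 i j)))

  fixed-iterate : ∀ {x} k → x ^ (2 ℕ.^ k) ≡ x → ∀ i → x ^ (2 ℕ.^ (i ℕ.* k)) ≡ x
  fixed-iterate k fixed zero = *-identityʳ _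
  fixed-iterate {x} k fixed (suc i) = begin
    x ^ (2 ℕ.^ (k ℕ.+ i ℕ.* k))               ≡⟨ frobenius-∘ x k (i ℕ.* k) ⟨
    (x ^ (2 ℕ.^ k)) ^ (2 ℕ.^ (i ℕ.* k))       ≡⟨ cong (_^ (2 ℕ.^ (i ℕ.* k))) fixed ⟩
    x ^ (2 ℕ.^ (i ℕ.* k))                     ≡⟨ fixed-iterate k fixed i ⟩
    x                                         ∎

  idempotent : ∀ {x} → x * x ≡ x → x ≡ 0# ⊎ x ≡ 1#
  idempotent {x} xx≡x with x ≟ 0#
  ... | yes x≡0 = inj₁ x≡0
  ... | no x≢0 = inj₂ (*-cancelˡ x≢0 (trans xx≡x (sym (*-identityʳ x))))

  -- With the k-th and the m-th Frobenius power, all their iterates fix x. Bézout supplies a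
  -- multiple of k and a multiple of m that differ by 1, whence x² = x.
  coprime-fixed : ∀ k → gcd k m ≡ 1 → ∀ {x} → x ^ (2 ℕ.^ k) ≡ x → x ≡ 0# ⊎ x ≡ 1#
  coprime-fixed k gcd≡1 {x} fixed = idempotent
    (bézout (Bézout.identity (subst (GCD k m) gcd≡1 (gcd-GCD k m))))
    where
    square : ∀ u {v} → 1 ℕ.+ u ≡ v → x ^ (2 ℕ.^ u) ≡ x → x ^ (2 ℕ.^ v) ≡ x → x * x ≡ x
    square u refl eq₁ eq₂ = begin
      x * x                               ≡⟨ cong₂ _*_ eq₁ eq₁ ⟨
      x ^ (2 ℕ.^ u) * x ^ (2 ℕ.^ u)       ≡⟨ ^-homo-* x (2 ℕ.^ u) (2 ℕ.^ u) ⟨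
      x ^ (2 ℕ.^ u ℕ.+ 2 ℕ.^ u)           ≡⟨ cong (λ w → x ^ (2 ℕ.^ u ℕ.+ w)) (ℕ.+-identityʳ _) ⟨
      x ^ (2 ℕ.^ (1 ℕ.+ u))               ≡⟨ eq₂ ⟩
      x                                   ∎
    bézout : Bézout.Identity 1 k m → x * x ≡ x
    bézout (Bézout.+- i j eq) = square (j ℕ.* m) eq (fixed-iterate m (fermat x) j) (fixed-iterate k fixed i)
    bézout (Bézout.-+ i j eq) = square (i ℕ.* k) eq (fixed-iterate k fixed i) (fixed-iterate m (fermat x) j)

-- The additive group of the plane.

module PlaneProperties {m : ℕ} (M : BinaryField m) where
  open FieldProperties M
  open Plane M

  +²-self : ∀ z → z +² z ≡ 0²
  +²-self (x , y) = cong₂ _,_ (x+x≡0 x) (x+x≡0 y)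

  +²-self-cancel : ∀ z c → z +² (z +² c) ≡ c
  +²-self-cancel (x , y) (u , v) = cong₂ _,_ (+-self-cancel x u) (+-self-cancel y v)

  +²-comm : ∀ z c → z +² c ≡ c +² z
  +²-comm (x , y) (u , v) = cong₂ _,_ (+-comm x u) (+-comm y v)

  z+c≡0⇒z≡c : ∀ {z c} → z +² c ≡ 0² → z ≡ c
  z+c≡0⇒z≡c eq = cong₂ _,_ (x+y≡0⇒x≡y (cong proj₁ eq)) (x+y≡0⇒x≡y (cong proj₂ eq))

  elements²-unique : Unique elements²
  elements²-unique = Unique.cartesianProduct⁺ elements-unique elements-unique

  ∈-elements² : ∀ z → z ∈ elements²
  ∈-elements² (x , y) = ∈-cartesianProduct⁺ (∈-elements x) (∈-elements y)

-- The family: polar form, APN property and fibres.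

module _ {m : ℕ} (M : BinaryField m) where
  open FieldProperties M

  -- The residues modulo 3 are passed with explicit quotients because these are exponents of cube
  -- roots: x^(q+1) = (x^j₁)³ and x^r = x (x^j₂)³.
  module Family₄ (k h : ℕ) (gcd≡1 : gcd k m ≡ 1) (m≡h+h : m ≡ h ℕ.+ h)
    {j₁ j₂ j₃ : ℕ} (q≡ : 2 ℕ.^ k ℕ.+ 1 ≡ j₁ ℕ.* 3) (r≡ : 2 ℕ.^ (k ℕ.+ h) ≡ 1 ℕ.+ j₂ ℕ.* 3)
    (2^h≡ : 2 ℕ.^ h ≡ 2 ℕ.+ j₃ ℕ.* 3)
    {a B ω : Carrier} (a≢0 : a ≢ 0#) (a-fixed : a ^ (2 ℕ.^ h) ≡ a)
    (B≢0 : B ≢ 0#) (B-nonCube : ∀ z → z ^ 3 ≢ B)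
    (B-a : B ^ (2 ℕ.^ k ℕ.+ 2 ℕ.^ (k ℕ.+ h)) ≢ a ^ (2 ℕ.^ k ℕ.+ 1))
    (ω-root : ω * ω + ω + 1# ≡ 0#)
    where
    open FrobeniusFixedPoints M
    open Trinomials M
    open Cubes M
    open Plane M
    open PlaneProperties M
    open ≡-Reasoning

    q r : ℕ
    q = 2 ℕ.^ k
    r = 2 ℕ.^ (k ℕ.+ h)

    F : M² → M²
    F = family₄ q r a B

    private
      s τ ρ : Carrier → Carrier
      s x = x ^ q
      τ x = x ^ (2 ℕ.^ h)
      ρ x = x ^ r

      s-+ = frobenius-+ k
      ρ-+ = frobenius-+ (k ℕ.+ h)
      s-* : ∀ x y → s (x * y) ≡ s x * s y
      s-* x y = ^-distrib-* x y q
      ρ-* : ∀ x y → ρ (x * y) ≡ ρ x * ρ y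
      ρ-* x y = ^-distrib-* x y r

      sτ : ∀ x → s (τ x) ≡ ρ x
      sτ x = trans (frobenius-∘ x h k) (cong (λ w → x ^ (2 ℕ.^ w)) (ℕ.+-comm h k))
      τs : ∀ x → τ (s x) ≡ s (τ x)
      τs x = trans (frobenius-∘ x k h) (sym (sτ x))
      ττ : ∀ x → τ (τ x) ≡ x
      ττ x = trans (frobenius-∘ x h h) (trans (cong (λ w → x ^ (2 ℕ.^ w)) (sym m≡h+h)) (fermat x))

      τ-fixed-isCube : ∀ {x} → τ x ≡ x → x ≢ 0# → ∃ λ y → y ≢ 0# × y ^ 3 ≡ x
      τ-fixed-isCube {x} fixed = fixed-isCube (j₃) (trans (cong (x ^_) (sym (2^h≡))) fixed)

      x^[q+1] : ∀ x → x ^ (q ℕ.+ 1) ≡ s x * x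
      x^[q+1] x = trans (^-homo-* x q 1) (cong (s x *_) (*-identityʳ x))

      s[x]x-isCube : ∀ x → s x * x ≡ (x ^ j₁) ^ 3
      s[x]x-isCube x = trans (sym (x^[q+1] x)) (trans (cong (x ^_) (q≡)) (sym (^-assocʳ x j₁ 3)))

      ρ≡ : ∀ x → ρ x ≡ x * (x ^ j₂) ^ 3
      ρ≡ x = trans (cong (x ^_) (r≡)) (cong (x *_) (sym (^-assocʳ x j₂ 3)))

      0^ : ∀ {j} → 0 < j → 0# ^ j ≡ 0#
      0^ {suc j} _ = zeroˡ _
      s0 : s 0# ≡ 0#
      s0 = 0^ (ℕ.m^n>0 2 k)
      ρ0 : ρ 0# ≡ 0#
      ρ0 = 0^ (ℕ.m^n>0 2 (k ℕ.+ h))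

      b : Carrier
      b = a * B ⁻¹
      Bb≡a : B * b ≡ a
      Bb≡a = begin
        B * (a * B ⁻¹)   ≡⟨ solve 3 (λ B a i → B :* (a :* i) := a :* (B :* i)) refl B a (B ⁻¹) ⟩
        a * (B * B ⁻¹)   ≡⟨ cong (a *_) (*-inverseʳ B≢0) ⟩
        a * 1#           ≡⟨ *-identityʳ a ⟩
        a                ∎

      -- `F` with x^(q+1) split into two factors, so that the ring solver can treat `s x` as an
      -- atom.
      F̂ : M² → M²
      F̂ (x , y) = s x * x + B * (s y * y) , ρ x * y + b * (x * ρ y)

      F≡F̂ : ∀ z → F z ≡ F̂ z
      F≡F̂ (x , y) = cong₂ _,_ (cong₂ (λ w w′ → w + B * w′) (x^[q+1] x) (x^[q+1] y)) refl

    polar : M² → M² → M²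
    polar (x , y) (u , v) =
      (s x * u + s u * x) + B * (s y * v + s v * y) ,
      (ρ x * v + ρ u * y) + b * (x * ρ v + u * ρ y)

    F-+ : ∀ z c → F (z +² c) ≡ F z +² F c +² polar z c
    F-+ z@(x , y) c@(u , v) = trans (F≡F̂ (z +² c)) (trans (cong₂ _,_
      (trans (cong₂ (λ w w′ → w * (x + u) + B * (w′ * (y + v))) (s-+ x u) (s-+ y v))
        (solve 9 (λ x y u v sx sy su sv B →
          (sx :+ su) :* (x :+ u) :+ B :* ((sy :+ sv) :* (y :+ v)) :=
          (sx :* x :+ B :* (sy :* y)) :+ (su :* u :+ B :* (sv :* v)) :+
          ((sx :* u :+ su :* x) :+ B :* (sy :* v :+ sv :* y)))
          refl x y u v (s x) (s y) (s u) (s v) B))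
      (trans (cong₂ (λ w w′ → w * (y + v) + b * ((x + u) * w′)) (ρ-+ x u) (ρ-+ y v))
        (solve 9 (λ x y u v sx sy su sv b →
          (sx :+ su) :* (y :+ v) :+ b :* ((x :+ u) :* (sy :+ sv)) :=
          (sx :* y :+ b :* (x :* sy)) :+ (su :* v :+ b :* (u :* sv)) :+
          ((sx :* v :+ su :* y) :+ b :* (x :* sv :+ u :* sy)))
          refl x y u v (ρ x) (ρ y) (ρ u) (ρ v) b)))
      (sym (cong₂ (λ w w′ → w +² w′ +² polar z c) (F≡F̂ z) (F≡F̂ c))))

    polar-sym : ∀ z c → polar z c ≡ polar c z
    polar-sym (x , y) (u , v) = cong₂ _,_
      (cong₂ (λ w w′ → w + B * w′) (+-comm _ _) (+-comm _ _))
      (cong₂ (λ w w′ → w + b * w′) (+-comm _ _) (+-comm _ _))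

    polar-+ˡ : ∀ z z′ c → polar (z +² z′) c ≡ polar z c +² polar z′ c
    polar-+ˡ (x , y) (x′ , y′) (u , v) = cong₂ _,_
      (trans (cong₂ (λ w w′ → (w * u + s u * (x + x′)) + B * (w′ * v + s v * (y + y′))) (s-+ x x′) (s-+ y y′))
        (solve 13 (λ x y x′ y′ u v sx sy sx′ sy′ su sv B →
          ((sx :+ sx′) :* u :+ su :* (x :+ x′)) :+ B :* ((sy :+ sy′) :* v :+ sv :* (y :+ y′)) :=
          ((sx :* u :+ su :* x) :+ B :* (sy :* v :+ sv :* y)) :+ ((sx′ :* u :+ su :* x′) :+ B :* (sy′ :* v :+ sv :* y′)))
          refl x y x′ y′ u v (s x) (s y) (s x′) (s y′) (s u) (s v) B))
      (trans (cong₂ (λ w w′ → (w * v + ρ u * (y + y′)) + b * ((x + x′) * ρ v + u * w′)) (ρ-+ x x′) (ρ-+ y y′))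
        (solve 13 (λ x y x′ y′ u v sx sy sx′ sy′ su sv b →
          ((sx :+ sx′) :* v :+ su :* (y :+ y′)) :+ b :* ((x :+ x′) :* sv :+ u :* (sy :+ sy′)) :=
          ((sx :* v :+ su :* y) :+ b :* (x :* sv :+ u :* sy)) :+ ((sx′ :* v :+ su :* y′) :+ b :* (x′ :* sv :+ u :* sy′)))
          refl x y x′ y′ u v (ρ x) (ρ y) (ρ x′) (ρ y′) (ρ u) (ρ v) b))

    private
      -- Put w = t τ t. The two equations become B τ B w^(q+1) = 1 and a w^q = 1. The q-th power of
      -- the first and the (q+1)-st power of the second give B^(q+r) and a^(q+1) the same inverse
      -- (w^q)^(q+1), against `B-a`.
      nonDegenerate : ∀ t → let A = B * (s t * t) in A * τ A ≡ 1# → a * (ρ t * s t) ≢ 1#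
      nonDegenerate t Aτ≡1 e≡1 = B-a (*-cancelˡ (*-nonZero sw≢0 (s-nonZero sw≢0)) (begin
        s w * s (s w) * B ^ (q ℕ.+ r)                  ≡⟨ cong (s w * s (s w) *_) B^≡ ⟩
        s w * s (s w) * (s B * s (τ B))                ≡⟨ solve 4 (λ x y B C → x :* y :* (B :* C) := B :* C :* (y :* x)) refl (s w) (s (s w)) (s B) (s (τ B)) ⟩
        s B * s (τ B) * (s (s w) * s w)                ≡⟨ cong₂ _*_ (s-* B (τ B)) (s-* (s w) w) ⟨
        s (B * τ B) * s (s w * w)                      ≡⟨ s-* _ _ ⟨
        s (B * τ B * (s w * w))                        ≡⟨ cong s norm ⟩
        s 1#                                           ≡⟨ 1^ q ⟩
        1#                                             ≡⟨ *-identityˡ 1# ⟨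
        1# * 1#                                        ≡⟨ cong₂ _*_ aw≡1 (trans (cong s aw≡1) (1^ q)) ⟨
        a * s w * s (a * s w)                          ≡⟨ cong (a * s w *_) (s-* a (s w)) ⟩
        a * s w * (s a * s (s w))                      ≡⟨ solve 4 (λ a x sa y → a :* x :* (sa :* y) := x :* y :* (sa :* a)) refl a (s w) (s a) (s (s w)) ⟩
        s w * s (s w) * (s a * a)                      ≡⟨ cong (s w * s (s w) *_) (x^[q+1] a) ⟨
        s w * s (s w) * a ^ (q ℕ.+ 1)                  ∎))
        where
        w = t * τ t

        B^≡ : B ^ (q ℕ.+ r) ≡ s B * s (τ B)
        B^≡ = trans (^-homo-* B q r) (cong (s B *_) (sym (sτ B)))

        aw≡1 : a * s w ≡ 1#
        aw≡1 = trans (cong (a *_) (trans (s-* t (τ t)) (trans (cong (s t *_) (sτ t)) (*-comm _ _)))) e≡1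

        s-nonZero : ∀ {x} → x ≢ 0# → s x ≢ 0#
        s-nonZero = ^-nonZero q

        sw≢0 : s w ≢ 0#
        sw≢0 sw≡0 = 0#≢1# (trans (sym (trans (cong (a *_) sw≡0) (zeroʳ a))) aw≡1)

        norm : B * τ B * (s w * w) ≡ 1#
        norm = begin
          B * τ B * (s w * w)                        ≡⟨ cong (λ v → B * τ B * (v * w)) (s-* t (τ t)) ⟩
          B * τ B * (s t * s (τ t) * (t * τ t))      ≡⟨ solve 6 (λ B C x y t u → B :* C :* (x :* y :* (t :* u)) := B :* (x :* t) :* (C :* (y :* u))) refl B (τ B) (s t) (s (τ t)) t (τ t) ⟩
          B * (s t * t) * (τ B * (s (τ t) * τ t))    ≡⟨ cong (λ v → B * (s t * t) * (τ B * (v * τ t))) (τs t) ⟨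
          B * (s t * t) * (τ B * (τ (s t) * τ t))    ≡⟨ cong (λ v → B * (s t * t) * (τ B * v)) (^-distrib-* (s t) t (2 ℕ.^ h)) ⟨
          B * (s t * t) * (τ B * τ (s t * t))        ≡⟨ cong (B * (s t * t) *_) (^-distrib-* B (s t * t) (2 ℕ.^ h)) ⟨
          B * (s t * t) * τ (B * (s t * t))          ≡⟨ Aτ≡1 ⟩
          1#                                         ∎

      -- α, δ and s t * t are cubes and s (τ z) is z times a cube, so after cancelling z an equality
      -- would make B a ratio of cubes.
      nonCube-ρ : ∀ {t} → t ≢ 0# → ∀ α δ z → τ α ≡ α → α ≢ 0# → τ δ ≡ δ → δ ≢ 0# → z ≢ 0# →
        α * s (τ z) ≢ δ * (B * (s t * t) * z)
      nonCube-ρ {t} t≢0 α δ z τα α≢0 τδ δ≢0 z≢0 eq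
        with τ-fixed-isCube τα α≢0 | τ-fixed-isCube τδ δ≢0
      ... | α′ , _ , α≡ | δ′ , δ′≢0 , δ≡ = nonCube-ratio B-nonCube (α′ * z′) (δ′ * t′)
        (*-nonZero δ′≢0 (^-nonZero (j₁) t≢0)) (*-cancelˡ z≢0 (begin
          z * (α′ * z′) ^ 3            ≡⟨ cong (z *_) (^-distrib-* α′ z′ 3) ⟩
          z * (α′ ^ 3 * z′ ^ 3)        ≡⟨ cong (λ w → z * (w * z′ ^ 3)) α≡ ⟩
          z * (α * z′ ^ 3)             ≡⟨ solve 3 (λ z α w → z :* (α :* w) := α :* (z :* w)) refl z α (z′ ^ 3) ⟩
          α * (z * z′ ^ 3)             ≡⟨ cong (α *_) (trans (sym (ρ≡ z)) (sym (sτ z))) ⟩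
          α * s (τ z)                  ≡⟨ eq ⟩
          δ * (B * (s t * t) * z)      ≡⟨ cong₂ (λ v w → v * (B * w * z)) (sym δ≡) (s[x]x-isCube t) ⟩
          δ′ ^ 3 * (B * t′ ^ 3 * z)    ≡⟨ solve 4 (λ d B t z → d :* (B :* t :* z) := z :* (B :* (d :* t))) refl (δ′ ^ 3) B (t′ ^ 3) z ⟩
          z * (B * (δ′ ^ 3 * t′ ^ 3))  ≡⟨ cong (λ w → z * (B * w)) (^-distrib-* δ′ t′ 3) ⟨
          z * (B * (δ′ * t′) ^ 3)      ∎))
        where
        z′ = z ^ j₂
        t′ = t ^ j₁

      -- Extracts u^(q+1) from the first component at x = u X, y = u t Y, v = u t. Letters such as
      -- `su` and `sX` stand for q-th powers.
      scaling₁ : ∀ u t X Y su st sX sY B →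
        su * u * (sX + X + B * (st * t) * (sY + Y)) ≡
        (su * sX * u + su * (u * X)) + B * (su * st * sY * (u * t) + su * st * (u * t * Y))
      scaling₁ = solve 9 (λ u t X Y su st sX sY B →
        su :* u :* (sX :+ X :+ B :* (st :* t) :* (sY :+ Y)) :=
        (su :* sX :* u :+ su :* (u :* X)) :+ B :* (su :* st :* sY :* (u :* t) :+ su :* st :* (u :* t :* Y))) refl

      -- Besides extracting u^(r+1), this multiplies by B t^q. That multiplier makes the
      -- coefficients A = B t^(q+1), as in the first equation, and e = a t^(q+r), which τ fixes
      -- because it exchanges t^q and t^r.
      scaling₂ : ∀ u t X Y ru rt rX rY st B b →
        ru * u * (B * (st * t) * (rX + Y) + B * b * (rt * st) * (X + rY)) ≡
        B * st * ((ru * rX * (u * t) + ru * (u * t * Y)) + b * (u * X * (ru * rt) + u * (ru * rt * rY)))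
      scaling₂ = solve 11 (λ u t X Y ru rt rX rY st B b →
        ru :* u :* (B :* (st :* t) :* (rX :+ Y) :+ B :* b :* (rt :* st) :* (X :+ rY)) :=
        B :* st :* ((ru :* rX :* (u :* t) :+ ru :* (u :* t :* Y)) :+ b :* (u :* X :* (ru :* rt) :+ u :* (ru :* rt :* rY)))) refl

      kernel-scaled : ∀ {u t} X Y → u ≢ 0# → t ≢ 0# → polar (u * X , u * t * Y) (u , u * t) ≡ 0² →
        (X ≡ 0# × Y ≡ 0#) ⊎ (X ≡ 1# × Y ≡ 1#)
      kernel-scaled {u} {t} X Y u≢0 t≢0 eq = conclude
        (trinomials-solution s τ s-+ (^-nonZero q) (frobenius-+ h) (λ x y → ^-distrib-* x y (2 ℕ.^ h)) τs ττ
          (B * (s t * t)) (a * (ρ t * s t)) X Y τe (*-nonZero B≢0 (*-nonZero (^-nonZero q t≢0) t≢0))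
          (nonCube-ρ t≢0) (nonDegenerate t) eq₁ eq₂)
        where
        τe : τ (a * (ρ t * s t)) ≡ a * (ρ t * s t)
        τe = begin
          τ (a * (ρ t * s t))              ≡⟨ trans (^-distrib-* a _ (2 ℕ.^ h)) (cong₂ _*_ a-fixed (^-distrib-* (ρ t) (s t) (2 ℕ.^ h))) ⟩
          a * (τ (ρ t) * τ (s t))          ≡⟨ cong₂ (λ v w → a * (v * w)) (trans (cong τ (sym (sτ t))) (trans (τs (τ t)) (cong s (ττ t)))) (trans (τs t) (sτ t)) ⟩
          a * (s t * ρ t)                  ≡⟨ cong (a *_) (*-comm _ _) ⟩
          a * (ρ t * s t)                  ∎

        eq₁ : s X + X ≡ B * (s t * t) * (s Y + Y)
        eq₁ = x+y≡0⇒x≡y (*-zero-cancelˡ (*-nonZero (^-nonZero q u≢0) u≢0) (begin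
          s u * u * (s X + X + B * (s t * t) * (s Y + Y))
            ≡⟨ scaling₁ u t X Y (s u) (s t) (s X) (s Y) B ⟩
          (s u * s X * u + s u * (u * X)) + B * (s u * s t * s Y * (u * t) + s u * s t * (u * t * Y))
            ≡⟨ cong₂ (λ v w → (v * u + s u * (u * X)) + B * w) (s-* u X)
                 (cong₂ (λ v w → v * (u * t) + w * (u * t * Y)) (trans (s-* (u * t) Y) (cong (_* s Y) (s-* u t))) (s-* u t)) ⟨
          proj₁ (polar (u * X , u * t * Y) (u , u * t))
            ≡⟨ cong proj₁ eq ⟩
          0# ∎))

        eq₂ : B * (s t * t) * (s (τ X) + Y) ≡ a * (ρ t * s t) * (X + s (τ Y))
        eq₂ = x+y≡0⇒x≡y (*-zero-cancelˡ (*-nonZero (^-nonZero r u≢0) u≢0) (begin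
          ρ u * u * (B * (s t * t) * (s (τ X) + Y) + a * (ρ t * s t) * (X + s (τ Y)))
            ≡⟨ cong₂ (λ v w → ρ u * u * (B * (s t * t) * (v + Y) + a * (ρ t * s t) * (X + w))) (sτ X) (sτ Y) ⟩
          ρ u * u * (B * (s t * t) * (ρ X + Y) + a * (ρ t * s t) * (X + ρ Y))
            ≡⟨ cong (λ v → ρ u * u * (B * (s t * t) * (ρ X + Y) + v * (ρ t * s t) * (X + ρ Y))) Bb≡a ⟨
          ρ u * u * (B * (s t * t) * (ρ X + Y) + B * b * (ρ t * s t) * (X + ρ Y))
            ≡⟨ scaling₂ u t X Y (ρ u) (ρ t) (ρ X) (ρ Y) (s t) B b ⟩
          B * s t * ((ρ u * ρ X * (u * t) + ρ u * (u * t * Y)) + b * (u * X * (ρ u * ρ t) + u * (ρ u * ρ t * ρ Y)))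
            ≡⟨ cong₂ (λ v w → B * s t * ((v * (u * t) + ρ u * (u * t * Y)) + b * w)) (ρ-* u X)
                 (cong₂ (λ v w → u * X * v + u * w) (ρ-* u t) (trans (ρ-* (u * t) Y) (cong (_* ρ Y) (ρ-* u t)))) ⟨
          B * s t * proj₂ (polar (u * X , u * t * Y) (u , u * t))
            ≡⟨ trans (cong (λ w → B * s t * proj₂ w) eq) (zeroʳ _) ⟩
          0# ∎))

        conclude : s Y ≡ Y × X ≡ τ Y → (X ≡ 0# × Y ≡ 0#) ⊎ (X ≡ 1# × Y ≡ 1#)
        conclude (sY≡Y , X≡τY) with coprime-fixed k gcd≡1 sY≡Y
        ... | inj₁ refl = inj₁ (trans X≡τY (0^ (ℕ.m^n>0 2 h)) , refl)
        ... | inj₂ refl = inj₂ (trans X≡τY (1^ (2 ℕ.^ h)) , refl)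

      /-* : ∀ {u} x → u ≢ 0# → u * (u ⁻¹ * x) ≡ x
      /-* x u≢0 = trans (sym (*-assoc _ _ _)) (trans (cong (_* x) (*-inverseʳ u≢0)) (*-identityˡ x))

      -- The quotient x / u is fixed by `s`, hence is 0 or 1.
      kernel-axis₁ : ∀ {x u} → u ≢ 0# → s x * u + s u * x ≡ 0# → x ≡ 0# ⊎ x ≡ u
      kernel-axis₁ {x} {u} u≢0 eq = Sum.map
        (λ x/u≡0 → trans (sym (/-* x u≢0)) (trans (cong (u *_) x/u≡0) (zeroʳ u)))
        (λ x/u≡1 → trans (sym (/-* x u≢0)) (trans (cong (u *_) x/u≡1) (*-identityʳ u)))
        (coprime-fixed k gcd≡1 fixed)
        where
        fixed : s (u ⁻¹ * x) ≡ u ⁻¹ * x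
        fixed = *-cancelˡ (*-nonZero u≢0 (^-nonZero q u≢0)) (begin
          u * s u * s (u ⁻¹ * x)     ≡⟨ *-assoc _ _ _ ⟩
          u * (s u * s (u ⁻¹ * x))   ≡⟨ cong (u *_) (trans (sym (s-* u _)) (cong s (/-* x u≢0))) ⟩
          u * s x                    ≡⟨ *-comm _ _ ⟩
          s x * u                    ≡⟨ x+y≡0⇒x≡y eq ⟩
          s u * x                    ≡⟨ cong (s u *_) (/-* x u≢0) ⟨
          s u * (u * (u ⁻¹ * x))     ≡⟨ *-assoc _ _ _ ⟨
          s u * u * (u ⁻¹ * x)       ≡⟨ cong (_* (u ⁻¹ * x)) (*-comm _ _) ⟩
          u * s u * (u ⁻¹ * x)       ∎)

      -- For x ≠ 0, dividing by x v leaves x^(r-1) = b v^(r-1). Then B = a v^(r-1) / x^(r-1) would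
      -- be built from cubes, `a` being one because τ fixes it.
      kernel-axis₂ : ∀ {x v} → v ≢ 0# → ρ x * v + b * (x * ρ v) ≡ 0# → x ≡ 0#
      kernel-axis₂ {x} {v} v≢0 eq with x ≟ 0#
      ... | yes x≡0 = x≡0
      ... | no x≢0 = ⊥-elim (absurd (τ-fixed-isCube a-fixed a≢0))
        where
        v′ = v ^ j₂
        x′ = x ^ j₂
        absurd : ¬ ∃ λ y → y ≢ 0# × y ^ 3 ≡ a
        absurd (a′ , a′≢0 , a≡) = nonCube-ratio B-nonCube (a′ * v′) x′ (^-nonZero j₂ x≢0)
          (*-cancelˡ (*-nonZero x≢0 v≢0) (begin
            x * v * (a′ * v′) ^ 3         ≡⟨ cong (x * v *_) (trans (^-distrib-* a′ v′ 3) (cong (_* v′ ^ 3) a≡)) ⟩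
            x * v * (a * v′ ^ 3)          ≡⟨ cong (λ w → x * v * (w * v′ ^ 3)) Bb≡a ⟨
            x * v * (B * b * v′ ^ 3)      ≡⟨ solve 5 (λ x v B b w → x :* v :* (B :* b :* w) := B :* (b :* (x :* (v :* w)))) refl x v B b (v′ ^ 3) ⟩
            B * (b * (x * (v * v′ ^ 3)))  ≡⟨ cong (λ w → B * (b * (x * w))) (ρ≡ v) ⟨
            B * (b * (x * ρ v))           ≡⟨ cong (B *_) (x+y≡0⇒x≡y eq) ⟨
            B * (ρ x * v)                 ≡⟨ cong (λ w → B * (w * v)) (ρ≡ x) ⟩
            B * (x * x′ ^ 3 * v)          ≡⟨ solve 4 (λ B x w v → B :* (x :* w :* v) := x :* v :* (B :* w)) refl B x (x′ ^ 3) v ⟩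
            x * v * (B * x′ ^ 3)          ∎))

      -- For u = 0 the second component no longer contains y and forces x = 0; the first one is then
      -- the axis equation for y and v.
      kernel-u≡0 : ∀ {x y v} → v ≢ 0# → polar (x , y) (0# , v) ≡ 0² → x ≡ 0# × (y ≡ 0# ⊎ y ≡ v)
      kernel-u≡0 {x} {y} {v} v≢0 eq = x≡0 , kernel-axis₁ v≢0 (*-zero-cancelˡ B≢0 (begin
        B * (s y * v + s v * y)
          ≡⟨ solve 3 (λ e x s0 → e := (s0 :* con false :+ s0 :* con false) :+ e) refl (B * (s y * v + s v * y)) x (s 0#) ⟩
        s 0# * 0# + s 0# * 0# + B * (s y * v + s v * y)
          ≡⟨ cong (λ w → s w * 0# + s 0# * w + B * (s y * v + s v * y)) x≡0 ⟨
        proj₁ (polar (x , y) (0# , v))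
          ≡⟨ cong proj₁ eq ⟩
        0# ∎))
        where
        x≡0 : x ≡ 0#
        x≡0 = kernel-axis₂ v≢0 (begin
          ρ x * v + b * (x * ρ v)
            ≡⟨ solve 7 (λ rx v y b x rv ry → rx :* v :+ b :* (x :* rv) :=
                 (rx :* v :+ con false :* y) :+ b :* (x :* rv :+ con false :* ry)) refl (ρ x) v y b x (ρ v) (ρ y) ⟩
          (ρ x * v + 0# * y) + b * (x * ρ v + 0# * ρ y)
            ≡⟨ cong (λ w → (ρ x * v + w * y) + b * (x * ρ v + 0# * ρ y)) ρ0 ⟨
          proj₂ (polar (x , y) (0# , v))
            ≡⟨ cong proj₂ eq ⟩
          0# ∎)

      kernel-v≡0 : ∀ {x y u} → u ≢ 0# → polar (x , y) (u , 0#) ≡ 0² → (x ≡ 0# ⊎ x ≡ u) × y ≡ 0#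
      kernel-v≡0 {x} {y} {u} u≢0 eq = kernel-axis₁ u≢0 (begin
        s x * u + s u * x
          ≡⟨ solve 3 (λ e B s0 → e := e :+ B :* (s0 :* con false :+ s0 :* con false)) refl (s x * u + s u * x) B (s 0#) ⟩
        s x * u + s u * x + B * (s 0# * 0# + s 0# * 0#)
          ≡⟨ cong (λ w → s x * u + s u * x + B * (s w * 0# + s 0# * w)) y≡0 ⟨
        proj₁ (polar (x , y) (u , 0#))
          ≡⟨ cong proj₁ eq ⟩
        0# ∎) , y≡0
        where
        y≡0 : y ≡ 0#
        y≡0 with y ≟ 0#
        ... | yes y≡0 = y≡0
        -- For v = 0 the second component is the equation of `kernel-axis₂` with u in the role of x
        -- and y in that of v, so y ≠ 0 would give u = 0.
        ... | no y≢0 = ⊥-elim (u≢0 (kernel-axis₂ y≢0 (begin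
          ρ u * y + b * (u * ρ y)
            ≡⟨ solve 7 (λ ru y b u ry rx x → ru :* y :+ b :* (u :* ry) :=
                 (rx :* con false :+ ru :* y) :+ b :* (x :* con false :+ u :* ry)) refl (ρ u) y b u (ρ y) (ρ x) x ⟩
          (ρ x * 0# + ρ u * y) + b * (x * 0# + u * ρ y)
            ≡⟨ cong (λ w → (ρ x * 0# + ρ u * y) + b * (x * w + u * ρ y)) ρ0 ⟨
          proj₂ (polar (x , y) (u , 0#))
            ≡⟨ cong proj₂ eq ⟩
          0# ∎)))

      kernel-uv≢0 : ∀ {x y u v} → u ≢ 0# → v ≢ 0# → polar (x , y) (u , v) ≡ 0² → (x ≡ 0# × y ≡ 0#) ⊎ (x ≡ u × y ≡ v)
      kernel-uv≢0 {x} {y} {u} {v} u≢0 v≢0 eq = Sum.map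
        (λ (X≡0 , Y≡0) → trans (sym (/-* x u≢0)) (trans (cong (u *_) X≡0) (zeroʳ u)) ,
                          trans (sym (/-* y v≢0)) (trans (cong (v *_) Y≡0) (zeroʳ v)))
        (λ (X≡1 , Y≡1) → trans (sym (/-* x u≢0)) (trans (cong (u *_) X≡1) (*-identityʳ u)) ,
                          trans (sym (/-* y v≢0)) (trans (cong (v *_) Y≡1) (*-identityʳ v)))
        (kernel-scaled (u ⁻¹ * x) (v ⁻¹ * y) u≢0 t≢0 scaled)
        where
        t≢0 : u ⁻¹ * v ≢ 0#
        t≢0 t≡0 = v≢0 (trans (sym (/-* v u≢0)) (trans (cong (u *_) t≡0) (zeroʳ u)))
        scaled : polar (u * (u ⁻¹ * x) , u * (u ⁻¹ * v) * (v ⁻¹ * y)) (u , u * (u ⁻¹ * v)) ≡ 0²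
        scaled = trans (cong₂ polar
          (cong₂ _,_ (/-* x u≢0) (trans (cong (_* (v ⁻¹ * y)) (/-* v u≢0)) (/-* y v≢0)))
          (cong (u ,_) (/-* v u≢0))) eq

    -- The APN property in linear form. The scaled system divides by both u and v, so the two axes
    -- are treated apart.
    polar-kernel : ∀ {z c} → c ≢ 0² → polar z c ≡ 0² → z ≡ 0² ⊎ z ≡ c
    polar-kernel {x , y} {u , v} c≢0 eq = cases (u ≟ 0#) (v ≟ 0#)
      where
      cases : Dec (u ≡ 0#) → Dec (v ≡ 0#) → (x , y) ≡ 0² ⊎ (x , y) ≡ (u , v)
      cases (yes u≡0) (yes v≡0) = ⊥-elim (c≢0 (cong₂ _,_ u≡0 v≡0))
      cases (yes u≡0) (no v≢0) =
        (λ (x≡0 , y≡) → Sum.map (cong₂ _,_ x≡0) (cong₂ _,_ (trans x≡0 (sym u≡0))) y≡)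
        (kernel-u≡0 v≢0 (subst (λ u → polar (x , y) (u , v) ≡ 0²) u≡0 eq))
      cases (no u≢0) (yes v≡0) =
        (λ (x≡ , y≡0) → Sum.map (λ p → cong₂ _,_ p y≡0) (λ p → cong₂ _,_ p (trans y≡0 (sym v≡0))) x≡)
        (kernel-v≡0 u≢0 (subst (λ v → polar (x , y) (u , v) ≡ 0²) v≡0 eq))
      cases (no u≢0) (no v≢0) = Sum.map (λ (p , q) → cong₂ _,_ p q) (λ (p , q) → cong₂ _,_ p q)
        (kernel-uv≢0 u≢0 v≢0 eq)

    F-polar : ∀ z c → F (z +² c) +² F z ≡ F c +² polar z c
    F-polar z c = begin
      F (z +² c) +² F z              ≡⟨ cong (_+² F z) (F-+ z c) ⟩
      F z +² F c +² polar z c +² F z ≡⟨ shuffle (F z) (F c) (polar z c) ⟩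
      F c +² polar z c               ∎
      where
      shuffle : ∀ u v w → u +² v +² w +² u ≡ v +² w
      shuffle (x , y) (x′ , y′) (x″ , y″) = cong₂ _,_ (lemma x x′ x″) (lemma y y′ y″)
        where
        lemma : ∀ x y z → x + y + z + x ≡ y + z
        lemma = solve 3 (λ x y z → x :+ y :+ z :+ x := y :+ z) refl

    +²-cancelˡ : ∀ u {v w} → u +² v ≡ u +² w → v ≡ w
    +²-cancelˡ u eq = trans (sym (+²-self-cancel u _)) (trans (cong (u +²_) eq) (+²-self-cancel u _))

    polar-coset : ∀ {z z′ c} → c ≢ 0² → polar z c ≡ polar z′ c → z ≡ z′ ⊎ z ≡ z′ +² c
    polar-coset {z} {z′} {c} c≢0 eq = Sum.map
      (λ p → sym (z+c≡0⇒z≡c p))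
      (λ p → trans (sym (+²-self-cancel z′ z)) (cong (z′ +²_) p))
      (polar-kernel {z′ +² z} c≢0 (trans (polar-+ˡ z′ z c) (trans (cong (polar z′ c +²_) eq) (+²-self _))))

    F-APN : APN F
    F-APN c d c≢0 = bound _ (Unique.filter⁺ Δ? elements²-unique) λ z∈ → proj₂ (∈-filter⁻ Δ? {xs = elements²} z∈)
      where
      Δ? : ∀ z → Dec (F (z +² c) +² F z ≡ d)
      Δ? z = F (z +² c) +² F z ≟² d
      bound : ∀ zs → Unique zs → (∀ {z} → z ∈ zs → F (z +² c) +² F z ≡ d) → length zs ≤ 2
      bound []       _   _  = z≤n
      -- The first solution in the list serves as base point: any other differs from it by an
      -- element of the kernel {0, c}.
      bound (z ∷ zs) zs! ∈⇒ = Unique-⊆⇒length≤ {ys = z ∷ z +² c ∷ []} zs! solutions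
        where
        solutions : ∀ {z′} → z′ ∈ z ∷ zs → z′ ∈ z ∷ z +² c ∷ []
        solutions {z′} z′∈ = [ here , there ∘ here ]′ (polar-coset {z′} {z} c≢0 (+²-cancelˡ (F c)
          (trans (sym (F-polar z′ c)) (trans (∈⇒ z′∈) (trans (sym (∈⇒ (here refl))) (F-polar z c))))))

    private
      ωω≡ω+1 : ω * ω ≡ ω + 1#
      ωω≡ω+1 = x+y≡0⇒x≡y (trans (sym (+-assoc _ _ _)) (ω-root))

      ω³≡1 : ω ^ 3 ≡ 1#
      ω³≡1 = begin
        ω * (ω * (ω * 1#))  ≡⟨ cong (λ w → ω * (ω * w)) (*-identityʳ ω) ⟩
        ω * (ω * ω)         ≡⟨ cong (ω *_) ωω≡ω+1 ⟩
        ω * (ω + 1#)        ≡⟨ trans (distribˡ ω ω 1#) (cong₂ _+_ ωω≡ω+1 (*-identityʳ ω)) ⟩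
        ω + 1# + ω          ≡⟨ solve 1 (λ w → w :+ con true :+ w := con true) refl ω ⟩
        1#                  ∎

      ω^3^ : ∀ j → (ω ^ j) ^ 3 ≡ 1#
      ω^3^ j = begin
        (ω ^ j) ^ 3     ≡⟨ ^-assocʳ ω j 3 ⟩
        ω ^ (j ℕ.* 3)   ≡⟨ cong (ω ^_) (ℕ.*-comm j 3) ⟩
        ω ^ (3 ℕ.* j)   ≡⟨ ^-assocʳ ω 3 j ⟨
        (ω ^ 3) ^ j     ≡⟨ cong (_^ j) ω³≡1 ⟩
        1# ^ j          ≡⟨ 1^ j ⟩
        1#              ∎

      sωω : s ω * ω ≡ 1#
      sωω = trans (s[x]x-isCube ω) (ω^3^ (j₁))

      ρω : ρ ω ≡ ω
      ρω = trans (ρ≡ ω) (trans (cong (ω *_) (ω^3^ (j₂))) (*-identityʳ ω))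

      ωωω : ω * (ω * ω) ≡ 1#
      ωωω = trans (cong (λ w → ω * (ω * w)) (sym (*-identityʳ ω))) ω³≡1

    T : M² → M²
    T (x , y) = ω * x , ω * ω * y

    -- The first component is unchanged because ω^(q+1) = 1, the second because ω^r = ω and ω ω² =
    -- 1.
    F-T : ∀ z → F (T z) ≡ F z
    F-T z@(x , y) = trans (F≡F̂ (T z)) (trans (cong₂ _,_
      (cong₂ (λ v w → v + B * w) (s-inv x) (trans (cong (λ w → s w * w) (*-assoc ω ω y)) (trans (s-inv (ω * y)) (s-inv y))))
      (cong₂ (λ v w → v + b * w) (begin
          ρ (ω * x) * (ω * ω * y)        ≡⟨ cong (_* (ω * ω * y)) (trans (ρ-* ω x) (cong (_* ρ x) ρω)) ⟩
          ω * ρ x * (ω * ω * y)          ≡⟨ solve 3 (λ w x y → w :* x :* (w :* w :* y) := w :* (w :* w) :* (x :* y)) refl ω (ρ x) y ⟩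
          ω * (ω * ω) * (ρ x * y)        ≡⟨ trans (cong (_* (ρ x * y)) ωωω) (*-identityˡ _) ⟩
          ρ x * y                        ∎)
        (begin
          ω * x * ρ (ω * ω * y)          ≡⟨ cong (ω * x *_) (trans (ρ-* (ω * ω) y) (cong (_* ρ y) (trans (ρ-* ω ω) (cong₂ _*_ ρω ρω)))) ⟩
          ω * x * (ω * ω * ρ y)          ≡⟨ solve 3 (λ w x y → w :* x :* (w :* w :* y) := w :* (w :* w) :* (x :* y)) refl ω x (ρ y) ⟩
          ω * (ω * ω) * (x * ρ y)        ≡⟨ trans (cong (_* (x * ρ y)) ωωω) (*-identityˡ _) ⟩
          x * ρ y                        ∎)))
      (sym (F≡F̂ z)))
      where
      s-inv : ∀ x → s (ω * x) * (ω * x) ≡ s x * x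
      s-inv x = begin
        s (ω * x) * (ω * x)    ≡⟨ cong (_* (ω * x)) (s-* ω x) ⟩
        s ω * s x * (ω * x)    ≡⟨ solve 4 (λ v x w y → v :* x :* (w :* y) := v :* w :* (x :* y)) refl (s ω) (s x) ω x ⟩
        s ω * ω * (s x * x)    ≡⟨ trans (cong (_* (s x * x)) sωω) (*-identityˡ _) ⟩
        s x * x                ∎

    -- Both ω and ω² are roots of x² + x + 1, so T² = T + 1. In particular T c + c = T² c, a point
    -- where `F` takes the same value as at T c.
    T-T : ∀ z → T (T z) ≡ T z +² z
    T-T (x , y) = cong₂ _,_
      (begin
        ω * (ω * x)         ≡⟨ *-assoc ω ω x ⟨
        ω * ω * x           ≡⟨ cong (_* x) ωω≡ω+1 ⟩
        (ω + 1#) * x        ≡⟨ trans (distribʳ x ω 1#) (cong (ω * x +_) (*-identityˡ x)) ⟩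
        ω * x + x           ∎)
      (begin
        ω * ω * (ω * ω * y)      ≡⟨ solve 2 (λ w y → w :* w :* (w :* w :* y) := w :* (w :* w) :* (w :* y)) refl ω y ⟩
        ω * (ω * ω) * (ω * y)    ≡⟨ trans (cong (_* (ω * y)) ωωω) (*-identityˡ _) ⟩
        ω * y                    ≡⟨ solve 2 (λ w y → w :* y := (w :+ con true) :* y :+ y) refl ω y ⟩
        (ω + 1#) * y + y         ≡⟨ cong (λ w → w * y + y) ωω≡ω+1 ⟨
        ω * ω * y + y            ∎)

    T-T-T : ∀ z → T (T (T z)) ≡ z
    T-T-T z = begin
      T (T (T z))         ≡⟨ T-T (T z) ⟩
      T (T z) +² T z      ≡⟨ +²-comm _ _ ⟩
      T z +² T (T z)      ≡⟨ cong (T z +²_) (T-T z) ⟩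
      T z +² (T z +² z)   ≡⟨ +²-self-cancel (T z) z ⟩
      z                   ∎

    T-nonZero : ∀ {z} → z ≢ 0² → T z ≢ 0²
    T-nonZero {z} z≢0 Tz≡0 = z≢0 (trans (sym (T-T-T z)) (trans (cong (T ∘ T) Tz≡0)
      (trans (cong T T0) T0)))
      where
      T0 : T 0² ≡ 0²
      T0 = cong₂ _,_ (zeroʳ _) (zeroʳ _)

    -- For c = z + z′ ≠ 0 the equation F z′ = F z reads polar z c = F c, and T c is a solution of it.
    F-fibre : ∀ z z′ → F z ≡ F z′ → z ≡ z′ ⊎ z ≡ T z′ ⊎ z ≡ T (T z′)
    F-fibre z z′ eq = cases (c ≟² 0²)
      where
      c = z +² z′

      solution : polar z c ≡ polar (T c) c
      solution = +²-cancelˡ (F c) (begin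
        F c +² polar z c          ≡⟨ F-polar z c ⟨
        F (z +² c) +² F z         ≡⟨ cong (λ w → F w +² F z) (+²-self-cancel z z′) ⟩
        F z′ +² F z               ≡⟨ cong (F z′ +²_) eq ⟩
        F z′ +² F z′              ≡⟨ trans (+²-self _) (sym (+²-self _)) ⟩
        F c +² F c                ≡⟨ cong₂ _+²_ (sym (trans (cong F (sym (T-T c))) (trans (F-T (T c)) (F-T c)))) (sym (F-T c)) ⟩
        F (T c +² c) +² F (T c)   ≡⟨ F-polar (T c) c ⟩
        F c +² polar (T c) c      ∎)

      -- As z′ = z + c, the solution z = T c gives z′ = T c + c = T² c, that is z = T² z′. The other
      -- solution z = T² c gives z′ = T c and so z = T z′.
      z≡Tc : z ≡ T c → z ≡ T (T z′)
      z≡Tc p = begin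
        z                 ≡⟨ p ⟩
        T c               ≡⟨ cong T (T-T-T c) ⟨
        T (T (T (T c)))   ≡⟨ cong (T ∘ T) (T-T c) ⟩
        T (T (T c +² c))  ≡⟨ cong (λ w → T (T (w +² c))) p ⟨
        T (T (z +² c))    ≡⟨ cong (T ∘ T) (+²-self-cancel z z′) ⟩
        T (T z′)          ∎

      z≡TTc : z ≡ T c +² c → z ≡ T z′
      z≡TTc p = begin
        z                     ≡⟨ trans p (sym (T-T c)) ⟩
        T (T c)               ≡⟨ cong T (trans (+²-comm (T c +² c) c) (trans (cong (c +²_) (+²-comm (T c) c)) (+²-self-cancel c (T c)))) ⟨
        T (T c +² c +² c)     ≡⟨ cong (λ w → T (w +² c)) p ⟨
        T (z +² c)            ≡⟨ cong T (+²-self-cancel z z′) ⟩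
        T z′                  ∎

      cases : Dec (c ≡ 0²) → z ≡ z′ ⊎ z ≡ T z′ ⊎ z ≡ T (T z′)
      cases (yes p)  = inj₁ (z+c≡0⇒z≡c p)
      cases (no c≢0) = inj₂ ([ inj₂ ∘ z≡Tc , inj₁ ∘ z≡TTc ]′ (polar-coset {z} {T c} c≢0 solution))

    F0≡0 : F 0² ≡ 0²
    F0≡0 = trans (F≡F̂ 0²) (cong₂ _,_
      (trans (cong₂ _+_ (zeroʳ _) (trans (cong (B *_) (zeroʳ _)) (zeroʳ B))) (+-identityˡ 0#))
      (trans (cong₂ _+_ (zeroʳ _) (trans (cong (b *_) (zeroˡ _)) (zeroʳ b))) (+-identityˡ 0#)))

    F≡0⇒≡0 : ∀ z → F z ≡ 0² → z ≡ 0²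
    F≡0⇒≡0 z Fz≡0 with z ≟² 0²
    ... | yes z≡0 = z≡0
    ... | no z≢0 = [ sym , [ ⊥-elim ∘ nonZero ∘ sym , ⊥-elim ∘ nonZero′ ∘ sym ]′ ]′
        (F-fibre 0² z (trans F0≡0 (sym Fz≡0)))
      where
      nonZero : T z ≢ 0²
      nonZero = T-nonZero z≢0
      nonZero′ : T (T z) ≢ 0²
      nonZero′ = T-nonZero nonZero

    orbit : M² → List M²
    orbit z = z ∷ T z ∷ T (T z) ∷ []

    -- By T² = T + 1, a coincidence of two points of the orbit would make the third one zero.
    orbit-unique : ∀ {z} → z ≢ 0² → Unique (orbit z)
    orbit-unique {z} z≢0 = (Tz≢z ∘ sym ∷ TTz≢z ∘ sym ∷ []) ∷ (TTz≢Tz ∘ sym ∷ []) ∷ [] ∷ []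
      where
      Tz≢z : T z ≢ z
      Tz≢z p = T-nonZero (T-nonZero z≢0) (trans (T-T z) (trans (cong (_+² z) p) (+²-self z)))
      TTz≢Tz : T (T z) ≢ T z
      TTz≢Tz p = z≢0 (trans (sym (+²-self-cancel (T z) z)) (trans (cong (T z +²_) (trans (sym (T-T z)) p)) (+²-self (T z))))
      TTz≢z : T (T z) ≢ z
      TTz≢z p = T-nonZero z≢0 (trans (sym (+²-self-cancel z (T z)))
        (trans (cong (z +²_) (trans (+²-comm z (T z)) (trans (sym (T-T z)) p))) (+²-self z)))

    F-fibre⇔orbit : ∀ {w} z → F z ≡ w → ∀ z′ → F z′ ≡ w ⇔ z′ ∈ orbit z
    F-fibre⇔orbit {w} z Fz≡w z′ = mk⇔
      (λ Fz′≡w → [ here , there ∘ [ here , there ∘ here ]′ ]′ (F-fibre z′ z (trans Fz′≡w (sym Fz≡w))))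
      λ { (here p) → trans (cong F p) Fz≡w
        ; (there (here p)) → trans (cong F p) (trans (F-T z) Fz≡w)
        ; (there (there (here p))) → trans (cong F p) (trans (F-T (T z)) (trans (F-T z) Fz≡w))
        ; (there (there (there ()))) }

    F-threeToOne : ThreeToOne F
    F-threeToOne = (λ z → mk⇔ (F≡0⇒≡0 z) (λ z≡0 → trans (cong F z≡0) F0≡0)) , λ w w≢0 (z , Fz≡w) →
      length-filter (λ z → F z ≟² w) elements²-unique ∈-elements²
        (orbit-unique λ z≡0 → w≢0 (trans (sym Fz≡w) (trans (cong F z≡0) F0≡0)))
        (F-fibre⇔orbit z Fz≡w)

    -- Transport to the field in which the trace is taken.

    module _ {n : ℕ} (L : BinaryField n) (φ : LinearIdentification L) where
      private
        module L = FieldProperties L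
        open LinearIdentification φ using (to-+; transport; bijection)
        φ→ : M² → L.Carrier
        φ→ = LinearIdentification.to φ
        φ← : L.Carrier → M²
        φ← = LinearIdentification.from φ

        φ→φ← : ∀ x → φ→ (φ← x) ≡ x
        φ→φ← = Inverse.strictlyInverseˡ bijection

        φ←φ→ : ∀ z → φ← (φ→ z) ≡ z
        φ←φ→ = Inverse.strictlyInverseʳ bijection

        φ←-+ : ∀ x y → φ← (x L.+ y) ≡ φ← x +² φ← y
        φ←-+ x y = begin
          φ← (x L.+ y)                         ≡⟨ cong₂ (λ v w → φ← (v L.+ w)) (φ→φ← x) (φ→φ← y) ⟨
          φ← (φ→ (φ← x) L.+ φ→ (φ← y))         ≡⟨ cong φ← (to-+ (φ← x) (φ← y)) ⟨
          φ← (φ→ (φ← x +² φ← y))               ≡⟨ φ←φ→ _ ⟩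
          φ← x +² φ← y                         ∎

        φ→0 : φ→ 0² ≡ L.0#
        φ→0 = trans (cong φ→ (sym (+²-self 0²))) (trans (to-+ 0² 0²) (L.x+x≡0 (φ→ 0²)))

        φ←≡0 : ∀ {x} → φ← x ≡ 0² → x ≡ L.0#
        φ←≡0 {x} eq = trans (sym (φ→φ← x)) (trans (cong φ→ eq) φ→0)

        φ→-injective : ∀ {z w} → φ→ z ≡ φ→ w → z ≡ w
        φ→-injective eq = trans (sym (φ←φ→ _)) (trans (cong φ← eq) (φ←φ→ _))

      polarᴸ : L.Carrier → L.Carrier → L.Carrier
      polarᴸ x y = φ→ (polar (φ← x) (φ← y))

      transport-+ : ∀ x y → transport F (x L.+ y) ≡ transport F x L.+ transport F y L.+ polarᴸ x y
      transport-+ x y = begin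
        φ→ (F (φ← (x L.+ y)))                                ≡⟨ cong (φ→ ∘ F) (φ←-+ x y) ⟩
        φ→ (F (φ← x +² φ← y))                                ≡⟨ cong φ→ (F-+ (φ← x) (φ← y)) ⟩
        φ→ (F (φ← x) +² F (φ← y) +² polar (φ← x) (φ← y))     ≡⟨ to-+ _ _ ⟩
        φ→ (F (φ← x) +² F (φ← y)) L.+ polarᴸ x y             ≡⟨ cong (L._+ polarᴸ x y) (to-+ _ _) ⟩
        transport F x L.+ transport F y L.+ polarᴸ x y       ∎

      polarᴸ-+ˡ : ∀ x x′ y → polarᴸ (x L.+ x′) y ≡ polarᴸ x y L.+ polarᴸ x′ y
      polarᴸ-+ˡ x x′ y = trans (cong (λ z → φ→ (polar z (φ← y))) (φ←-+ x x′))
        (trans (cong φ→ (polar-+ˡ (φ← x) (φ← x′) (φ← y))) (to-+ _ _))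

      transport≡0⇒≡0 : ∀ x → transport F x ≡ L.0# → x ≡ L.0#
      transport≡0⇒≡0 x eq = φ←≡0 (F≡0⇒≡0 (φ← x) (φ→-injective (trans eq (sym φ→0))))

      transport-fibre : ∀ x → x ≢ L.0# → length (filter (λ y → transport F x L.≟ transport F y) L.elements) ≡ 3
      transport-fibre x x≢0 = length-filter (λ y → transport F x L.≟ transport F y) L.elements-unique L.∈-elements
        (Unique.map⁺ φ→-injective (orbit-unique (x≢0 ∘ φ←≡0)))
        λ y → mk⇔
          (λ eq → subst (_∈ map φ→ (orbit (φ← x))) (φ→φ← y)
            (∈-map⁺ φ→ (Equivalence.to (F-fibre⇔orbit (φ← x) refl (φ← y)) (sym (φ→-injective eq)))))
          (λ y∈ → fibre y (∈-map⁻ φ→ y∈))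
        where
        fibre : ∀ y → (∃ λ z → z ∈ orbit (φ← x) × y ≡ φ→ z) → transport F x ≡ transport F y
        fibre y (z , z∈ , y≡) = cong φ→ (sym (Equivalence.from (F-fibre⇔orbit (φ← x) refl (φ← y))
          (subst (_∈ orbit (φ← x)) (trans (sym (φ←φ→ z)) (cong φ← (sym y≡))) z∈)))

    F-spectrum : m ≢ 0 → (L : BinaryField (2 ℕ.* m)) (φ : LinearIdentification L) →
      Walsh.ClassicalWalshSpectrum L (LinearIdentification.transport φ F)
    F-spectrum m≢0 L φ = quadratic∧threeToOne⇒classical m L m≢0 (LinearIdentification.transport φ F) (polarᴸ L φ)
      (transport-+ L φ) (polarᴸ-+ˡ L φ) (λ x y → cong (LinearIdentification.to φ) (polar-sym _ _))
      (transport≡0⇒≡0 L φ) (transport-fibre L φ)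

-- The embedded subfield with 2^(m/2) elements.

module SubfieldEmbedding {h m : ℕ} (K : BinaryField h) (M : BinaryField m)
  (ι : BinaryField.Carrier K → BinaryField.Carrier M)
  (ι-hom : IsRingHomomorphism (BinaryField.rawRing K) (BinaryField.rawRing M) ι) where
  open IsRingHomomorphism ι-hom
  private
    module K = FieldProperties K
    module M = FieldProperties M

  ι-^ : ∀ x n → ι (x K.^ n) ≡ ι x M.^ n
  ι-^ x zero    = 1#-homo
  ι-^ x (suc n) = trans (*-homo x (x K.^ n)) (cong (ι x M.*_) (ι-^ x n))

  -- The form in which membership of `a` in the subfield is used: τ fixes it.
  ι-fixed : ∀ x → ι x M.^ (2 ℕ.^ h) ≡ ι x
  ι-fixed x = trans (sym (ι-^ x (2 ℕ.^ h))) (cong ι (K.fermat x))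

  ι-nonZero : ∀ {x} → x ≢ K.0# → ι x ≢ M.0#
  ι-nonZero {x} x≢0 ιx≡0 = M.0#≢1# (begin
    M.0#                     ≡⟨ M.zeroˡ _ ⟨
    M.0# M.* ι (x K.⁻¹)      ≡⟨ cong (M._* ι (x K.⁻¹)) ιx≡0 ⟨
    ι x M.* ι (x K.⁻¹)       ≡⟨ *-homo x (x K.⁻¹) ⟨
    ι (x K.* x K.⁻¹)         ≡⟨ cong ι (K.*-inverseʳ x≢0) ⟩
    ι K.1#                   ≡⟨ 1#-homo ⟩
    M.1#                     ∎)
    where open ≡-Reasoning

open import Data.Nat.Base using (_+_; _*_; _^_)

theoremC3 :
    (m : ℕ) → m % 4 ≡ 2 →
    (M : BinaryField m) →
    let module M = BinaryField M
        open Plane M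
    in
    (k : ℕ) → 0 < k → k < m → gcd k m ≡ 1 →
    let q = 2 ^ k
        r = 2 ^ (k + m / 2)
    in
    -- the subfield of M with 2^(m/2) elements, given by its embedding
    (K : BinaryField (m / 2)) →
    let module K = BinaryField K in
    (ι : K.Carrier → M.Carrier) → IsRingHomomorphism K.rawRing M.rawRing ι →
    (a : K.Carrier) → a ≢ K.0# →
    (B : M.Carrier) → B ≢ M.0# → (∀ z → z M.^ 3 ≢ B) →
    B M.^ (q + r) ≢ ι a M.^ (q + 1) →
    let F = family₄ q r (ι a) B in
    APN F ×
    ThreeToOne F ×
    ((L : BinaryField (2 * m)) (φ : LinearIdentification L) →
      Walsh.ClassicalWalshSpectrum L (LinearIdentification.transport φ F))
theoremC3 m m%4≡2 M k _ _ gcd≡1 K ι ι-hom a a≢0 B B≢0 B-nonCube B-a =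
  F-APN , F-threeToOne , F-spectrum m≢0
  where
  m≡ : m ≡ (1 + 2 * (m / 4)) * 2
  m≡ = proj₁ (m%4≡2⇒m/2 m m%4≡2)

  m/2≡ : m / 2 ≡ 1 + 2 * (m / 4)
  m/2≡ = proj₂ (m%4≡2⇒m/2 m m%4≡2)

  m≡h+h : m ≡ m / 2 + m / 2
  m≡h+h = trans (trans m≡ (cong (_* 2) (sym m/2≡))) (trans (ℕ.*-comm (m / 2) 2) (cong (m / 2 +_) (ℕ.+-identityʳ (m / 2))))

  m≢0 : m ≢ 0
  m≢0 m≡0 = 0≢2 (trans (cong (_% 4) (sym m≡0)) m%4≡2)
    where
    0≢2 : 0 ≢ 2
    0≢2 ()

  k≡ : ∃ λ c → k ≡ 1 + 2 * c
  k≡ = coprime-even⇒odd k (divides (1 + 2 * (m / 4)) m≡) gcd≡1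

  q+1≡ : ∃ λ j → 2 ^ k + 1 ≡ j * 3
  q+1≡ = 2^odd+1 {c = proj₁ k≡} (proj₂ k≡)

  r≡ : ∃ λ j → 2 ^ (k + m / 2) ≡ 1 + j * 3
  r≡ = 2^odd+odd {c = proj₁ k≡} {m / 4} (proj₂ k≡) m/2≡

  2^h≡ : ∃ λ j → 2 ^ (m / 2) ≡ 2 + j * 3
  2^h≡ = 2^odd {c = m / 4} m/2≡

  open SubfieldEmbedding K M ι ι-hom using (ι-fixed; ι-nonZero)
  open Family₄ M k (m / 2) gcd≡1 m≡h+h
    {proj₁ q+1≡} {proj₁ r≡} {proj₁ 2^h≡} (proj₂ q+1≡) (proj₂ r≡) (proj₂ 2^h≡)
    -- The non-cube `B` also supplies the cube root of unity ω that defines `T`.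
    (ι-nonZero a≢0) (ι-fixed a) B≢0 B-nonCube B-a (proj₂ (Cubes.primitive-cube-root M B-nonCube))
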